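{- Let $B\in\mathbb{R}_{+}$, $F\in\mathbb{N}$, $L\in[1,\infty)$ and $k\in\{0\}\cup\mathbb{N}$. Then there exist constants $K,K'\in(0,1]$ (depending only on $B,F,L,k$) such that the following holds. Let $R$ be a commutative ring, let $d\ge k+2$, let $(X,w)$ be a properly weighted $R$-oriented $d$-poset with $L(X)\le L$ and $F^{\max}_{i,j}(X)\le F$ for all $-1\le i\le j\le k+2$, let $\mathcal{P}$ be a $k$-intersection profile for $X$ and $\mathcal{P}'$ a $(k+1)$-intersection profile for $X$. Let $\mathcal{F}$ be an $R$-sheaf on $X$, let $\varepsilon\in(0,1]$ and $B'\in[1,\infty)$, and suppose that: (1a) $\mathrm{cbe}_{k-\dim u-1}(X_u,w_u,\mathcal{F}_u)\ge\varepsilon$ for every $u\in X(0)\cup\dots\cup X(k)$; (1b) $\mathrm{cbe}_{k-\dim u}(X_u,w_u,\mathcal{F}_u)\ge\varepsilon$ for every $u\in X(0)\cup\dots\cup X(k+1)$; (2a) for every $(t,\ell,r,b)\in\mathcal{P}\cup\mathcal{P}'$ with $b>-1$ and every $u\in X(b)$, $\mathrm{NIH}^{\ell,r,t}_u(X,w)$ is a $\big((K\varepsilon)^{2^{k+1-r}},B(K\varepsilon)^{ -2^{k+1-r}(2^{(r-1)-b}-1)}\big)$-skeleton expander; (2b) for every $(t,\ell,r,b)\in\mathcal{P}\cup\mathcal{P}'$ with $b=-1$, $\mathrm{NIH}^{\ell,r,t}(X,w)$ is a $\big((K\varepsilon)^{2^{k+1-r}},B'B(K\varepsilon)^{ -2^{k+1-r}(2^{r}-1)}\big)$-skeleton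 expander. Suppose further that $B^k(X,\mathcal{F})=0$, that there is a finite $R$-module $\Sigma$ with $\mathcal{F}(x)=\Sigma$ for every $x\in X(k)$, and that there are $M,M'\in\mathbb{R}_+$ with $w(x)\le Mw(y)$ for all $x,y\in X(k)$ and $w(x')\le M'w(y')$ for all $x',y'\in X(k+1)$. Then the $k$-cocycle code $Z^k=Z^k(X,\mathcal{F})\subseteq\Sigma^{X(k)}$ satisfies $\delta(Z^k)\ge\frac1MB'^{ -1}K'(K\varepsilon)^{2^{k+1}-1}$ and its natural tester has soundness $\frac{1}{MM'}B'^{ -1}K'(K\varepsilon)^{2^{k+2}-1}$. Moreover, the Correction Algorithm with $q=K(K\varepsilon)^{2^{k+1}-1}$ is a decoding algorithm for $Z^k$ that works for words that are $\frac{B'^{ -1}K'^2(K\varepsilon)^{2^{k+2}-1}}{M(1+K'(K\varepsilon)^{2^{k+1}})}$-close to $Z^k$.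
   Context: **Posets.** All posets are finite; $x\lhd y$ means $x<y$ with no element strictly between. A graded poset is a poset $X$ with $\dim:X\to\mathbb{Z}$ such that $x\le y$ implies $\dim x\le\dim y$ and $x\lhd y$ implies $\dim y=\dim x+1$. Put $X(i)=\{x\in X:\dim x=i\}$ ($i$-faces), $x(i)=\{y\in X(i):y\le x\}$, and $A_x=\{a\in A:a\ge x\}$ for $A\subseteq X$. A $d$-poset ($d\ge 0$) is a nonempty graded poset in which every face is $\le$ some $d$-face and which has a face $\emptyset_X$ with $\dim\emptyset_X=-1$ and $\emptyset_X\le x$ for all $x$. For a subset $A$ of a $d$-poset, $\mathrm{Inf}\,A$ is the set of maximal lower bounds of $A$. **Face counts.** For $i\le j\le k$, $F^{\max}_{i,j,k}(X)$ (resp. $F^{\min}_{i,j,k}(X)$) is the maximal (resp. minimal) number of $y\in X(j)$ with $x\le y\le z$, over all $x\in X(i)$, $z\in X(k)$ with $x\le z$. Write $F^{\max}_{j,k}=F^{\max}_{ -1,j,k}$ and $L(X)=\max_{ -1\le i\le j\le k\le d}F^{\max}_{i,j,k}/F^{\min}_{i,j,k}$. **Weights and links.** A proper weight function on a $d$-poset $X$ is $w:X\to\mathbb{R}_+$ (positive reals) with $\sum_{y\in X(d)}w(y)=1$ and $w(x)=\sum_{y\in X(d),\,y\ge x}w(y)/|y(i)|$ for all $x\in X(i)$ and all $i$. For $A\subseteq X$, $w(A)=\sum_{a\in A}w(a)$. For $z\in X$ the link is $X_z=\{x\in X:x\ge z\}$ with $\dim_{X_z}x=\dim x-\dim z-1$,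 given the proper weight function $w_z(x)=\frac{1}{w(X(d)_z)}\sum_{y\in X(d)_x}\frac{w(y)}{\#\{x'\in X(\dim x):z\le x'\le y\}}$. **Orientation, sheaves, cohomology.** An $R$-orientation on $X$ assigns $[y:x]\in R^\times$ to each $x\lhd y$ so that $\sum_{y:x<y<z}[z:y][y:x]=0$ whenever $x\le z$ and $\dim z=\dim x+2$; links carry the restricted orientation. An $R$-sheaf $\mathcal{F}$ on $X$ consists of $R$-modules $\mathcal{F}(x)$ ($x\in X$) and $R$-linear maps $\mathrm{res}_{y\leftarrow x}:\mathcal{F}(x)\to\mathcal{F}(y)$ ($x<y$) with $\mathrm{res}_{z\leftarrow y}\circ\mathrm{res}_{y\leftarrow x}=\mathrm{res}_{z\leftarrow x}$ for $x<y<z$. $\mathcal{F}_z$ is the restriction of $\mathcal{F}$ to $X_z$. $C^i=C^i(X,\mathcal{F})=\prod_{x\in X(i)}\mathcal{F}(x)$; $d=d_i:C^i\to C^{i+1}$ is $(d_if)(y)=\sum_{x\in y(i)}[y:x]\,\mathrm{res}_{y\leftarrow x}f(x)$; $Z^i=\ker d_i$, $B^i=\mathrm{im}\,d_{i-1}$. **Expansion.** For $f,g\in C^i$: $\|f\|_w=w(\{x:f(x)\ne0\})$, $\mathrm{dist}_w(f,g)=\|f-g\|_w$. $\mathrm{cbe}_i(X,w,\mathcal{F})$ is the supremum of the $\mu\ge 0$ with $\|df\|_w\ge\mu\,\mathrm{dist}_w(f,B^i)$ for all $f\in C^i$. **No-intersection hypergraphs, skeleton expansion.** For a weighted $d$-poset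 $(X,w)$ and $i,j,k\in\{0,\dots,d\}$ with $i,j<k$, $\mathrm{NIH}^{i,j,k}(X,w)$ is the hypergraph with vertex set $X(i)\cup X(j)$ and hyperedge set $X(k)$ (incidence from $X$), with weights: $w(z)$ for a hyperedge $z$; for a vertex $x$, $w(x)$ if $i=j$ and $\frac12w(x)$ if $i\ne j$; and with relation on vertices: $x\sim y$ iff some $z\in X(k)$ has $x,y\le z$, $\mathrm{Inf}\{x,y\}=\{\emptyset_X\}$ and $(\dim x,\dim y)\in\{(i,j),(j,i)\}$. A related weighted hypergraph $(H,w_H,\sim)$ is an $(\alpha,\beta)$-skeleton expander if for every set $A$ of vertices $w_H(E_2(A))\le\alpha w_H(A)+\beta w_H(A)^2$, where $E_2(A)$ is the set of hyperedges $e$ containing two distinct $u,v\in A$ with $u\sim v$. For $z\in X$ with $b=\dim z<i,j$, $\mathrm{NIH}^{i,j,k}_z(X,w)=\mathrm{NIH}^{i-b-1,j-b-1,k-b-1}(X_z,w_z)$. **Intersection profiles.** An abstract $k$-intersection profile $\mathcal{P}$ is a set of integer quadruples $(t,\ell,r,b)$ with $k+1\ge t>\ell\ge r>b\ge-1$, together with a set $\mathrm{Ad}(\mathcal{P})$ of integer pairs $(i,j)$ with $k+1\ge i>j\ge-1$, such that: (i) for $(t,\ell,r,b)\in\mathcal{P}$, $(t,\ell),(t,r),(\ell,b),(r,b)\in\mathrm{Ad}(\mathcal{P})$; (ii) if $t>\ell\ge r>-1$ and $(t,r),(t,\ell)\in\mathrm{Ad}(\mathcal{P})$, then $\mathcal{P}$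 contains a quadruple $(t,\ell,r,*)$; (iii) if $t>\ell>r\ge-1$ and $(t,\ell),(t,r)\in\mathrm{Ad}(\mathcal{P})$, then $(\ell,r)\in\mathrm{Ad}(\mathcal{P})$; (iv) $(k+1,k)$ and $(k+1,-1),(k,-1),\dots,(0,-1)$ are in $\mathrm{Ad}(\mathcal{P})$. A pair of faces $(x,y)$ is $\mathcal{P}$-admissible if $x>y$ and $(\dim x,\dim y)\in\mathrm{Ad}(\mathcal{P})$. $\mathcal{P}$ is a $k$-intersection profile for $X$ if whenever $(x,y),(x,z)$ are $\mathcal{P}$-admissible with $\dim y\ge\dim z$, either $y\ge z$ or $(\dim x,\dim y,\dim z,\dim u)\in\mathcal{P}$ for every $u\in\mathrm{Inf}\{y,z\}$. **Cocycle code.** $Z^k\subseteq C^k=\Sigma^{X(k)}$ is viewed as a code with alphabet $\Sigma$; $\delta(Z^k)$ is its relative distance and closeness refers to the (unweighted) normalized Hamming distance on $\Sigma^{X(k)}$. Natural tester: choose $y\in X(k+1)$ uniformly at random, read $f(x)$ for $x\in y(k)$, accept iff $(d_kf)(y)=0$. Soundness $\mu$ means $\mathrm{Prob}(\text{reject }f)\ge\mu\,\mathrm{dist}(f,Z^k)$ for all $f$. A decoding algorithm for words $\eta$-close to $Z^k$ takes $f$ with $\mathrm{dist}(f,Z^k)<\eta$ and outputs the unique $f'\in Z^k$ with $\mathrm{dist}(f,f')<\eta$. **Correction Algorithm.** For $u\in X$ and $g\in C^{k-\dim u-1}(X_u,\mathcal{F}_u)$, let $g^u\in C^k(X,\mathcal{F})$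 be $g^u(x)=g(x)$ if $x\ge u$ and $0$ otherwise. Input: $f\in C^k(X,\mathcal{F})$ and a real $q\ge0$. Set $f_0=f$, $i=0$. While there exist $u\in X(0)\cup\dots\cup X(k)$ and $g\in C^{k-\dim u-1}(X_u,\mathcal{F}_u)$ with $\|df_i+d(g^u)\|_w<\|df_i\|_w-q\,w(u)$, choose such a pair, set $f_{i+1}=f_i+g^u$ and increase $i$ by $1$. Output the last $f_i$. -}

module Defs where

open import Algebra.Bundles using (CommutativeRing; Semiring)
import Algebra.Definitions as AlgebraDefinitions
import Algebra.Definitions.RawSemiring as RawSemiringDefinitions
open import Algebra.Module.Bundles using (Module)
open import Algebra.Module.Morphism.Structures using (module ModuleMorphisms)
open import Axiom.ExcludedMiddle using (ExcludedMiddle)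
open import Data.Empty.Irrelevant using (⊥-elim)
open import Data.Irrelevant using ([_])
open import Data.Integer.Base as ℤ using (ℤ; +_; -1ℤ; 0ℤ; 1ℤ; ∣_∣)
import Data.Integer.Properties as ℤ
open import Data.List.Base
  using (List; []; _∷_; foldr; map; filter; length; upTo; cartesianProduct)
open import Data.Integer.Tactic.RingSolver using (solve-∀)
import Data.List.Extrema
import Data.List.Extrema.Nat as ℕ-Extrema
open import Data.List.Membership.Propositional using (_∈_)
import Data.List.Relation.Unary.All as All
open import Data.List.Relation.Unary.AllPairs using ([]; _∷_)
open import Data.List.Relation.Unary.Any using (here; there)
import Data.List.Relation.Unary.Enumerates.Setoid as Enumerates
open import Data.List.Relation.Unary.Unique.Propositional using (Unique)
open import Data.Nat.Base as ℕ using (ℕ)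
open import Data.Product.Base using (∃; ∃-syntax; _×_; _,_; proj₁; proj₂)
open import Data.Refinement.Base using (Refinement-syntax; _,_; value)
open import Data.Sum.Base using (_⊎_)
open import Function.Base using (_∘_; flip; _on_)
open import Induction.WellFounded using (Acc)
open import Level using (Level; 0ℓ; _⊔_) renaming (suc to lsuc)
open import Relation.Binary.Bundles using (Setoid; TotalOrder)
open import Relation.Binary.Construct.Closure.ReflexiveTransitive using (Star)
import Relation.Binary.Construct.NonStrictToStrict as NonStrictToStrict
open import Relation.Binary.Core using (Rel)
open import Relation.Binary.PropositionalEquality
  using (_≡_; _≢_; refl; sym; trans; cong; subst)
import Relation.Binary.PropositionalEquality.Properties as ≡
open import Relation.Binary.Rewriting using (IsNormalForm)
open import Relation.Binary.Structures
  using (IsDecPartialOrder; IsTotalOrder)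
open import Relation.Nullary using (¬_; Dec; yes; no; _×-dec_; _⊎-dec_)
open import Relation.Nullary.Decidable using (map′)
open import Relation.Unary using (Pred; Decidable; Satisfiable; ｛_｝; _∪_; _≐_)
  renaming (_∈_ to _∈ₚ_)

private
  variable
    a p r ℓr m ℓm : Level

module Bounds {A : Set a} (_≤_ : Rel A 0ℓ) where

  IsUpperBound : Pred A p → Pred A (a ⊔ p)
  IsUpperBound S b = ∀ {x} → x ∈ₚ S → x ≤ b

  IsLowerBound : Pred A p → Pred A (a ⊔ p)
  IsLowerBound S b = ∀ {x} → x ∈ₚ S → b ≤ x

  IsInfimum : Pred A p → Pred A (a ⊔ p)
  IsInfimum S b = IsLowerBound S b × IsUpperBound (IsLowerBound S) b

  IsSupremum : Pred A p → Pred A (a ⊔ p)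
  IsSupremum S b = IsUpperBound S b × IsLowerBound (IsUpperBound S) b

-- The real numbers, axiomatised as a Dedekind-complete ordered field
-- (which determines them up to unique isomorphism).  `_⁻¹` is total; no
-- use below depends on its value at 0#.

record CompleteOrderedField : Set₁ where
  infix  4 _≤_
  infix  8 _⁻¹
  infixl 7 _/_

  field
    commutativeRing : CommutativeRing 0ℓ 0ℓ
  open CommutativeRing commutativeRing public

  field
    0≉1          : 0# ≉ 1#
    _⁻¹          : Carrier → Carrier
    ⁻¹-cong      : ∀ {x y} → x ≈ y → x ⁻¹ ≈ y ⁻¹
    *-inverseʳ   : ∀ {x} → x ≉ 0# → x * x ⁻¹ ≈ 1#
    _≤_          : Rel Carrier 0ℓ
    isTotalOrder : IsTotalOrder _≈_ _≤_
    +-monoˡ-≤    : ∀ {x y} z → x ≤ y → x + z ≤ y + z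
    *-nonNeg     : ∀ {x y} → 0# ≤ x → 0# ≤ y → 0# ≤ x * y

  open NonStrictToStrict _≈_ _≤_ public using (_<_)
  open Bounds _≤_ public
  open RawSemiringDefinitions (Semiring.rawSemiring semiring) public using (_^_) renaming (_×_ to _·_)

  field
    complete : (S : Pred Carrier 0ℓ) → Satisfiable S →
               Satisfiable (IsUpperBound S) → Satisfiable (IsSupremum S)

  -- c ≤ inf S and c ≤ sup S, with values in the extended real line:
  -- inf ∅ = ∞, and sup S = ∞ if S is unbounded above.
  _≤inf_ _≤sup_ : Carrier → Pred Carrier p → Set p
  c ≤inf S = IsLowerBound S c
  c ≤sup S = ∀ b → IsUpperBound S b → c ≤ b

  totalOrder : TotalOrder 0ℓ 0ℓ 0ℓ
  totalOrder = record { isTotalOrder = isTotalOrder }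

  _/_ : Carrier → Carrier → Carrier
  x / y = x * y ⁻¹

  fromℕ : ℕ → Carrier
  fromℕ n = n · 1#

  ½ : Carrier
  ½ = fromℕ 2 ⁻¹

  ∑ : {A : Set a} → List A → (A → Carrier) → Carrier
  ∑ xs f = foldr _+_ 0# (map f xs)

-- All exponents at which this is used are non-negative.
2^_ : ℤ → ℕ
2^ n = 2 ℕ.^ ∣ n ∣

module _ {A : Set a} {P : Pred A p} where

  value-injective : {x y : [ z ∈ A ∣ P z ]} → value x ≡ value y → x ≡ y
  value-injective {_ , _} {_ , _} refl = refl

  collect : Decidable P → List A → List [ x ∈ A ∣ P x ]
  collect P? []       = []
  collect P? (x ∷ xs) with P? x
  ... | yes px = (x , [ px ]) ∷ collect P? xs
  ... | no  _  = collect P? xs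

  ∈-collect⁺ : (P? : Decidable P) (x : [ z ∈ A ∣ P z ]) {xs : List A} →
               value x ∈ xs → x ∈ collect P? xs
  ∈-collect⁺ P? (x , [ px ]) {y ∷ xs} x∈ with P? y | x∈
  ... | yes _  | here refl = here refl
  ... | yes _  | there x∈′ = there (∈-collect⁺ P? (x , [ px ]) x∈′)
  ... | no ¬py | here refl = ⊥-elim (¬py px)
  ... | no _   | there x∈′ = ∈-collect⁺ P? (x , [ px ]) x∈′

  ∈-collect⁻ : (P? : Decidable P) {x : [ z ∈ A ∣ P z ]} {xs : List A} →
               x ∈ collect P? xs → value x ∈ xs
  ∈-collect⁻ P? {xs = y ∷ xs} x∈ with P? y | x∈
  ... | yes _ | here refl = here refl
  ... | yes _ | there x∈′ = there (∈-collect⁻ P? x∈′)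
  ... | no _  | x∈′       = there (∈-collect⁻ P? x∈′)

  collect-unique : (P? : Decidable P) {xs : List A} →
                   Unique xs → Unique (collect P? xs)
  collect-unique P? []                   = []
  collect-unique P? {x ∷ xs} (x∉ ∷ uniq) with P? x
  ... | yes _ = All.tabulate (λ y∈ x≡y →
                  All.lookup x∉ (∈-collect⁻ P? y∈) (cong value x≡y))
                ∷ collect-unique P? uniq
  ... | no _  = collect-unique P? uniq

-- Finite graded posets with a least face ∅ of dimension -1.  The
-- conditions specific to a d-poset are kept apart in `IsDPoset`, because
-- the link of a top-dimensional face is a poset of this kind but not a
-- d-poset for any d ≥ 0.

record GradedPoset : Set₁ where
  infix 4 _≤_ _⋖_

  field
    Carrier           : Set
    _≤_               : Rel Carrier 0ℓ
    isDecPartialOrder : IsDecPartialOrder _≡_ _≤_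
    elements          : List Carrier
    elements-complete : ∀ x → x ∈ elements
    elements-unique   : Unique elements

  open IsDecPartialOrder isDecPartialOrder public
    using (_≟_; _≤?_; antisym) renaming (refl to ≤-refl; trans to ≤-trans)
  open NonStrictToStrict _≡_ _≤_ public using (_<_)
  open Bounds _≤_ using (IsLowerBound)

  _⋖_ : Rel Carrier 0ℓ
  x ⋖ y = x < y × ¬ (∃[ z ] x < z × z < y)

  field
    dim      : Carrier → ℤ
    dim-mono : ∀ {x y} → x ≤ y → dim x ℤ.≤ dim y
    dim-⋖    : ∀ {x y} → x ⋖ y → dim y ≡ dim x ℤ.+ 1ℤ
    ∅        : Carrier
    ∅-dim    : dim ∅ ≡ -1ℤ
    ∅-min    : ∀ x → ∅ ≤ x

  Face : ℤ → Set
  Face i = [ x ∈ Carrier ∣ dim x ≡ i ]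

  faces : ∀ i → List (Face i)
  faces i = collect (λ x → dim x ℤ.≟ i) elements

  cast : ∀ {i j} → .(i ≡ j) → Face i → Face j
  cast i≡j (x , [ e ]) = x , [ trans e i≡j ]

  facesBelow : ∀ y i → List [ x ∈ Carrier ∣ dim x ≡ i × x ≤ y ]
  facesBelow y i = collect (λ x → dim x ℤ.≟ i ×-dec x ≤? y) elements

  facesAbove : ∀ i → Carrier → List (Face i)
  facesAbove i x = filter (λ y → x ≤? value y) (faces i)

  facesBetween : Carrier → ∀ i → Carrier → List (Face i)
  facesBetween x i z = filter (λ y → x ≤? value y ×-dec value y ≤? z) (faces i)

  Inf : Pred Carrier 0ℓ → Pred Carrier 0ℓ
  Inf A u = IsLowerBound A u × (∀ {v} → IsLowerBound A v → u ≤ v → u ≡ v)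

  Inf₂ : Carrier → Carrier → Pred Carrier 0ℓ
  Inf₂ x y = Inf (｛ x ｝ ∪ ｛ y ｝)

  IsDPoset : ℕ → Set
  IsDPoset d = ∀ x → ∃[ y ] dim y ≡ + d × x ≤ y

  private
    counts : ℤ → ℤ → ℤ → List ℕ
    counts i j k =
      map (λ (x , z) → length (facesBetween (value x) j (value z)))
        (filter (λ (x , z) → value x ≤? value z) (cartesianProduct (faces i) (faces k)))

  -- The first arguments of max and min are the values on empty lists;
  -- they are a lower and an upper bound of all counts, respectively.
  Fᵐᵃˣ Fᵐⁱⁿ : ℤ → ℤ → ℤ → ℕ
  Fᵐᵃˣ i j k = ℕ-Extrema.max 0 (counts i j k)
  Fᵐⁱⁿ i j k = ℕ-Extrema.min (length elements) (counts i j k)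

module _ (X : GradedPoset) (z : GradedPoset.Carrier X) where
  open GradedPoset X

  private
    LinkFace : Set
    LinkFace = [ x ∈ Carrier ∣ z ≤ x ]

    z≤_ : (x : LinkFace) → z ≤ value x
    z≤ (x , [ z≤x ]) with z ≤? x
    ... | yes q = q
    ... | no ¬q = ⊥-elim (¬q z≤x)

    infix 4 _≤ˡ_ _<ˡ_
    _≤ˡ_ : Rel LinkFace 0ℓ
    _≤ˡ_ = _≤_ on value

    _<ˡ_ : Rel LinkFace 0ℓ
    _<ˡ_ = NonStrictToStrict._<_ _≡_ _≤ˡ_

    <ˡ⇒< : ∀ {x y} → x <ˡ y → value x < value y
    <ˡ⇒< (x≤y , x≢y) = x≤y , x≢y ∘ value-injective

    <⇒<ˡ : ∀ {x y} → value x < value y → x <ˡ y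
    <⇒<ˡ (x≤y , x≢y) = x≤y , x≢y ∘ cong value

    dimˡ : LinkFace → ℤ
    dimˡ x = dim (value x) ℤ.- dim z ℤ.- 1ℤ

    ⋖ˡ⇒⋖ : ∀ {x y} → x <ˡ y × ¬ (∃[ u ] x <ˡ u × u <ˡ y) → value x ⋖ value y
    ⋖ˡ⇒⋖ {x} (x<y , none) = <ˡ⇒< x<y , λ (u , x<u , u<y) →
      none ((u , [ ≤-trans (z≤ x) (proj₁ x<u) ]) , <⇒<ˡ x<u , <⇒<ˡ u<y)

    shift : ∀ i j → (i ℤ.+ 1ℤ) ℤ.- j ℤ.- 1ℤ ≡ (i ℤ.- j ℤ.- 1ℤ) ℤ.+ 1ℤ
    shift = solve-∀

    base : ∀ i → i ℤ.- i ℤ.- 1ℤ ≡ -1ℤ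
    base = solve-∀

  link : GradedPoset
  link = record
    { Carrier           = LinkFace
    ; _≤_               = _≤ˡ_
    ; isDecPartialOrder = record
      { isPartialOrder = record
        { isPreorder = record
          { isEquivalence = ≡.isEquivalence
          ; reflexive     = λ { refl → ≤-refl }
          ; trans         = ≤-trans
          }
        ; antisym = λ x≤y y≤x → value-injective (antisym x≤y y≤x)
        }
      ; _≟_  = λ x y → map′ value-injective (cong value) (value x ≟ value y)
      ; _≤?_ = λ x y → value x ≤? value y
      }
    ; elements          = collect (z ≤?_) elements
    ; elements-complete = λ x → ∈-collect⁺ (z ≤?_) x (elements-complete (value x))
    ; elements-unique   = collect-unique (z ≤?_) elements-unique
    ; dim               = dimˡ
    ; dim-mono          = λ x≤y →
        ℤ.+-monoˡ-≤ (ℤ.- 1ℤ) (ℤ.+-monoˡ-≤ (ℤ.- dim z) (dim-mono x≤y))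
    ; dim-⋖             = λ {x} x⋖y →
        trans (cong (λ i → i ℤ.- dim z ℤ.- 1ℤ) (dim-⋖ (⋖ˡ⇒⋖ x⋖y)))
              (shift (dim (value x)) (dim z))
    ; ∅                 = z , [ ≤-refl ]
    ; ∅-dim             = base (dim z)
    ; ∅-min             = z≤_
    }

Quadruple : Set
Quadruple = ℤ × ℤ × ℤ × ℤ

record AbstractIntersectionProfile (k : ℕ) : Set₁ where
  field
    𝒫  : Pred Quadruple 0ℓ
    Ad : Pred (ℤ × ℤ) 0ℓ

    𝒫-range  : ∀ {t ℓ r b} → (t , ℓ , r , b) ∈ₚ 𝒫 →
               t ℤ.≤ + k ℤ.+ 1ℤ × ℓ ℤ.< t × r ℤ.≤ ℓ × b ℤ.< r × -1ℤ ℤ.≤ b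
    Ad-range : ∀ {i j} → (i , j) ∈ₚ Ad →
               i ℤ.≤ + k ℤ.+ 1ℤ × j ℤ.< i × -1ℤ ℤ.≤ j

    𝒫⇒Ad     : ∀ {t ℓ r b} → (t , ℓ , r , b) ∈ₚ 𝒫 →
               (t , ℓ) ∈ₚ Ad × (t , r) ∈ₚ Ad × (ℓ , b) ∈ₚ Ad × (r , b) ∈ₚ Ad
    Ad⇒𝒫     : ∀ {t ℓ r} → ℓ ℤ.< t → r ℤ.≤ ℓ → -1ℤ ℤ.< r →
               (t , r) ∈ₚ Ad → (t , ℓ) ∈ₚ Ad → ∃[ b ] (t , ℓ , r , b) ∈ₚ 𝒫
    Ad-inner : ∀ {t ℓ r} → ℓ ℤ.< t → r ℤ.< ℓ → -1ℤ ℤ.≤ r →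
               (t , ℓ) ∈ₚ Ad → (t , r) ∈ₚ Ad → (ℓ , r) ∈ₚ Ad
    Ad-top   : (+ k ℤ.+ 1ℤ , + k) ∈ₚ Ad
    Ad-∅     : ∀ {i} → 0ℤ ℤ.≤ i → i ℤ.≤ + k ℤ.+ 1ℤ → (i , -1ℤ) ∈ₚ Ad

module _ {k : ℕ} (𝓘 : AbstractIntersectionProfile k) (X : GradedPoset) where
  open AbstractIntersectionProfile 𝓘
  open GradedPoset X

  Admissible : Rel Carrier 0ℓ
  Admissible x y = y < x × (dim x , dim y) ∈ₚ Ad

  IsIntersectionProfileFor : Set
  IsIntersectionProfileFor = ∀ {x y z} → Admissible x y → Admissible x z →
    dim z ℤ.≤ dim y →
    z ≤ y ⊎ (∀ u → u ∈ₚ Inf₂ y z → (dim x , dim y , dim z , dim u) ∈ₚ 𝒫)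

module _ (R : CommutativeRing r ℓr) (X : GradedPoset) where
  open CommutativeRing R using (_≈_; _+_; _*_; 0#; 1#) renaming (Carrier to |R|)
  open AlgebraDefinitions _≈_ using (Invertible)
  open GradedPoset X

  -- `o y x` is [y : x]; only its values on pairs x ⋖ y matter.
  IsOrientation : (o : Carrier → Carrier → |R|) → Set (r ⊔ ℓr)
  IsOrientation o =
    (∀ {x y} → x ⋖ y → Invertible 1# _*_ (o y x)) ×
    (∀ {x z} → x ≤ z → dim z ≡ dim x ℤ.+ + 2 →
       foldr _+_ 0# (map (λ y → o z y * o y x)
         (filter (λ y → (x <? y) ×-dec (y <? z)) elements)) ≈ 0#)
    where
    _<?_ : ∀ x y → Dec (x < y)
    _<?_ = NonStrictToStrict.<-decidable _≡_ _≤_ _≟_ _≤?_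

  record Sheaf m ℓm : Set (r ⊔ ℓr ⊔ lsuc (m ⊔ ℓm)) where
    open Module using (Carrierᴹ; _≈ᴹ_; rawModule)
    open ModuleMorphisms using (IsModuleHomomorphism)
    field
      𝓕       : Carrier → Module R m ℓm
      res     : ∀ {x y} → .(x < y) → Carrierᴹ (𝓕 x) → Carrierᴹ (𝓕 y)
      res-hom : ∀ {x y} .(x<y : x < y) →
                IsModuleHomomorphism (rawModule (𝓕 x)) (rawModule (𝓕 y)) (res x<y)
      res-res : ∀ {x y z} .(x<y : x < y) .(y<z : y < z) .(x<z : x < z) s →
                _≈ᴹ_ (𝓕 z) (res y<z (res x<y s)) (res x<z s)

module _ {R : CommutativeRing r ℓr} (X : GradedPoset) (z : GradedPoset.Carrier X) where
  open CommutativeRing R using () renaming (Carrier to |R|)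
  open GradedPoset X

  linkOrientation : (Carrier → Carrier → |R|) →
                    GradedPoset.Carrier (link X z) → GradedPoset.Carrier (link X z) → |R|
  linkOrientation o y x = o (value y) (value x)

  linkSheaf : Sheaf R X m ℓm → Sheaf R (link X z) m ℓm
  linkSheaf ℱ = record
    { 𝓕       = λ x → 𝓕 (value x)
    ; res     = λ x<y → res (strict x<y)
    ; res-hom = λ x<y → res-hom (strict x<y)
    ; res-res = λ x<y y<z x<z → res-res (strict x<y) (strict y<z) (strict x<z)
    }
    where
    open Sheaf ℱ
    strict : ∀ {x y} → GradedPoset._<_ (link X z) x y → value x < value y
    strict (x≤y , x≢y) = x≤y , x≢y ∘ value-injective

module Cohomology
  {R : CommutativeRing r ℓr} (X : GradedPoset)
  (o : GradedPoset.Carrier X → GradedPoset.Carrier X → CommutativeRing.Carrier R)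
  (ℱ : Sheaf R X m ℓm)
  where
  open GradedPoset X
  open Sheaf ℱ
  module 𝓕 (x : Carrier) = Module (𝓕 x)

  private
    .below : ∀ {i} {x y : Carrier} → dim x ≡ i → dim y ≡ ℤ.suc i → x ≤ y → x < y
    below dx dy x≤y = x≤y , λ { refl → ℤ.i≢suc[i] (trans (sym dx) dy) }

  C : ℤ → Set m
  C i = (x : Face i) → 𝓕.Carrierᴹ (value x)

  _≈ᶜ_ : ∀ {i} → Rel (C i) ℓm
  f ≈ᶜ g = ∀ x → 𝓕._≈ᴹ_ (value x) (f x) (g x)

  0ᶜ : ∀ {i} → C i
  0ᶜ x = 𝓕.0ᴹ (value x)

  _+ᶜ_ _-ᶜ_ : ∀ {i} → C i → C i → C i
  (f +ᶜ g) x = 𝓕._+ᴹ_ (value x) (f x) (g x)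
  (f -ᶜ g) x = 𝓕._+ᴹ_ (value x) (f x) (𝓕.-ᴹ_ (value x) (g x))

  Supp : ∀ {i} → C i → Pred (Face i) ℓm
  Supp f x = ¬ 𝓕._≈ᴹ_ (value x) (f x) (𝓕.0ᴹ (value x))

  d : ∀ {i} → C i → C (ℤ.suc i)
  d {i} f (y , [ dy ]) =
    foldr (𝓕._+ᴹ_ y) (𝓕.0ᴹ y) (map term (facesBelow y i))
    where
    term : [ x ∈ Carrier ∣ dim x ≡ i × x ≤ y ] → 𝓕.Carrierᴹ y
    term (x , [ q ]) =
      𝓕._*ₗ_ y (o y x) (res (below (proj₁ q) dy (proj₂ q)) (f (x , [ proj₁ q ])))

  Z : ∀ i → Pred (C i) ℓm
  Z i f = d f ≈ᶜ 0ᶜ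

  B : ∀ i → Pred (C i) (m ⊔ ℓm)
  B i f = ∃[ g ] f ≈ᶜ (λ x → d {ℤ.pred i} g (cast (sym (ℤ.suc-pred i)) x))

-- `extendByZero X o ℱ u k g` is gᵘ.
module _
  {R : CommutativeRing r ℓr} (X : GradedPoset)
  (o : GradedPoset.Carrier X → GradedPoset.Carrier X → CommutativeRing.Carrier R)
  (ℱ : Sheaf R X m ℓm) (u : GradedPoset.Carrier X)
  where
  open GradedPoset X
  private
    module Cₓ = Cohomology X o ℱ
    module Cᵤ = Cohomology (link X u) (linkOrientation {R = R} X u o) (linkSheaf X u ℱ)

  extendByZero : ∀ k → Cᵤ.C (k ℤ.- dim u ℤ.- 1ℤ) → Cₓ.C k
  extendByZero k g (x , [ dx ]) with u ≤? x
  ... | yes u≤x = g ((x , [ u≤x ]) , [ cong (λ i → i ℤ.- dim u ℤ.- 1ℤ) dx ])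
  ... | no  _   = Cₓ.𝓕.0ᴹ x

-- The mathematics is classical: excluded middle is used to measure arbitrary
-- subsets and to take infima.

module Classical (lem : ∀ {ℓ} → ExcludedMiddle ℓ) (ℝ : CompleteOrderedField) where
  private
    module ℝ = CompleteOrderedField ℝ
  open ℝ using (0#; 1#; _≈_; _≉_; _≤inf_; _≤sup_; _/_; ∑; fromℕ; ½; IsInfimum)
    renaming (Carrier to |ℝ|; _≤_ to _≤ᵣ_; _<_ to _<ᵣ_; _+_ to _+ᵣ_; _*_ to _*ᵣ_)

  -- The infimum of S if it exists, and 0# otherwise.  Below, S is always a
  -- non-empty finite set of values, so its infimum exists and is attained.
  inf : Pred |ℝ| p → |ℝ|
  inf S with lem {P = ∃ (IsInfimum S)}
  ... | yes (s , _) = s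
  ... | no  _       = 0#

  subset : {A : Set a} → List A → Pred A p → List A
  subset xs P = filter (λ x → lem {P = P x}) xs

  private
    -1…_ : ℕ → List ℤ
    -1… d = map (λ n → ℤ.pred (+ n)) (upTo (2 ℕ.+ d))

  -- L(X).  All ratios are non-negative, so starting the maximum at 0# is harmless.
  irregularity : ℕ → GradedPoset → |ℝ|
  irregularity d X = max 0#
    (map (λ (i , j , k) → fromℕ (Fᵐᵃˣ i j k) / fromℕ (Fᵐⁱⁿ i j k))
      (filter (λ (i , j , k) → i ℤ.≤? j ×-dec j ℤ.≤? k)
        (cartesianProduct (-1… d) (cartesianProduct (-1… d) (-1… d)))))
    where
    open GradedPoset X
    open Data.List.Extrema ℝ.totalOrder using (max)

  module _ (d : ℕ) (X : GradedPoset) where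
    open GradedPoset X

    IsProperWeight : (Carrier → |ℝ|) → Set
    IsProperWeight w =
      (∀ x → 0# <ᵣ w x) ×
      ∑ (faces (+ d)) (w ∘ value) ≈ 1# ×
      (∀ x → w x ≈ ∑ (facesAbove (+ d) x)
               (λ y → w (value y) / fromℕ (length (facesBelow (value y) (dim x)))))

    linkWeight : (z : Carrier) → (Carrier → |ℝ|) → GradedPoset.Carrier (link X z) → |ℝ|
    linkWeight z w x =
      ∑ (facesAbove (+ d) (value x))
        (λ y → w (value y) / fromℕ (length (facesBetween z (dim (value x)) (value y))))
      / ∑ (facesAbove (+ d) z) (w ∘ value)

  record WeightedHypergraph : Set₁ where
    field
      Vertex Edge : Set
      vertices    : List Vertex
      edges       : List Edge
      _∈ᴱ_        : Vertex → Edge → Set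
      wᵛ          : Vertex → |ℝ|
      wᴱ          : Edge → |ℝ|
      _∼_         : Rel Vertex 0ℓ

    E₂ : Pred Vertex 0ℓ → Pred Edge 0ℓ
    E₂ A e = ∃[ u ] ∃[ v ] A u × A v × u ∈ᴱ e × v ∈ᴱ e × u ≢ v × u ∼ v

    IsSkeletonExpander : |ℝ| → |ℝ| → Set₁
    IsSkeletonExpander α β = (A : Pred Vertex 0ℓ) →
      let wA = ∑ (subset vertices A) wᵛ in
      ∑ (subset edges (E₂ A)) wᴱ ≤ᵣ (α *ᵣ wA) +ᵣ (β *ᵣ (wA *ᵣ wA))

  open WeightedHypergraph public using (IsSkeletonExpander)

  NIH : (X : GradedPoset) → (GradedPoset.Carrier X → |ℝ|) → ℤ → ℤ → ℤ → WeightedHypergraph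
  NIH X w i j k = record
    { Vertex   = [ x ∈ Carrier ∣ dim x ≡ i ⊎ dim x ≡ j ]
    ; Edge     = Face k
    ; vertices = collect (λ x → dim x ℤ.≟ i ⊎-dec dim x ℤ.≟ j) elements
    ; edges    = faces k
    ; _∈ᴱ_     = λ x z → value x ≤ value z
    ; wᵛ       = λ x → vertexWeight (value x) (i ℤ.≟ j)
    ; wᴱ       = w ∘ value
    ; _∼_      = λ x y →
        (∃[ z ] value x ≤ value {P = λ z → dim z ≡ k} z × value y ≤ value z) ×
        Inf₂ (value x) (value y) ≐ ｛ ∅ ｝ ×
        ((dim (value x) ≡ i × dim (value y) ≡ j) ⊎ (dim (value x) ≡ j × dim (value y) ≡ i))
    }
    where
    open GradedPoset X
    vertexWeight : Carrier → Dec (i ≡ j) → |ℝ|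
    vertexWeight x (yes _) = w x
    vertexWeight x (no  _) = ½ *ᵣ w x

  linkNIH : ℕ → (X : GradedPoset) → (GradedPoset.Carrier X → |ℝ|) →
            GradedPoset.Carrier X → ℤ → ℤ → ℤ → WeightedHypergraph
  linkNIH d X w z i j k =
    NIH (link X z) (linkWeight d X z w)
        (i ℤ.- b ℤ.- 1ℤ) (j ℤ.- b ℤ.- 1ℤ) (k ℤ.- b ℤ.- 1ℤ)
    where b = GradedPoset.dim X z

  module Expansion
    {R : CommutativeRing r ℓr} (X : GradedPoset) (w : GradedPoset.Carrier X → |ℝ|)
    (o : GradedPoset.Carrier X → GradedPoset.Carrier X → CommutativeRing.Carrier R)
    (ℱ : Sheaf R X m ℓm)
    where
    open GradedPoset X
    open Cohomology X o ℱ

    ‖_‖ : ∀ {i} → C i → |ℝ|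
    ‖_‖ {i} f = ∑ (subset (faces i) (Supp f)) (w ∘ value)

    dist : ∀ {i} → C i → Pred (C i) p → |ℝ|
    dist f S = inf (λ s → ∃[ g ] g ∈ₚ S × s ≈ ‖ f -ᶜ g ‖)

    cbeBounds : ℤ → Pred |ℝ| m
    cbeBounds i μ = 0# ≤ᵣ μ × (∀ (f : C i) → (μ *ᵣ dist f (B i)) ≤ᵣ ‖ d f ‖)

    -- ε ≤ cbeᵢ(X , w , ℱ)
    _≤cbe_ : |ℝ| → ℤ → Set m
    ε ≤cbe i = ε ≤sup cbeBounds i

    -- One iteration of the loop, from fᵢ to fᵢ₊₁.
    CorrectionStep : ∀ k → |ℝ| → Rel (C (+ k)) (m ⊔ ℓm)
    CorrectionStep k q f f′ = ∃[ u ] 0ℤ ℤ.≤ dim u × dim u ℤ.≤ + k × ∃[ g ]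
      let gᵘ = extendByZero X o ℱ u (+ k) g in
      (‖ d f +ᶜ d gᵘ ‖ <ᵣ (‖ d f ‖ ℝ.- (q *ᵣ w u))) × f′ ≈ᶜ (f +ᶜ gᵘ)

  module Code {Pos : Set} (positions : List Pos) {ℓc : Level} (Alphabet : Setoid m ℓm)
              (Codeword : Pred (Pos → Setoid.Carrier Alphabet) ℓc) where
    private
      module Σ = Setoid Alphabet

    Word : Set m
    Word = Pos → Σ.Carrier

    _≐ʷ_ : Rel Word ℓm
    f ≐ʷ g = ∀ x → f x Σ.≈ g x

    hamming : Word → Word → |ℝ|
    hamming f g = fromℕ (length (subset positions (λ x → ¬ f x Σ.≈ g x))) / fromℕ (length positions)

    distToCode : Word → |ℝ|
    distToCode f = inf (λ s → ∃[ g ] Codeword g × s ≈ hamming f g)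

    -- c ≤ δ(Codeword)
    _≤relativeDistance : |ℝ| → Set (m ⊔ ℓm ⊔ ℓc)
    c ≤relativeDistance =
      c ≤inf (λ s → ∃[ f ] ∃[ g ] Codeword f × Codeword g × ¬ f ≐ʷ g × s ≈ hamming f g)

    HasSoundness : (rejectionProbability : Word → |ℝ|) → |ℝ| → Set m
    HasSoundness rejectionProbability μ =
      ∀ f → (μ *ᵣ distToCode f) ≤ᵣ rejectionProbability f

    -- A nondeterministic algorithm decodes words η-close to the code if,
    -- on such a word, all its runs halt, and each of them outputs the
    -- unique codeword at distance less than η.
    IsDecodingAlgorithm : (Halts : Pred Word (m ⊔ ℓm)) (Outputs : Rel Word (m ⊔ ℓm)) →
                          |ℝ| → Set (m ⊔ ℓm ⊔ ℓc)
    IsDecodingAlgorithm Halts Outputs η = ∀ f → distToCode f <ᵣ η →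
      Halts f × (∀ f′ → Outputs f f′ →
        Codeword f′ × hamming f f′ <ᵣ η ×
        (∀ f″ → Codeword f″ → hamming f f″ <ᵣ η → f″ ≐ʷ f′))

  -- The hypothesis 𝓕≡S identifies C^k with the words S^X(k).
  module CocycleCode
    {R : CommutativeRing r ℓr} (X : GradedPoset) (w : GradedPoset.Carrier X → |ℝ|)
    (o : GradedPoset.Carrier X → GradedPoset.Carrier X → CommutativeRing.Carrier R)
    (ℱ : Sheaf R X m ℓm) (k : ℕ) (S : Module R m ℓm)
    (𝓕≡S : ∀ (x : GradedPoset.Face X (+ k)) → Sheaf.𝓕 ℱ (value x) ≡ S)
    where
    open GradedPoset X
    open Cohomology X o ℱ
    open Expansion X w o ℱ
    open Module S using (Carrierᴹ; ≈ᴹ-setoid)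

    toCochain : (Face (+ k) → Carrierᴹ) → C (+ k)
    toCochain f x = subst Module.Carrierᴹ (sym (𝓕≡S x)) (f x)

    fromCochain : C (+ k) → (Face (+ k) → Carrierᴹ)
    fromCochain f x = subst Module.Carrierᴹ (𝓕≡S x) (f x)

    open Code (faces (+ k)) ≈ᴹ-setoid (Z (+ k) ∘ toCochain) public

    rejectionProbability : Word → |ℝ|
    rejectionProbability f =
      fromℕ (length (subset (faces (ℤ.suc (+ k))) (Supp (d (toCochain f)))))
      / fromℕ (length (faces (ℤ.suc (+ k))))

    Halts : |ℝ| → Pred Word (m ⊔ ℓm)
    Halts q f = Acc (flip (CorrectionStep k q)) (toCochain f)

    Outputs : |ℝ| → Rel Word (m ⊔ ℓm)
    Outputs q f f′ = ∃[ h ] Star (CorrectionStep k q) (toCochain f) h ×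
      IsNormalForm (CorrectionStep k q) h × f′ ≡ fromCochain h

IsFiniteModule : {R : CommutativeRing r ℓr} → Module R m ℓm → Set (m ⊔ ℓm)
IsFiniteModule S = ∃ (Enumerates.IsEnumeration (Module.≈ᴹ-setoid S))

{-# OPTIONS --safe #-}

-- The key statement concerns a cocycle h ∈ Cⁿ (n = k or k+1) of small norm whose
-- norm cannot be lowered much by coboundaries supported above a single face: it
-- vanishes.  Call the faces in supp h fat and, descending in dimension, call u fat
-- if the fat faces of some admissible dimension have density at least a threshold
-- in the link of u.  As the links are skeleton expanders, few (n+1)-faces contain
-- two fat faces with a non-fat infimum.  Below every other (n+1)-face z, descending
-- through fat faces is locally confluent, so by Newman's lemma all of supp h below
-- z descends to the same terminal face u.  If hᵤ denotes the part of h descending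
-- to u, then dhᵤ agrees with dh = 0 at such z, so dhᵤ is supported on the few
-- exceptional faces.  Since hᵤ is locally minimal, expansion of the link of u bounds
-- ‖hᵤ‖ by ‖dhᵤ‖, and summing over u gives ε‖h‖ ≤ O(Kε)‖h‖, whence h = 0 if K is small.
--
-- For n = k local minimality is automatic, because Bᵏ = 0; this bounds the distance.
-- For n = k+1 and h = df with f an output of the Correction Algorithm, it shows that
-- f is a cocycle; as a step at u moves f by O(w(u)) and lowers ‖df‖ by q w(u), the
-- output is at distance O(‖df‖/q) from the input.

module Submission where

open import Defs
open import Algebra.Bundles using (CommutativeMonoid; CommutativeRing)
open import Algebra.Module.Bundles using (Module)
open import Algebra.Module.Morphism.Structures using (module ModuleMorphisms)
import Algebra.Properties.CommutativeSemigroup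
import Algebra.Properties.Ring
import Algebra.Properties.Semiring.Exp
import Algebra.Solver.Ring.NaturalCoefficients.Default
open import Axiom.ExcludedMiddle using (ExcludedMiddle)
open import Data.Bool.Base using (if_then_else_)
import Data.Empty.Irrelevant
open import Data.Integer.Base as ℤ using (ℤ; +_; -1ℤ; 0ℤ; 1ℤ; ∣_∣)
import Data.Integer.Properties as ℤ
import Data.Integer.Tactic.RingSolver as ℤ
open import Data.Irrelevant using ([_])
open import Data.List.Base using (List; []; _∷_; foldr; map; filter; length; upTo; cartesianProduct; _++_)
import Data.List.Extrema
import Data.List.Extrema.Nat as ℕ-Extrema
open import Data.List.Membership.Propositional using (_∈_)
open import Data.List.Membership.Propositional.Properties
  using (∈-filter⁺; ∈-filter⁻; ∈-map⁺; ∈-cartesianProduct⁺; ∈-upTo⁺; ∈-++⁺ˡ; ∈-++⁺ʳ)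
open import Data.List.Properties using (length-filter; length-map; length-upTo)
import Data.List.Relation.Unary.All as All
open import Data.List.Relation.Unary.AllPairs using ([]; _∷_)
open import Data.List.Relation.Unary.Any using (here; there)
open import Data.Nat.Base as ℕ using (ℕ; zero; suc; z≤n; s≤s)
import Data.Nat.Induction as ℕ
import Data.Nat.Properties as ℕ
open import Data.Product.Base using (∃; ∃₂; ∃-syntax; Σ-syntax; _×_; _,_; proj₁; proj₂)
open import Data.Refinement.Base using (Refinement-syntax; _,_; value)
open import Data.Sum.Base using (_⊎_; inj₁; inj₂)
open import Function.Base using (_∘_; flip; id; case_of_)
open import Induction.WellFounded using (Acc; acc; WellFounded)
import Induction.WellFounded as WF
open import Level using (0ℓ; _⊔_)
open import Relation.Binary.Bundles using (TotalOrder)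
import Relation.Binary.Construct.NonStrictToStrict as NonStrictToStrict
open import Relation.Binary.Construct.Closure.ReflexiveTransitive using (Star; ε; _◅_)
open import Relation.Binary.Construct.Closure.Transitive using (Plus; [_]; _∼⁺⟨_⟩_)
open import Relation.Binary.Core using (Rel)
import Relation.Binary.Construct.On as On
open import Relation.Binary.PropositionalEquality
  using (_≡_; _≢_; cong; cong₂; subst; subst₂; module ≡-Reasoning)
  renaming (refl to ≡-refl; sym to ≡-sym; trans to ≡-trans)
import Relation.Binary.Reasoning.PartialOrder
import Relation.Binary.Reasoning.Setoid
open import Relation.Binary.Rewriting using (IsNormalForm; WeaklyConfluent; Confluent; sn&wcr⇒cr)
open import Relation.Nullary using (¬_; Dec; yes; no; contradiction; does)
open import Relation.Nullary.Decidable using (toWitness; fromWitness; True; decidable-stable; _×-dec_)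
open import Relation.Unary using (Pred; Decidable; Satisfiable; ｛_｝; _∪_) renaming (_∈_ to _∈ₚ_)

-- Sums over lists

-- The thresholds come from a function π of the dimension: u is fat when some admissible i has
-- density at least π (dim u) / π i in its link. Let a non-fat u of dimension b be an infimum of fat
-- faces of dimensions ℓ ≥ r. Non-fatness gives a π r ≤ 2 π b for the vertex weight a of the
-- hypergraph, so the quadratic term β a² of skeleton expansion becomes linear, of order a π r, as
-- soon as β π b ≤ B (π r)². Squaring from one dimension to the next, from π n = κ = Kε on, leads to
-- π i = κ^(2^(n-i)), the origin of the doubly exponential constants. The sum V of w(x) π (dim x)
-- over fat x is a potential. It is at most Γ κ ‖h‖, so the exceptional faces weigh O(Kε) ‖h‖. The
-- face ∅ has no coboundary expansion hypothesis and cannot be fat; there B′ V ≤ π (-1) stands in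
-- for non-fatness, whence the restriction to B′ Γ κ ‖h‖ ≤ κ^(2^(n+1)). Local minimality up to q
-- w(u) loses q times the weight of the fat faces, at most q Γ κ ‖h‖ / π 0; keeping this O(K) ‖h‖
-- for n = k+1 gives q = K κ^(2^(k+1)-1).

module MonoidSum {c ℓ} (M : CommutativeMonoid c ℓ) where
  open CommutativeMonoid M
    using (Carrier; _≈_; _∙_; refl; sym; trans; ∙-cong; ∙-congˡ; ∙-congʳ; assoc; identityˡ; identityʳ; commutativeSemigroup)
    renaming (ε to 0ᴹ)
  open Algebra.Properties.CommutativeSemigroup commutativeSemigroup using (interchange)

  sum : ∀ {a} {A : Set a} → List A → (A → Carrier) → Carrier
  sum xs f = foldr _∙_ 0ᴹ (map f xs)

  module _ {a} {A : Set a} where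

    sum-cong : ∀ {f g : A → Carrier} xs → (∀ x → f x ≈ g x) → sum xs f ≈ sum xs g
    sum-cong []       e = refl
    sum-cong (x ∷ xs) e = ∙-cong (e x) (sum-cong xs e)

    sum-0 : ∀ {f : A → Carrier} xs → (∀ x → f x ≈ 0ᴹ) → sum xs f ≈ 0ᴹ
    sum-0 []       e = refl
    sum-0 (x ∷ xs) e = trans (∙-cong (e x) (sum-0 xs e)) (identityˡ 0ᴹ)

    sum-∙ : ∀ (f g : A → Carrier) xs → sum xs (λ x → f x ∙ g x) ≈ sum xs f ∙ sum xs g
    sum-∙ f g []  = sym (identityˡ 0ᴹ)
    sum-∙ f g (x ∷ xs) = trans (∙-congˡ (sum-∙ f g xs)) (interchange (f x) (g x) _ _)

    module _ {p} {P : Pred A p} (P? : Decidable P) where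

      sum-filter : ∀ {f g : A → Carrier} xs → (∀ x → P x → f x ≈ g x) → (∀ x → ¬ P x → g x ≈ 0ᴹ) →
                   sum (filter P? xs) f ≈ sum xs g
      sum-filter []       e z = refl
      sum-filter (x ∷ xs) e z with P? x
      ... | yes px = ∙-cong (e x px) (sum-filter xs e z)
      ... | no ¬px = trans (sum-filter xs e z) (sym (trans (∙-congʳ (z x ¬px)) (identityˡ _)))

      sum-collect : ∀ {f : [ x ∈ A ∣ P x ] → Carrier} {g : A → Carrier} xs →
                    (∀ x (px : P x) → f (x , [ px ]) ≈ g x) → (∀ x → ¬ P x → g x ≈ 0ᴹ) →
                    sum (collect P? xs) f ≈ sum xs g
      sum-collect []       e z = refl
      sum-collect (x ∷ xs) e z with P? x
      ... | yes px = ∙-cong (e x px) (sum-collect xs e z)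
      ... | no ¬px = trans (sum-collect xs e z) (sym (trans (∙-congʳ (z x ¬px)) (identityˡ _)))

      -- Serves to compare the coboundary at a face of X, one filter of `elements`, with the
      -- coboundary at the same face of a link, two nested filters: terms outside `U` vanish and the
      -- others match.
      sum-collect-collect :
        ∀ {u q} {U : Pred A u} (U? : Decidable U) {Q : Pred [ x ∈ A ∣ U x ] q} (Q? : Decidable Q)
        {f : [ x ∈ A ∣ P x ] → Carrier} {g : [ x ∈ [ x ∈ A ∣ U x ] ∣ Q x ] → Carrier} xs →
        (∀ x (px : P x) (ux : U x) → Q (x , [ ux ])) →
        (∀ x (ux : U x) → Q (x , [ ux ]) → P x) →
        (∀ x (px : P x) (ux : U x) (qx : Q (x , [ ux ])) → f (x , [ px ]) ≈ g ((x , [ ux ]) , [ qx ])) →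
        (∀ x (px : P x) → ¬ U x → f (x , [ px ]) ≈ 0ᴹ) →
        sum (collect P? xs) f ≈ sum (collect Q? (collect U? xs)) g
      sum-collect-collect U? Q? []       PU⇒Q Q⇒P e z = refl
      sum-collect-collect U? Q? (x ∷ xs) PU⇒Q Q⇒P e z with U? x
      sum-collect-collect U? Q? (x ∷ xs) PU⇒Q Q⇒P e z | yes ux with P? x | Q? (x , [ ux ])
      ... | yes px | yes qx = ∙-cong (e x px ux qx) (sum-collect-collect U? Q? xs PU⇒Q Q⇒P e z)
      ... | yes px | no ¬qx = contradiction (PU⇒Q x px ux) ¬qx
      ... | no ¬px | yes qx = contradiction (Q⇒P x ux qx) ¬px
      ... | no ¬px | no ¬qx = sum-collect-collect U? Q? xs PU⇒Q Q⇒P e z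
      sum-collect-collect U? Q? (x ∷ xs) PU⇒Q Q⇒P e z | no ¬ux with P? x
      ... | yes px = trans (∙-cong (z x px ¬ux) (sum-collect-collect U? Q? xs PU⇒Q Q⇒P e z)) (identityˡ _)
      ... | no ¬px = sum-collect-collect U? Q? xs PU⇒Q Q⇒P e z

  sum-swap : ∀ {a b} {A : Set a} {B : Set b} (f : A → B → Carrier) xs ys →
             sum xs (λ x → sum ys (f x)) ≈ sum ys (λ y → sum xs (λ x → f x y))
  sum-swap f []       ys = sym (sum-0 ys λ _ → refl)
  sum-swap f (x ∷ xs) ys = trans (∙-congˡ (sum-swap f xs ys)) (sym (sum-∙ (f x) _ ys))

module _ {a p q} {A : Set a} {P : Pred A p} {Q : Pred A q} (P? : Decidable P) (Q? : Decidable Q)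
         (P⇒Q : ∀ {x} → P x → Q x) where

  length-filter-mono : ∀ xs → length (filter P? xs) ℕ.≤ length (filter Q? xs)
  length-filter-mono []  = z≤n
  length-filter-mono (x ∷ xs) with P? x | Q? x
  ... | yes _  | yes _ = s≤s (length-filter-mono xs)
  ... | yes px | no ¬q = contradiction (P⇒Q px) ¬q
  ... | no _   | yes _ = ℕ.m≤n⇒m≤1+n (length-filter-mono xs)
  ... | no _   | no _  = length-filter-mono xs

  length-filter-< : ∀ {x xs} → x ∈ xs → ¬ P x → Q x → length (filter P? xs) ℕ.< length (filter Q? xs)
  length-filter-< {x} {xs = y ∷ xs} x∈ ¬px qx with P? y | Q? y | x∈
  ... | yes py | _      | here ≡-refl = contradiction py ¬px
  ... | no _   | yes _  | here ≡-refl = s≤s (length-filter-mono xs)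
  ... | no _   | no ¬qy | here ≡-refl = contradiction qx ¬qy
  ... | yes _  | yes _  | there x∈′  = s≤s (length-filter-< x∈′ ¬px qx)
  ... | yes py | no ¬qy | there x∈′  = contradiction (P⇒Q py) ¬qy
  ... | no _   | yes _  | there x∈′  = ℕ.m≤n⇒m≤1+n (length-filter-< x∈′ ¬px qx)
  ... | no _   | no _   | there x∈′  = length-filter-< x∈′ ¬px qx

-- Graded posets

module PosetProperties (lem : ∀ {ℓ} → ExcludedMiddle ℓ) (X : GradedPoset) where
  open GradedPoset X

  <-≤-trans : ∀ {x y z} → x < y → y ≤ z → x < z
  <-≤-trans = NonStrictToStrict.<-≤-trans _≡_ _≤_ ≡-sym ≤-trans antisym (λ { ≡-refl p → p })

  -- Measures for `_<_` and its converse. The dimension cannot serve yet: that it increases strictly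
  -- is itself deduced from the existence of covers, which needs well-foundedness.
  downSize upSize : Carrier → ℕ
  downSize x = length (filter (_≤? x) elements)
  upSize x = length (filter (x ≤?_) elements)

  downSize-< : ∀ {x y} → x < y → downSize x ℕ.< downSize y
  downSize-< {x} {y} (x≤y , x≢y) = length-filter-< (_≤? x) (_≤? y) (λ z≤x → ≤-trans z≤x x≤y)
    (elements-complete y) (λ y≤x → x≢y (antisym x≤y y≤x)) ≤-refl

  upSize-< : ∀ {x y} → x < y → upSize y ℕ.< upSize x
  upSize-< {x} {y} (x≤y , x≢y) = length-filter-< (y ≤?_) (x ≤?_) (≤-trans x≤y)
    (elements-complete x) (λ y≤x → x≢y (antisym x≤y y≤x)) ≤-refl

  <-wellFounded : WellFounded _<_
  <-wellFounded = WF.Subrelation.wellFounded downSize-< (On.wellFounded downSize ℕ.<-wellFounded)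

  >-wellFounded : WellFounded (flip _<_)
  >-wellFounded = WF.Subrelation.wellFounded upSize-< (On.wellFounded upSize ℕ.<-wellFounded)

  cover-exists : ∀ {x y} → x < y → ∃[ z ] x ⋖ z × z ≤ y
  cover-exists {x} {y} = go (<-wellFounded y)
    where
    go : ∀ {y} → Acc _<_ y → x < y → ∃[ z ] x ⋖ z × z ≤ y
    go {y} (acc rs) x<y with lem {P = ∃[ z ] x < z × z < y}
    ... | no none = y , (x<y , none) , ≤-refl
    ... | yes (z , x<z , z<y) =
      let (u , x⋖u , u≤z) = go (rs z<y) x<z in u , x⋖u , ≤-trans u≤z (proj₁ z<y)

  -- The axioms give a strict increase only along covers; a cover of x below y supplies it, and
  -- `dim-mono` carries it up to y.
  dim-< : ∀ {x y} → x < y → dim x ℤ.< dim y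
  dim-< {x} x<y =
    let (z , x⋖z , z≤y) = cover-exists x<y
    in ℤ.<-≤-trans (subst (dim x ℤ.<_) (≡-trans (ℤ.+-comm 1ℤ (dim x)) (≡-sym (dim-⋖ x⋖z)))
                            (ℤ.≤∧≢⇒< (ℤ.i≤suc[i] (dim x)) ℤ.i≢suc[i]))
                   (dim-mono z≤y)

  ≤∧dim≡⇒≡ : ∀ {x y} → x ≤ y → dim x ≡ dim y → x ≡ y
  ≤∧dim≡⇒≡ {x} {y} x≤y e with x ≟ y
  ... | yes x≡y = x≡y
  ... | no  x≢y = contradiction (dim-< (x≤y , x≢y)) (ℤ.<-irrefl e)

  -1≤dim : ∀ x → -1ℤ ℤ.≤ dim x
  -1≤dim x = subst (ℤ._≤ dim x) ∅-dim (dim-mono (∅-min x))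

  dim≡-1⇒≡∅ : ∀ {x} → dim x ≡ -1ℤ → x ≡ ∅
  dim≡-1⇒≡∅ {x} e = ≡-sym (≤∧dim≡⇒≡ (∅-min x) (≡-trans ∅-dim (≡-sym e)))

  -- Climbing from x towards y by covers raises the dimension by exactly one each time, so no value
  -- up to `dim y` is skipped.
  interpolate : ∀ {x y i} → x ≤ y → dim x ℤ.≤ i → i ℤ.≤ dim y → ∃[ z ] x ≤ z × z ≤ y × dim z ≡ i
  interpolate {x} {y} {i} = go (>-wellFounded x)
    where
    go : ∀ {x} → Acc (flip _<_) x → x ≤ y → dim x ℤ.≤ i → i ℤ.≤ dim y → ∃[ z ] x ≤ z × z ≤ y × dim z ≡ i
    go {x} (acc rs) x≤y dx≤i i≤dy with dim x ℤ.≟ i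
    ... | yes e = x , ≤-refl , x≤y , e
    ... | no ne =
      let x<y : x < y
          x<y = x≤y , λ { ≡-refl → ne (ℤ.≤-antisym dx≤i i≤dy) }
          (z , x⋖z , z≤y) = cover-exists x<y
          dz≤i : dim z ℤ.≤ i
          dz≤i = subst (ℤ._≤ i) (≡-trans (ℤ.+-comm 1ℤ (dim x)) (≡-sym (dim-⋖ x⋖z))) (ℤ.i<j⇒suc[i]≤j (ℤ.≤∧≢⇒< dx≤i ne))
          (u , z≤u , u≤y , e) = go (rs (proj₁ x⋖z)) z≤y dz≤i i≤dy
      in u , ≤-trans (proj₁ (proj₁ x⋖z)) z≤u , u≤y , e

  -- ∅ is a common lower bound; replacing a lower bound by a strictly larger one as long as possible
  -- ends at a maximal one.
  Inf₂-exists : ∀ x y → ∃[ u ] u ∈ₚ Inf₂ x y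
  Inf₂-exists x y = go (>-wellFounded ∅) (λ {z} _ → ∅-min z)
    where
    open Bounds _≤_ using (IsLowerBound)
    Lower : Carrier → Set
    Lower = IsLowerBound (｛ x ｝ ∪ ｛ y ｝)
    go : ∀ {v} → Acc (flip _<_) v → Lower v → ∃[ u ] u ∈ₚ Inf₂ x y
    go {v} (acc rs) low with lem {P = ∃[ u ] v < u × Lower u}
    ... | yes (u , v<u , low′) = go (rs v<u) (λ {z} → low′ {z})
    ... | no none = v , (λ {z} → low {z}) , maximal
      where
      maximal : ∀ {u} → Lower u → v ≤ u → v ≡ u
      maximal {u} low′ v≤u with v ≟ u
      ... | yes e = e
      ... | no ne = contradiction (u , (v≤u , ne) , (λ {z} → low′ {z})) none

  Inf₂-≤ : ∀ {x y u} → u ∈ₚ Inf₂ x y → u ≤ x × u ≤ y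
  Inf₂-≤ (low , _) = low (inj₁ ≡-refl) , low (inj₂ ≡-refl)

  -- The proof stored in a `Face` is irrelevant; deciding the equality of integers recovers a usable
  -- one.
  face-dim : ∀ {i} (x : Face i) → dim (value x) ≡ i
  face-dim {i} (x , [ e ]) with dim x ℤ.≟ i
  ... | yes e′ = e′
  ... | no ne  = Data.Empty.Irrelevant.⊥-elim (ne e)

  face∈ : ∀ {i} (x : Face i) → x ∈ faces i
  face∈ {i} x = ∈-collect⁺ (λ x → dim x ℤ.≟ i) x (elements-complete (value x))

  betweenCounts : ℤ → ℤ → ℤ → List ℕ
  betweenCounts i j k = map (λ (x , z) → length (facesBetween (value x) j (value z)))
    (filter (λ (x , z) → value x ≤? value z) (cartesianProduct (faces i) (faces k)))

  ∈-betweenCounts : ∀ {i j k} (x : Face i) (z : Face k) → value x ≤ value z →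
                    length (facesBetween (value x) j (value z)) ∈ betweenCounts i j k
  ∈-betweenCounts {j = j} x z x≤z = ∈-map⁺ (λ (x , z) → length (facesBetween (value x) j (value z)))
    (∈-filter⁺ (λ (x , z) → value x ≤? value z) (∈-cartesianProduct⁺ (face∈ x) (face∈ z)) x≤z)

  facesBetween≤Fᵐᵃˣ : ∀ {i j k} (x : Face i) (z : Face k) → value x ≤ value z →
                      length (facesBetween (value x) j (value z)) ℕ.≤ Fᵐᵃˣ i j k
  facesBetween≤Fᵐᵃˣ {i} {j} {k} x z x≤z =
    All.lookup (ℕ-Extrema.xs≤max 0 (betweenCounts i j k)) (∈-betweenCounts x z x≤z)

  Fᵐⁱⁿ≤facesBetween : ∀ {i j k} (x : Face i) (z : Face k) → value x ≤ value z →
                      Fᵐⁱⁿ i j k ℕ.≤ length (facesBetween (value x) j (value z))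
  Fᵐⁱⁿ≤facesBetween {i} {j} {k} x z x≤z =
    All.lookup (ℕ-Extrema.min≤xs (length elements) (betweenCounts i j k)) (∈-betweenCounts x z x≤z)

  -- The first hypothesis takes care of `length elements`, the value at which the minimum starts.
  ≤Fᵐⁱⁿ : ∀ {n i j k} → n ℕ.≤ length elements →
          (∀ (x : Face i) (z : Face k) → value x ≤ value z → n ℕ.≤ length (facesBetween (value x) j (value z))) →
          n ℕ.≤ Fᵐⁱⁿ i j k
  ≤Fᵐⁱⁿ {n} {i} {j} {k} n≤ bound = ℕ-Extrema.v≤min⁺ {xs = betweenCounts i j k} n≤
    (All.map⁺ (All.tabulate λ {(x , z)} xz∈ → bound x z (proj₂ (∈-filter⁻ (λ (x , z) → value x ≤? value z)
      {xs = cartesianProduct (faces i) (faces k)} xz∈))))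
    where import Data.List.Relation.Unary.All.Properties as All

-- Cochains and links

module Cochains {r ℓr m ℓm} {R : CommutativeRing r ℓr} (X : GradedPoset)
  (o : GradedPoset.Carrier X → GradedPoset.Carrier X → CommutativeRing.Carrier R) (ℱ : Sheaf R X m ℓm) where
  open GradedPoset X
  open Sheaf ℱ
  open Cohomology X o ℱ public

  module _ {x y : Carrier} .(x<y : x < y) where
    open ModuleMorphisms.IsModuleHomomorphism (res-hom x<y) public
      renaming (+ᴹ-homo to res-+; *ₗ-homo to res-*ₗ; 0ᴹ-homo to res-0; -ᴹ-homo to res-neg; ⟦⟧-cong to res-cong) using ()

  module _ {i : ℤ} where

    ≈ᶜ-refl : ∀ {f : C i} → f ≈ᶜ f
    ≈ᶜ-refl x = 𝓕.≈ᴹ-refl (value x)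

    ≈ᶜ-sym : ∀ {f g : C i} → f ≈ᶜ g → g ≈ᶜ f
    ≈ᶜ-sym e x = 𝓕.≈ᴹ-sym (value x) (e x)

    ≈ᶜ-trans : ∀ {f g h : C i} → f ≈ᶜ g → g ≈ᶜ h → f ≈ᶜ h
    ≈ᶜ-trans e e′ x = 𝓕.≈ᴹ-trans (value x) (e x) (e′ x)

    -ᶜ-+ᶜ : ∀ (f g : C i) → ((f -ᶜ g) +ᶜ g) ≈ᶜ f
    -ᶜ-+ᶜ f g x = 𝓕.≈ᴹ-trans v (𝓕.+ᴹ-assoc v _ _ _) (𝓕.≈ᴹ-trans v (𝓕.+ᴹ-congˡ v (𝓕.-ᴹ‿inverseˡ v _)) (𝓕.+ᴹ-identityʳ v _))
      where v = value x

    +ᶜ-cancel : ∀ {f g h : C i} → (f +ᶜ g) ≈ᶜ h → f ≈ᶜ (h -ᶜ g)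
    +ᶜ-cancel {f} {g} e x = 𝓕.≈ᴹ-trans v
      (𝓕.≈ᴹ-sym v (𝓕.≈ᴹ-trans v (𝓕.+ᴹ-assoc v _ _ _) (𝓕.≈ᴹ-trans v (𝓕.+ᴹ-congˡ v (𝓕.-ᴹ‿inverseʳ v _)) (𝓕.+ᴹ-identityʳ v _))))
      (𝓕.+ᴹ-congʳ v (e x))
      where v = value x

    -ᶜ-zeroʳ : ∀ {f g : C i} → g ≈ᶜ 0ᶜ → (f -ᶜ g) ≈ᶜ f
    -ᶜ-zeroʳ {f} {g} e = ≈ᶜ-sym (+ᶜ-cancel λ x → 𝓕.≈ᴹ-trans (value x) (𝓕.+ᴹ-congˡ (value x) (e x)) (𝓕.+ᴹ-identityʳ (value x) _))

    -‿≈0⇒≈ : ∀ {f g : C i} → (f -ᶜ g) ≈ᶜ 0ᶜ → f ≈ᶜ g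
    -‿≈0⇒≈ {f} {g} e = ≈ᶜ-trans (≈ᶜ-sym (-ᶜ-+ᶜ f g)) λ x →
      𝓕.≈ᴹ-trans (value x) (𝓕.+ᴹ-congʳ (value x) (e x)) (𝓕.+ᴹ-identityˡ (value x) _)

  module _ {i : ℤ} where

    d-cong : ∀ {f g : C i} → f ≈ᶜ g → d f ≈ᶜ d g
    d-cong f≈g (y , dy) = sum-cong (facesBelow y i) λ x → 𝓕.*ₗ-congˡ y (res-cong _ (f≈g _))
      where open MonoidSum (𝓕.+ᴹ-commutativeMonoid y)

    d-+ : ∀ (f g : C i) → d (f +ᶜ g) ≈ᶜ (d f +ᶜ d g)
    d-+ f g (y , dy) = 𝓕.≈ᴹ-trans y
      (sum-cong (facesBelow y i) λ x → 𝓕.≈ᴹ-trans y (𝓕.*ₗ-congˡ y (res-+ _ _ _)) (𝓕.*ₗ-distribˡ y _ _ _))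
      (sum-∙ _ _ (facesBelow y i))
      where open MonoidSum (𝓕.+ᴹ-commutativeMonoid y)

    d-local : ∀ (f : C i) (y : Face (ℤ.suc i)) →
              (∀ x (dx : dim x ≡ i) → x ≤ value y → 𝓕._≈ᴹ_ x (f (x , [ dx ])) (𝓕.0ᴹ x)) →
              𝓕._≈ᴹ_ (value y) (d f y) (𝓕.0ᴹ (value y))
    d-local f (y , dy) f≈0 = 𝓕.≈ᴹ-trans y
      (sum-collect (λ x → dim x ℤ.≟ i ×-dec x ≤? y) {g = λ _ → 𝓕.0ᴹ y} elements
        (λ x (dx , x≤y) → 𝓕.≈ᴹ-trans y (𝓕.*ₗ-congˡ y (𝓕.≈ᴹ-trans y (res-cong _ (f≈0 x dx x≤y)) (res-0 _))) (𝓕.*ₗ-zeroʳ y _))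
        (λ _ _ → 𝓕.≈ᴹ-refl y))
      (sum-0 elements λ _ → 𝓕.≈ᴹ-refl y)
      where open MonoidSum (𝓕.+ᴹ-commutativeMonoid y)

    d-0 : ∀ {f : C i} → f ≈ᶜ 0ᶜ → d f ≈ᶜ 0ᶜ
    d-0 {f} f≈0 y = d-local f y λ x dx _ → f≈0 (x , [ dx ])

    d-sub : ∀ (f g : C i) → d (f -ᶜ g) ≈ᶜ (d f -ᶜ d g)
    d-sub f g = +ᶜ-cancel (≈ᶜ-trans (≈ᶜ-sym (d-+ (f -ᶜ g) g)) (d-cong (-ᶜ-+ᶜ f g)))

module _ {r ℓr m ℓm} {R : CommutativeRing r ℓr} (X : GradedPoset)
  (o : GradedPoset.Carrier X → GradedPoset.Carrier X → CommutativeRing.Carrier R) (ℱ : Sheaf R X m ℓm)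
  (u : GradedPoset.Carrier X) where
  private
    module X = GradedPoset X
    module Xᵤ = GradedPoset (link X u)
    module Cₓ = Cochains X o ℱ
    module Cᵤ = Cochains (link X u) (linkOrientation {R = R} X u o) (linkSheaf X u ℱ)
    open Cₓ using (module 𝓕)

    shift : ∀ i j → (1ℤ ℤ.+ i) ℤ.- j ℤ.- 1ℤ ≡ 1ℤ ℤ.+ (i ℤ.- j ℤ.- 1ℤ)
    shift = ℤ.solve-∀

    .below : ∀ {x y i} → X.dim x ≡ i → X.dim y ≡ ℤ.suc i → x X.≤ y → x X.< y
    below dx dy x≤y = x≤y , λ { ≡-refl → ℤ.i≢suc[i] (≡-trans (≡-sym dx) dy) }

  codim-cancel : ∀ {i j} → i ℤ.- X.dim u ℤ.- 1ℤ ≡ j ℤ.- X.dim u ℤ.- 1ℤ → i ≡ j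
  codim-cancel {i} {j} e = begin
    i  ≡⟨ unshift i (X.dim u) ⟩
    (i ℤ.- X.dim u ℤ.- 1ℤ) ℤ.+ (1ℤ ℤ.+ X.dim u)  ≡⟨ cong (ℤ._+ (1ℤ ℤ.+ X.dim u)) e ⟩
    (j ℤ.- X.dim u ℤ.- 1ℤ) ℤ.+ (1ℤ ℤ.+ X.dim u)  ≡⟨ unshift j (X.dim u) ⟨
    j  ∎
    where
    open ≡-Reasoning
    unshift : ∀ i a → i ≡ (i ℤ.- a ℤ.- 1ℤ) ℤ.+ (1ℤ ℤ.+ a)
    unshift = ℤ.solve-∀

  codim-suc : ∀ {i j} → i ℤ.- X.dim u ℤ.- 1ℤ ≡ ℤ.suc (j ℤ.- X.dim u ℤ.- 1ℤ) → i ≡ ℤ.suc j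
  codim-suc {i} {j} e = codim-cancel (≡-trans e (≡-sym (shift j (X.dim u))))

  codim-suc⁻ : ∀ {i j} → i ≡ ℤ.suc j → i ℤ.- X.dim u ℤ.- 1ℤ ≡ ℤ.suc (j ℤ.- X.dim u ℤ.- 1ℤ)
  codim-suc⁻ {j = j} ≡-refl = shift j (X.dim u)

  fromLink : ∀ {j} → Xᵤ.Face (j ℤ.- X.dim u ℤ.- 1ℤ) → X.Face j
  fromLink ((x , _) , [ e ]) = x , [ codim-cancel e ]

  toLink : ∀ {j} (x : X.Face j) → .(u X.≤ value x) → Xᵤ.Face (j ℤ.- X.dim u ℤ.- 1ℤ)
  toLink (x , [ e ]) u≤x = (x , [ u≤x ]) , [ cong (λ i → i ℤ.- X.dim u ℤ.- 1ℤ) e ]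

  -- A face of the link below y is a face of X between u and y, with inherited orientation and
  -- restriction maps; the remaining faces of X below y contribute nothing because f vanishes on
  -- them.
  link-d : ∀ {j} (f : Cₓ.C j) (g : Cᵤ.C (j ℤ.- X.dim u ℤ.- 1ℤ)) (y : X.Carrier) .(u≤y : u X.≤ y) .(dy : X.dim y ≡ ℤ.suc j) →
           (∀ (x : X.Face j) (u≤x : u X.≤ value x) → value x X.≤ y → 𝓕._≈ᴹ_ (value x) (f x) (g (toLink x u≤x))) →
           (∀ (x : X.Face j) → ¬ (u X.≤ value x) → value x X.≤ y → 𝓕._≈ᴹ_ (value x) (f x) (𝓕.0ᴹ (value x))) →
           𝓕._≈ᴹ_ y (Cₓ.d f (y , [ dy ])) (Cᵤ.d g ((y , [ u≤y ]) , [ codim-suc⁻ {j = j} dy ]))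
  link-d {j} f g y u≤y dy f≈g f≈0 = sum-collect-collect (λ x → X.dim x ℤ.≟ j ×-dec x X.≤? y) (u X.≤?_)
    (λ x → Xᵤ.dim x ℤ.≟ (j ℤ.- X.dim u ℤ.- 1ℤ) ×-dec value x X.≤? y) X.elements
    (λ x (dx , x≤y) u≤x → cong (λ i → i ℤ.- X.dim u ℤ.- 1ℤ) dx , x≤y)
    (λ x u≤x (dx , x≤y) → codim-cancel dx , x≤y)
    (λ x (dx , x≤y) u≤x _ → 𝓕.*ₗ-congˡ y (Cₓ.res-cong (below dx dy x≤y) (f≈g (x , [ dx ]) u≤x x≤y)))
    (λ x (dx , x≤y) u≰x → 𝓕.≈ᴹ-trans y (𝓕.*ₗ-congˡ y (𝓕.≈ᴹ-trans y (Cₓ.res-cong _ (f≈0 (x , [ dx ]) u≰x x≤y)) (Cₓ.res-0 _)))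
                        (𝓕.*ₗ-zeroʳ y _))
    where open MonoidSum (𝓕.+ᴹ-commutativeMonoid y)

  module _ {j : ℤ} (g : Cᵤ.C (j ℤ.- X.dim u ℤ.- 1ℤ)) where
    private
      gᵘ : Cₓ.C j
      gᵘ = extendByZero X o ℱ u j g

    extend-above : ∀ x (u≤x : u X.≤ value x) → 𝓕._≈ᴹ_ (value x) (gᵘ x) (g (toLink x u≤x))
    extend-above (x , e) u≤x with u X.≤? x
    ... | yes _  = 𝓕.≈ᴹ-refl x
    ... | no u≰x  = contradiction u≤x u≰x

    extend-outside : ∀ x → ¬ (u X.≤ value x) → 𝓕._≈ᴹ_ (value x) (gᵘ x) (𝓕.0ᴹ (value x))
    extend-outside (x , e) u≰x with u X.≤? x
    ... | yes u≤x = contradiction u≤x u≰x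
    ... | no _  = 𝓕.≈ᴹ-refl x

    d-extend-above : ∀ y .(u≤y : u X.≤ y) .(dy : X.dim y ≡ ℤ.suc j) →
                     𝓕._≈ᴹ_ y (Cₓ.d gᵘ (y , [ dy ])) (Cᵤ.d g ((y , [ u≤y ]) , [ codim-suc⁻ {j = j} dy ]))
    d-extend-above y u≤y dy = link-d gᵘ g y u≤y dy (λ x u≤x _ → extend-above x u≤x) (λ x u≰x _ → extend-outside x u≰x)

    d-extend-outside : ∀ y → ¬ (u X.≤ value y) → 𝓕._≈ᴹ_ (value y) (Cₓ.d gᵘ y) (𝓕.0ᴹ (value y))
    d-extend-outside y u≰y = Cₓ.d-local gᵘ y λ x dx x≤y → extend-outside (x , [ dx ]) λ u≤x → u≰y (X.≤-trans u≤x x≤y)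

+ᶻ-cancelˡ-≤ : ∀ i {j k} → i ℤ.+ j ℤ.≤ i ℤ.+ k → j ℤ.≤ k
+ᶻ-cancelˡ-≤ i {j} {k} p = subst₂ ℤ._≤_ (cancel i j) (cancel i k) (ℤ.+-monoʳ-≤ (ℤ.- i) p)
  where
  cancel : ∀ i j → ℤ.- i ℤ.+ (i ℤ.+ j) ≡ j
  cancel = ℤ.solve-∀

-- The coboundary squares to zero

module CoboundarySquared (lem : ∀ {ℓ} → ExcludedMiddle ℓ) {r ℓr m ℓm} {R : CommutativeRing r ℓr} (X : GradedPoset)
  (o : GradedPoset.Carrier X → GradedPoset.Carrier X → CommutativeRing.Carrier R) (orientation : IsOrientation R X o)
  (ℱ : Sheaf R X m ℓm) where
  open GradedPoset X
  open Sheaf ℱ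
  open Cochains X o ℱ
  private
    module R = CommutativeRing R
    module P = PosetProperties lem X

    _<?_ : ∀ x y → Dec (x < y)
    _<?_ = NonStrictToStrict.<-decidable _≡_ _≤_ _≟_ _≤?_

    between? : ∀ x z → Decidable (λ y → x < y × y < z)
    between? x z y = x <? y ×-dec y <? z

    module _ {j : ℤ} (f : C j) (z : Carrier) (dz : dim z ≡ ℤ.suc (ℤ.suc j)) where
      open MonoidSum (𝓕.+ᴹ-commutativeMonoid z)
      module M = Module (𝓕 z)
      open M using (_≈ᴹ_; _*ₗ_; 0ᴹ)

      j<dz : j ℤ.< dim z
      j<dz = subst (j ℤ.<_) (≡-sym dz) (ℤ.≤-<-trans (ℤ.i≤suc[i] j) (ℤ.≤∧≢⇒< (ℤ.i≤suc[i] _) ℤ.i≢suc[i]))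

      x<z : ∀ {x} → dim x ≡ j × x ≤ z → x < z
      x<z (dx , x≤z) = x≤z , λ { ≡-refl → ℤ.<-irrefl ≡-refl (subst (ℤ._< dim z) (≡-sym dx) j<dz) }

      -- `restricted` and `term` extend the summands by zero to all of `elements`, so that d (d f)
      -- becomes an unrestricted double sum whose order can be exchanged.
      restricted′ : ∀ x → Dec (dim x ≡ j × x ≤ z) → M.Carrierᴹ
      restricted′ x (yes p) = res (x<z p) (f (x , [ proj₁ p ]))
      restricted′ x (no _)  = 0ᴹ

      restricted : Carrier → M.Carrierᴹ
      restricted x = restricted′ x (dim x ℤ.≟ j ×-dec x ≤? z)

      restricted-yes : ∀ x (δ : Dec (dim x ≡ j × x ≤ z)) (p : dim x ≡ j × x ≤ z) → restricted′ x δ ≈ᴹ res (x<z p) (f (x , [ proj₁ p ]))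
      restricted-yes x (yes _) p = M.≈ᴹ-refl
      restricted-yes x (no ¬p) p = contradiction p ¬p

      restricted-no : ∀ x (δ : Dec (dim x ≡ j × x ≤ z)) → ¬ (dim x ≡ j × x ≤ z) → restricted′ x δ ≈ᴹ 0ᴹ
      restricted-no x (yes p) ¬p = contradiction p ¬p
      restricted-no x (no _)  ¬p = M.≈ᴹ-refl

      term′ : ∀ y x → Dec (x < y × y < z) → M.Carrierᴹ
      term′ y x (yes _) = (o z y R.* o y x) *ₗ restricted x
      term′ y x (no _)  = 0ᴹ

      term : Carrier → Carrier → M.Carrierᴹ
      term y x = term′ y x (between? x z y)

      term-yes : ∀ y x δ → x < y × y < z → term′ y x δ ≈ᴹ (o z y R.* o y x) *ₗ restricted x
      term-yes y x (yes _) p = M.≈ᴹ-refl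
      term-yes y x (no ¬p) p = contradiction p ¬p

      term-no : ∀ y x δ → (x < y → y < z → restricted x ≈ᴹ 0ᴹ) → term′ y x δ ≈ᴹ 0ᴹ
      term-no y x (yes (p , q)) e = M.≈ᴹ-trans (M.*ₗ-congˡ (e p q)) (M.*ₗ-zeroʳ _)
      term-no y x (no _)        e = M.≈ᴹ-refl

      below : ∀ {x y i} → dim x ≡ i → dim y ≡ ℤ.suc i → x ≤ y → x < y
      below dx dy x≤y = x≤y , λ { ≡-refl → ℤ.i≢suc[i] (≡-trans (≡-sym dx) dy) }

      middle-dim : ∀ {x y} → dim x ≡ j → x < y → y < z → dim y ≡ ℤ.suc j
      middle-dim {x} {y} dx x<y y<z = ℤ.≤-antisym
        (+ᶻ-cancelˡ-≤ 1ℤ (subst (ℤ.suc (dim y) ℤ.≤_) dz (ℤ.i<j⇒suc[i]≤j (P.dim-< y<z))))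
        (subst (λ i → ℤ.suc i ℤ.≤ dim y) dx (ℤ.i<j⇒suc[i]≤j (P.dim-< x<y)))

      res-sum : ∀ {a} {I : Set a} {y} .(y<z : y < z) (xs : List I) (g : I → 𝓕.Carrierᴹ y) →
                res y<z (foldr (𝓕._+ᴹ_ y) (𝓕.0ᴹ y) (map g xs)) ≈ᴹ sum xs (λ x → res y<z (g x))
      res-sum y<z []       g = res-0 y<z
      res-sum y<z (x ∷ xs) g = M.≈ᴹ-trans (res-+ y<z _ _) (M.+ᴹ-congˡ (res-sum y<z xs g))

      *ₗ-sum : ∀ {a} {I : Set a} c (xs : List I) (g : I → M.Carrierᴹ) → c *ₗ sum xs g ≈ᴹ sum xs (λ x → c *ₗ g x)
      *ₗ-sum c []       g = M.*ₗ-zeroʳ c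
      *ₗ-sum c (x ∷ xs) g = M.≈ᴹ-trans (M.*ₗ-distribˡ c _ _) (M.+ᴹ-congˡ (*ₗ-sum c xs g))

      sum-*ₗ : ∀ {a} {I : Set a} (xs : List I) (c : I → R.Carrier) s →
               sum xs (λ x → c x *ₗ s) ≈ᴹ foldr R._+_ R.0# (map c xs) *ₗ s
      sum-*ₗ []       c s = M.≈ᴹ-sym (M.*ₗ-zeroˡ s)
      sum-*ₗ (x ∷ xs) c s = M.≈ᴹ-trans (M.+ᴹ-congˡ (sum-*ₗ xs c s)) (M.≈ᴹ-sym (M.*ₗ-distribʳ s _ _))

      row : ∀ y (p : dim y ≡ ℤ.suc j × y ≤ z) .(y<z : y < z) →
            o z y *ₗ res y<z (d f (y , [ proj₁ p ])) ≈ᴹ sum elements (term y)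
      row y (dy , y≤z) y<z = M.≈ᴹ-trans (M.*ₗ-congˡ (res-sum y<z (facesBelow y j) _))
        (M.≈ᴹ-trans (*ₗ-sum (o z y) (facesBelow y j) _)
        (sum-collect (λ x → dim x ℤ.≟ j ×-dec x ≤? y) elements
          (λ x (dx , x≤y) → M.≈ᴹ-trans (M.*ₗ-congˡ (M.≈ᴹ-trans (res-*ₗ y<z _ _) (M.*ₗ-congˡ (res-res (below dx dy x≤y) y<z (x<z (dx , ≤-trans x≤y y≤z)) _))))
            (M.≈ᴹ-trans (M.≈ᴹ-sym (M.*ₗ-assoc _ _ _))
            (M.≈ᴹ-trans (M.*ₗ-congˡ (M.≈ᴹ-sym (restricted-yes x (dim x ℤ.≟ j ×-dec x ≤? z) (dx , ≤-trans x≤y y≤z))))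
              (M.≈ᴹ-sym (term-yes y x (between? x z y) (below dx dy x≤y , below dy dz y≤z))))))
          (λ x ¬p → term-no y x (between? x z y) λ x<y y<z →
            restricted-no x (dim x ℤ.≟ j ×-dec x ≤? z) λ (dx , _) → ¬p (dx , proj₁ x<y))))

      row-0 : ∀ y → ¬ (dim y ≡ ℤ.suc j × y ≤ z) → sum elements (term y) ≈ᴹ 0ᴹ
      row-0 y ¬p = sum-0 elements λ x → term-no y x (between? x z y) λ x<y y<z →
        restricted-no x (dim x ℤ.≟ j ×-dec x ≤? z) λ (dx , _) → ¬p (middle-dim dx x<y y<z , proj₁ y<z)

      column-0 : ∀ x → Dec (dim x ≡ j × x ≤ z) →
                 foldr R._+_ R.0# (map (λ y → o z y R.* o y x) (filter (between? x z) elements)) *ₗ restricted x ≈ᴹ 0ᴹ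
      column-0 x (yes (dx , x≤z)) = M.≈ᴹ-trans (M.*ₗ-congʳ (proj₂ orientation x≤z
        (≡-trans dz (≡-trans (+2 j) (cong (ℤ._+ + 2) (≡-sym dx)))))) (M.*ₗ-zeroˡ _)
        where
        +2 : ∀ j → 1ℤ ℤ.+ (1ℤ ℤ.+ j) ≡ j ℤ.+ + 2
        +2 = ℤ.solve-∀
      column-0 x (no ¬p) = M.≈ᴹ-trans (M.*ₗ-congˡ (restricted-no x (dim x ℤ.≟ j ×-dec x ≤? z) ¬p)) (M.*ₗ-zeroʳ _)

      -- For fixed x all terms are multiples of the one element `restricted x`, and their
      -- coefficients add up to the sum that the orientation axiom makes zero.
      column : ∀ x → sum elements (λ y → term y x) ≈ᴹ 0ᴹ
      column x = M.≈ᴹ-trans (M.≈ᴹ-sym (sum-filter (between? x z) elements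
          (λ y p → M.≈ᴹ-sym (term-yes y x (between? x z y) p)) (λ y ¬p → term-no y x (between? x z y) λ p q → contradiction (p , q) ¬p)))
        (M.≈ᴹ-trans (sum-*ₗ (filter (between? x z) elements) _ (restricted x)) (column-0 x (dim x ℤ.≟ j ×-dec x ≤? z)))

      dd≈0 : d (d f) (z , [ dz ]) ≈ᴹ 0ᴹ
      dd≈0 = M.≈ᴹ-trans (sum-collect (λ y → dim y ℤ.≟ ℤ.suc j ×-dec y ≤? z) elements
          (λ y p → row y p (below (proj₁ p) dz (proj₂ p))) row-0)
        (M.≈ᴹ-trans (sum-swap term elements elements) (sum-0 elements column))

  d∘d : ∀ {j} (f : C j) → d (d f) ≈ᶜ 0ᶜ
  d∘d f z = dd≈0 f (value z) (P.face-dim z)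

module _ {r ℓr m ℓm} {R : CommutativeRing r ℓr} (X : GradedPoset)
  (o : GradedPoset.Carrier X → GradedPoset.Carrier X → CommutativeRing.Carrier R) (ℱ : Sheaf R X m ℓm) where
  private
    module Cₓ = Cochains X o ℱ

  d-cast : ∀ {i i′} (e : i ≡ i′) (g : Cₓ.C i′) y .(p : GradedPoset.dim X y ≡ ℤ.suc i) .(p′ : GradedPoset.dim X y ≡ ℤ.suc i′) →
           Cₓ.𝓕._≈ᴹ_ y (Cₓ.d (λ x → g (GradedPoset.cast X e x)) (y , [ p ])) (Cₓ.d g (y , [ p′ ]))
  d-cast ≡-refl g y p p′ = Cₓ.𝓕.≈ᴹ-refl y

module _ {r ℓr m ℓm} {R : CommutativeRing r ℓr} (X : GradedPoset)
  (o : GradedPoset.Carrier X → GradedPoset.Carrier X → CommutativeRing.Carrier R) (ℱ : Sheaf R X m ℓm)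
  (u : GradedPoset.Carrier X) where
  private
    module X = GradedPoset X
    module Xᵤ = GradedPoset (link X u)
    module Cₓ = Cochains X o ℱ
    module Cᵤ = Cochains (link X u) (linkOrientation {R = R} X u o) (linkSheaf X u ℱ)
    open Cₓ using (module 𝓕)

  -- Extension by zero commutes with the coboundary, so a coboundary of the link extends to a
  -- coboundary of X. The sign puts h - bᵘ into the form h + d (gᵘ) in which the Correction
  -- Algorithm changes its coboundary.
  -ᶜ-as-d : ∀ {n j} (e : n ≡ ℤ.suc j) (b : Cᵤ.C (n ℤ.- X.dim u ℤ.- 1ℤ)) → Cᵤ.B (n ℤ.- X.dim u ℤ.- 1ℤ) b →
            ∃[ g ] ∀ (x : X.Face n) → 𝓕._≈ᴹ_ (value x) (𝓕.-ᴹ_ (value x) (extendByZero X o ℱ u n b x))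
                        (Cₓ.d (extendByZero X o ℱ u j g) (X.cast e x))
  -ᶜ-as-d {j = j} ≡-refl b (g′ , b≈dg′) = g , λ x → compare x (u X.≤? value x)
    where
    n = ℤ.suc j
    unsuc : ∀ i a → i ℤ.- a ℤ.- 1ℤ ≡ -1ℤ ℤ.+ ((1ℤ ℤ.+ i) ℤ.- a ℤ.- 1ℤ)
    unsuc = ℤ.solve-∀
    -g′ : Cᵤ.C (ℤ.pred (n ℤ.- X.dim u ℤ.- 1ℤ))
    -g′ = Cᵤ.0ᶜ Cᵤ.-ᶜ g′
    g : Cᵤ.C (j ℤ.- X.dim u ℤ.- 1ℤ)
    g x = -g′ (Xᵤ.cast (unsuc j (X.dim u)) x)
    gᵘ : Cₓ.C j
    gᵘ = extendByZero X o ℱ u j g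
    compare : ∀ (x : X.Face n) → Dec (u X.≤ value x) →
              𝓕._≈ᴹ_ (value x) (𝓕.-ᴹ_ (value x) (extendByZero X o ℱ u n b x)) (Cₓ.d gᵘ (X.cast ≡-refl x))
    compare x@(v , [ dv ]) (yes u≤v) = 𝓕.≈ᴹ-sym v (begin
      Cₓ.d gᵘ (v , [ dv ])  ≈⟨ d-extend-above X o ℱ u g v u≤v dv ⟩
      Cᵤ.d g (v̂ , [ codim-suc⁻ X o ℱ u {j = j} dv ])  ≈⟨ d-cast (link X u) (linkOrientation {R = R} X u o) (linkSheaf X u ℱ)
                        (unsuc j (X.dim u)) -g′ v̂ (codim-suc⁻ X o ℱ u {j = j} dv) (dim-v̂ dv) ⟩
      Cᵤ.d -g′ (v̂ , [ dim-v̂ dv ])  ≈⟨ Cᵤ.d-sub Cᵤ.0ᶜ g′ (v̂ , [ dim-v̂ dv ]) ⟩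
      (Cᵤ.d Cᵤ.0ᶜ Cᵤ.-ᶜ Cᵤ.d g′) (v̂ , [ dim-v̂ dv ])  ≈⟨ 𝓕.+ᴹ-cong v (Cᵤ.d-0 (Cᵤ.≈ᶜ-refl {f = Cᵤ.0ᶜ}) (v̂ , [ dim-v̂ dv ]))
                        (𝓕.-ᴹ‿cong v (𝓕.≈ᴹ-sym v (b≈dg′ (toLink X o ℱ u x u≤v)))) ⟩
      𝓕._+ᴹ_ v (𝓕.0ᴹ v) (𝓕.-ᴹ_ v (b (toLink X o ℱ u x u≤v)))  ≈⟨ 𝓕.+ᴹ-identityˡ v _ ⟩
      𝓕.-ᴹ_ v (b (toLink X o ℱ u x u≤v))  ≈⟨ 𝓕.-ᴹ‿cong v (extend-above X o ℱ u b x u≤v) ⟨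
      𝓕.-ᴹ_ v (extendByZero X o ℱ u n b x)  ∎)
      where
      open Relation.Binary.Reasoning.Setoid (Module.≈ᴹ-setoid (Sheaf.𝓕 ℱ v))
      v̂ : Xᵤ.Carrier
      v̂ = v , [ u≤v ]
      .dim-v̂ : X.dim v ≡ n → Xᵤ.dim v̂ ≡ ℤ.suc (ℤ.pred (n ℤ.- X.dim u ℤ.- 1ℤ))
      dim-v̂ e = ≡-trans (cong (λ i → i ℤ.- X.dim u ℤ.- 1ℤ) e) (≡-sym (ℤ.suc-pred _))
    compare x (no u≰v) = 𝓕.≈ᴹ-trans (value x) (𝓕.-ᴹ‿cong (value x) (extend-outside X o ℱ u b x u≰v))
      (𝓕.≈ᴹ-trans (value x) (𝓕.≈ᴹ-trans (value x) (𝓕.≈ᴹ-sym (value x) (𝓕.+ᴹ-identityˡ (value x) _)) (𝓕.-ᴹ‿inverseʳ (value x) _))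
        (𝓕.≈ᴹ-sym (value x) (d-extend-outside X o ℱ u g x u≰v)))

-- Exponents of the thresholds

∣∣-mono : ∀ {i j} → 0ℤ ℤ.≤ i → i ℤ.≤ j → ∣ i ∣ ℕ.≤ ∣ j ∣
∣∣-mono {+ _} {+ _} _ (ℤ.+≤+ p) = p

-- For c = suc j both sides agree: 2^(j+1) + 2^(j+1) (2^s - 1) = 2^(j+1+s). This is the exponent
-- form of β π b ≤ B (π r)², with j = n - r, c = k + 1 - r and s = r - 1 - b.
2^-exponents : ∀ {c j} s → c ℕ.≤ suc j →
               2 ℕ.^ j ℕ.+ 2 ℕ.^ j ℕ.+ 2 ℕ.^ c ℕ.* (2 ℕ.^ s ℕ.∸ 1) ℕ.≤ 2 ℕ.^ (suc j ℕ.+ s)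
2^-exponents {c} {j} s c≤ = begin
  2 ℕ.^ j ℕ.+ 2 ℕ.^ j ℕ.+ 2 ℕ.^ c ℕ.* (2 ℕ.^ s ℕ.∸ 1)  ≡⟨ cong (λ x → 2 ℕ.^ j ℕ.+ x ℕ.+ 2 ℕ.^ c ℕ.* (2 ℕ.^ s ℕ.∸ 1)) (ℕ.+-identityʳ (2 ℕ.^ j)) ⟨
  2 ℕ.^ suc j ℕ.+ 2 ℕ.^ c ℕ.* (2 ℕ.^ s ℕ.∸ 1)  ≤⟨ ℕ.+-monoʳ-≤ (2 ℕ.^ suc j) (ℕ.*-monoˡ-≤ (2 ℕ.^ s ℕ.∸ 1) (ℕ.^-monoʳ-≤ 2 c≤)) ⟩
  2 ℕ.^ suc j ℕ.+ 2 ℕ.^ suc j ℕ.* (2 ℕ.^ s ℕ.∸ 1)  ≡⟨ ℕ.*-suc (2 ℕ.^ suc j) (2 ℕ.^ s ℕ.∸ 1) ⟨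
  2 ℕ.^ suc j ℕ.* suc (2 ℕ.^ s ℕ.∸ 1)  ≡⟨ cong (2 ℕ.^ suc j ℕ.*_) (ℕ.m+[n∸m]≡n (ℕ.m^n>0 2 s)) ⟩
  2 ℕ.^ suc j ℕ.* 2 ℕ.^ s  ≡⟨ ℕ.^-distribˡ-+-* 2 (suc j) s ⟨
  2 ℕ.^ (suc j ℕ.+ s)  ∎
  where open ℕ.≤-Reasoning

module _ {k n : ℕ} (k≤n : k ℕ.≤ n) (n≤k+1 : n ℕ.≤ k ℕ.+ 1) {r b : ℤ} (r≤n : r ℤ.≤ + n) (b<r : b ℤ.< r) where
  private
    c j s : ℕ
    c = ∣ + k ℤ.+ 1ℤ ℤ.- r ∣
    j = ∣ + n ℤ.- r ∣
    s = ∣ r ℤ.- 1ℤ ℤ.- b ∣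

    r≤k+1 : r ℤ.≤ + k ℤ.+ 1ℤ
    r≤k+1 = ℤ.≤-trans r≤n (ℤ.+≤+ n≤k+1)

    +c : + c ≡ + k ℤ.+ 1ℤ ℤ.- r
    +c = ℤ.0≤i⇒+∣i∣≡i (ℤ.i≤j⇒0≤j-i r≤k+1)

    +j : + j ≡ + n ℤ.- r
    +j = ℤ.0≤i⇒+∣i∣≡i (ℤ.i≤j⇒0≤j-i r≤n)

    rearrange : ∀ r b → r ℤ.- (1ℤ ℤ.+ b) ≡ r ℤ.- 1ℤ ℤ.- b
    rearrange = ℤ.solve-∀

    +s : + s ≡ r ℤ.- 1ℤ ℤ.- b
    +s = ℤ.0≤i⇒+∣i∣≡i (subst (0ℤ ℤ.≤_) (rearrange r b) (ℤ.i≤j⇒0≤j-i (ℤ.i<j⇒suc[i]≤j b<r)))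

  codim≤ : ∣ + n ℤ.- r ∣ ℕ.≤ ∣ + k ℤ.+ 1ℤ ℤ.- r ∣
  codim≤ = ℤ.drop‿+≤+ (subst₂ ℤ._≤_ (≡-sym +j) (≡-sym +c) (ℤ.+-monoˡ-≤ (ℤ.- r) (ℤ.+≤+ n≤k+1)))

  codim≥ : ∣ + k ℤ.+ 1ℤ ℤ.- r ∣ ℕ.≤ suc ∣ + n ℤ.- r ∣
  codim≥ = ℤ.drop‿+≤+ (subst₂ ℤ._≤_ (≡-trans (shift (+ k) r) (≡-sym +c)) (cong (λ i → 1ℤ ℤ.+ i) (≡-sym +j))
    (ℤ.+-monoʳ-≤ 1ℤ (ℤ.+-monoˡ-≤ (ℤ.- r) (ℤ.+≤+ k≤n))))
    where
    shift : ∀ k r → 1ℤ ℤ.+ (k ℤ.+ (ℤ.- r)) ≡ k ℤ.+ 1ℤ ℤ.- r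
    shift = ℤ.solve-∀

  codim-+ : ∣ + n ℤ.- b ∣ ≡ suc ∣ + n ℤ.- r ∣ ℕ.+ ∣ r ℤ.- 1ℤ ℤ.- b ∣
  codim-+ = cong ∣_∣ (≡-trans (split (+ n) r b) (cong₂ (λ x y → 1ℤ ℤ.+ x ℤ.+ y) (≡-sym +j) (≡-sym +s)))
    where
    split : ∀ n r b → n ℤ.- b ≡ 1ℤ ℤ.+ (n ℤ.- r) ℤ.+ (r ℤ.- 1ℤ ℤ.- b)
    split = ℤ.solve-∀

-- `k ℕ.+ 1` and `suc k` are equal only propositionally. The inclusion of quadruples lets hypotheses
-- about `𝓘` be used for the transported profile.
castProfile : ∀ {m n} (X : GradedPoset) → m ≡ n → (𝓘 : AbstractIntersectionProfile m) → IsIntersectionProfileFor 𝓘 X →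
              Σ[ 𝓙 ∈ AbstractIntersectionProfile n ] IsIntersectionProfileFor 𝓙 X ×
              (∀ {p} → p ∈ₚ AbstractIntersectionProfile.𝒫 𝓙 → p ∈ₚ AbstractIntersectionProfile.𝒫 𝓘)
castProfile X ≡-refl 𝓘 isProfile = 𝓘 , isProfile , id

-- Ratios of face counts bounded by L(X)

module _ (lem : ∀ {ℓ} → ExcludedMiddle ℓ) (ℝ : CompleteOrderedField) where
  open CompleteOrderedField ℝ
  open Classical lem ℝ using (irregularity)
  open Data.List.Extrema totalOrder using (max; xs≤max)
  private
    -- Spells out the list of dimensions, which is private where `irregularity` is defined.
    irregularity-def : ∀ d X → let open GradedPoset X using (Fᵐᵃˣ; Fᵐⁱⁿ) in irregularity d X ≡ max 0#
      (map (λ (i , j , k) → fromℕ (Fᵐᵃˣ i j k) / fromℕ (Fᵐⁱⁿ i j k))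
        (filter (λ (i , j , k) → i ℤ.≤? j ×-dec j ℤ.≤? k)
          (cartesianProduct (map (λ n → ℤ.pred (+ n)) (upTo (2 ℕ.+ d))) (cartesianProduct (map (λ n → ℤ.pred (+ n)) (upTo (2 ℕ.+ d))) (map (λ n → ℤ.pred (+ n)) (upTo (2 ℕ.+ d)))))))
    irregularity-def d X = ≡-refl

    ∈-range : ∀ {d j} → -1ℤ ℤ.≤ j → j ℤ.≤ + d → j ∈ map (λ n → ℤ.pred (+ n)) (upTo (2 ℕ.+ d))
    ∈-range {j = + n}          _ (ℤ.+≤+ n≤d) = ∈-map⁺ (λ n → ℤ.pred (+ n)) (∈-upTo⁺ (s≤s (s≤s n≤d)))
    ∈-range {j = ℤ.-[1+ 0 ]}   _ _  = ∈-map⁺ (λ n → ℤ.pred (+ n)) {x = 0} (∈-upTo⁺ (s≤s z≤n))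
    ∈-range {j = ℤ.-[1+ suc n ]} (ℤ.-≤- ()) _

    entry≤max : ∀ {b i j} (range : List ℤ) (f : ℤ × ℤ × ℤ → Carrier) → b ∈ range → i ∈ range → j ∈ range →
                b ℤ.≤ i → i ℤ.≤ j → ∀ {m} →
                m ≡ max 0# (map f (filter (λ (i , j , k) → i ℤ.≤? j ×-dec j ℤ.≤? k)
                                  (cartesianProduct range (cartesianProduct range range)))) →
                f (b , i , j) ≤ m
    entry≤max range f b∈ i∈ j∈ b≤i i≤j ≡-refl = All.lookup (xs≤max 0# _) (∈-map⁺ f
      (∈-filter⁺ (λ (i , j , k) → i ℤ.≤? j ×-dec j ℤ.≤? k)
        (∈-cartesianProduct⁺ b∈ (∈-cartesianProduct⁺ i∈ j∈)) (b≤i , i≤j)))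

  ratio≤irregularity : ∀ d X {b i} → -1ℤ ℤ.≤ b → b ℤ.≤ i → i ℤ.≤ + d →
                       let open GradedPoset X using (Fᵐᵃˣ; Fᵐⁱⁿ) in fromℕ (Fᵐᵃˣ b i (+ d)) / fromℕ (Fᵐⁱⁿ b i (+ d)) ≤ irregularity d X
  ratio≤irregularity d X {b} {i} -1≤b b≤i i≤d =
    entry≤max (map (λ n → ℤ.pred (+ n)) (upTo (2 ℕ.+ d))) (λ (i , j , k) → fromℕ (Fᵐᵃˣ i j k) / fromℕ (Fᵐⁱⁿ i j k))
      (∈-range -1≤b (ℤ.≤-trans b≤i i≤d)) (∈-range (ℤ.≤-trans -1≤b b≤i) i≤d) (∈-range ℤ.-≤+ ℤ.≤-refl) b≤i i≤d
      (irregularity-def d X)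
    where open GradedPoset X using (Fᵐᵃˣ; Fᵐⁱⁿ)

-- Ordered field arithmetic

module Reals (lem : ∀ {ℓ} → ExcludedMiddle ℓ) (ℝ : CompleteOrderedField) where
  open CompleteOrderedField ℝ
    using (commutativeSemiring; semiring; +-commutativeMonoid; 0≉1; isTotalOrder; complete; totalOrder; ring;
           -‿inverseʳ; -‿inverseˡ; IsInfimum; IsLowerBound)
  open CompleteOrderedField ℝ public
    using (_≈_; _≉_; _≤_; _<_; _+_; _*_; -_; _/_; _⁻¹; _^_; 0#; 1#; ½; ∑; fromℕ; refl; sym; trans; reflexive;
           +-cong; +-congˡ; +-congʳ; *-cong; *-congˡ; *-congʳ; +-comm; +-assoc; *-comm; *-assoc;
           +-identityˡ; +-identityʳ; *-identityˡ; *-identityʳ; zeroˡ; zeroʳ; distribˡ; distribʳ;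
           +-monoˡ-≤; *-nonNeg; *-inverseʳ; ⁻¹-cong)
    renaming (Carrier to |ℝ|)
  open Classical lem ℝ
    using (inf; subset; WeightedHypergraph; module WeightedHypergraph; NIH)
  open TotalOrder totalOrder using (poset; antisym; total) public
    renaming (refl to ≤-refl; reflexive to ≤-reflexive; trans to ≤-trans)
  open Algebra.Solver.Ring.NaturalCoefficients.Default commutativeSemiring public
    using (solve; _:=_; _:+_; _:*_; con)
  open Algebra.Properties.Semiring.Exp semiring public using (^-homo-*)
  open MonoidSum +-commutativeMonoid public
    renaming (sum-cong to ∑-cong; sum-0 to ∑-0; sum-∙ to ∑-+; sum-swap to ∑-swap;
              sum-filter to ∑-filter; sum-collect to ∑-collect) using ()
  private
    module S = NonStrictToStrict _≈_ _≤_
  open Relation.Binary.Reasoning.PartialOrder poset public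

  ≤-respˡ : ∀ {x x′ y} → x ≈ x′ → x ≤ y → x′ ≤ y
  ≤-respˡ e p = ≤-trans (≤-reflexive (sym e)) p

  ≤-respʳ : ∀ {x y y′} → y ≈ y′ → x ≤ y → x ≤ y′
  ≤-respʳ e p = ≤-trans p (≤-reflexive e)

  <⇒≱ : ∀ {x y} → x < y → ¬ (y ≤ x)
  <⇒≱ = S.<⇒≱ antisym

  ≰⇒> : ∀ {x y} → ¬ (x ≤ y) → y < x
  ≰⇒> = S.≰⇒> sym ≤-reflexive total

  ≮⇒≥ : ∀ {x y} → ¬ (x < y) → y ≤ x
  ≮⇒≥ {x} {y} x≮y with lem {P = y ≤ x}
  ... | yes y≤x = y≤x
  ... | no  y≰x = contradiction (≰⇒> y≰x) x≮y

  <-≤-trans : ∀ {x y z} → x < y → y ≤ z → x < z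
  <-≤-trans = S.<-≤-trans sym ≤-trans antisym (λ e p → ≤-respʳ e p)

  ≤-<-trans : ∀ {x y z} → x ≤ y → y < z → x < z
  ≤-<-trans = S.≤-<-trans ≤-trans antisym (λ e p → ≤-respˡ e p)

  <-trans : ∀ {x y z} → x < y → y < z → x < z
  <-trans x<y y<z = ≤-<-trans (proj₁ x<y) y<z

  +-monoʳ-≤ : ∀ {x y} z → x ≤ y → z + x ≤ z + y
  +-monoʳ-≤ {x} {y} z x≤y = ≤-respˡ (+-comm x z) (≤-respʳ (+-comm y z) (+-monoˡ-≤ z x≤y))

  +-mono-≤ : ∀ {x y u v} → x ≤ y → u ≤ v → x + u ≤ y + v
  +-mono-≤ {y = y} {u = u} p q = ≤-trans (+-monoˡ-≤ u p) (+-monoʳ-≤ y q)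

  +-cancelʳ : ∀ x z → (x + z) + (- z) ≈ x
  +-cancelʳ x z = trans (+-assoc x z (- z)) (trans (+-congˡ (-‿inverseʳ z)) (+-identityʳ x))

  +-cancelʳ-≤ : ∀ {x y} z → x + z ≤ y + z → x ≤ y
  +-cancelʳ-≤ {x} {y} z p = ≤-respˡ (+-cancelʳ x z) (≤-respʳ (+-cancelʳ y z) (+-monoˡ-≤ (- z) p))

  x-y+y≈x : ∀ x y → (x + (- y)) + y ≈ x
  x-y+y≈x x y = trans (+-assoc x (- y) y) (trans (+-congˡ (-‿inverseˡ y)) (+-identityʳ x))

  ≤-neg : ∀ {x} → x ≤ 0# → 0# ≤ - x
  ≤-neg {x} p = ≤-respˡ (-‿inverseʳ x) (≤-respʳ (+-identityˡ (- x)) (+-monoˡ-≤ (- x) p))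

  x≤x+y : ∀ {x y} → 0# ≤ y → x ≤ x + y
  x≤x+y {x} p = ≤-respˡ (+-identityʳ x) (+-monoʳ-≤ x p)

  x≤y+x : ∀ {x y} → 0# ≤ y → x ≤ y + x
  x≤y+x {x} {y} p = ≤-respʳ (+-comm x y) (x≤x+y p)

  +-nonNeg : ∀ {x y} → 0# ≤ x → 0# ≤ y → 0# ≤ x + y
  +-nonNeg p q = ≤-trans p (x≤x+y q)

  *-monoʳ-≤ : ∀ {x y z} → 0# ≤ z → x ≤ y → z * x ≤ z * y
  *-monoʳ-≤ {x} {y} {z} 0≤z x≤y = begin
    z * x  ≈⟨ +-identityˡ _ ⟨
    0# + z * x  ≤⟨ +-monoˡ-≤ (z * x) (*-nonNeg 0≤z 0≤y-x) ⟩
    z * (y + - x) + z * x  ≈⟨ distribˡ z _ _ ⟨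
    z * ((y + - x) + x)  ≈⟨ *-congˡ (x-y+y≈x y x) ⟩
    z * y  ∎
    where
    0≤y-x : 0# ≤ y + - x
    0≤y-x = ≤-respˡ (-‿inverseʳ x) (+-monoˡ-≤ (- x) x≤y)

  *-monoˡ-≤ : ∀ {x y z} → 0# ≤ z → x ≤ y → x * z ≤ y * z
  *-monoˡ-≤ {x} {y} {z} p q = ≤-respˡ (*-comm z x) (≤-respʳ (*-comm z y) (*-monoʳ-≤ p q))

  *-mono-≤ : ∀ {x y u v} → 0# ≤ y → 0# ≤ u → x ≤ y → u ≤ v → x * u ≤ y * v
  *-mono-≤ 0≤y 0≤u p q = ≤-trans (*-monoˡ-≤ 0≤u p) (*-monoʳ-≤ 0≤y q)

  0≤1 : 0# ≤ 1#
  0≤1 with total 0# 1#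
  ... | inj₁ p = p
  ... | inj₂ 1≤0 = ≤-respʳ e (*-nonNeg (≤-neg 1≤0) (≤-neg 1≤0))
    where
    open Algebra.Properties.Ring ring using (-1*x≈-x; -‿involutive)
    e : - 1# * - 1# ≈ 1#
    e = trans (-1*x≈-x (- 1#)) (-‿involutive 1#)

  0<1 : 0# < 1#
  0<1 = 0≤1 , 0≉1

  *-inverseˡ : ∀ {x} → x ≉ 0# → x ⁻¹ * x ≈ 1#
  *-inverseˡ {x} p = trans (*-comm (x ⁻¹) x) (*-inverseʳ p)

  pos⇒≉0 : ∀ {x} → 0# < x → x ≉ 0#
  pos⇒≉0 (_ , 0≉x) x≈0 = 0≉x (sym x≈0)

  *-pos : ∀ {x y} → 0# < x → 0# < y → 0# < x * y
  *-pos {x} {y} 0<x 0<y = *-nonNeg (proj₁ 0<x) (proj₁ 0<y) , λ 0≈xy → proj₂ 0<y (begin-equality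
    0#  ≈⟨ zeroʳ (x ⁻¹) ⟨
    x ⁻¹ * 0#  ≈⟨ *-congˡ 0≈xy ⟩
    x ⁻¹ * (x * y)  ≈⟨ *-assoc _ _ _ ⟨
    x ⁻¹ * x * y  ≈⟨ *-congʳ (*-inverseˡ (pos⇒≉0 0<x)) ⟩
    1# * y  ≈⟨ *-identityˡ y ⟩
    y  ∎)

  ⁻¹-pos : ∀ {x} → 0# < x → 0# < x ⁻¹
  ⁻¹-pos {x} 0<x = ≰⇒> λ x⁻¹≤0 → <⇒≱ 0<1 (begin
    1#  ≈⟨ *-inverseʳ (pos⇒≉0 0<x) ⟨
    x * x ⁻¹  ≤⟨ *-monoʳ-≤ (proj₁ 0<x) x⁻¹≤0 ⟩
    x * 0#  ≈⟨ zeroʳ x ⟩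
    0#  ∎)

  x/y*y≈x : ∀ {x y} → 0# < y → x / y * y ≈ x
  x/y*y≈x {x} {y} 0<y =
    trans (*-assoc x (y ⁻¹) y) (trans (*-congˡ (*-inverseˡ (pos⇒≉0 0<y))) (*-identityʳ x))

  x*y/y≈x : ∀ {x y} → 0# < y → (x * y) / y ≈ x
  x*y/y≈x {x} {y} 0<y =
    trans (*-assoc x y (y ⁻¹)) (trans (*-congˡ (*-inverseʳ (pos⇒≉0 0<y))) (*-identityʳ x))

  *-cancelʳ-≤ : ∀ {x y z} → 0# < z → x * z ≤ y * z → x ≤ y
  *-cancelʳ-≤ 0<z p = ≤-respˡ (x*y/y≈x 0<z) (≤-respʳ (x*y/y≈x 0<z) (*-monoˡ-≤ (proj₁ (⁻¹-pos 0<z)) p))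

  *-cancelˡ-≤ : ∀ {x y z} → 0# < z → z * x ≤ z * y → x ≤ y
  *-cancelˡ-≤ {x} {y} {z} 0<z p = *-cancelʳ-≤ 0<z (≤-respˡ (*-comm z x) (≤-respʳ (*-comm z y) p))

  x≤y/z : ∀ {x y z} → 0# < z → x * z ≤ y → x ≤ y / z
  x≤y/z 0<z p = *-cancelʳ-≤ 0<z (≤-respʳ (sym (x/y*y≈x 0<z)) p)

  x/z≤y : ∀ {x y z} → 0# < z → x ≤ y * z → x / z ≤ y
  x/z≤y 0<z p = *-cancelʳ-≤ 0<z (≤-respˡ (sym (x/y*y≈x 0<z)) p)

  ⁻¹-≤1 : ∀ {x} → 1# ≤ x → x ⁻¹ ≤ 1#
  ⁻¹-≤1 {x} 1≤x = ≤-respˡ (*-identityˡ _)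
    (x/z≤y (<-≤-trans 0<1 1≤x) (≤-respʳ (sym (*-identityˡ x)) 1≤x))

  x≤y*x : ∀ {x y} → 0# ≤ x → 1# ≤ y → x ≤ y * x
  x≤y*x {x} p q = ≤-respˡ (*-identityˡ x) (*-monoˡ-≤ p q)

  x≤x*y : ∀ {x y} → 0# ≤ x → 1# ≤ y → x ≤ x * y
  x≤x*y {x} {y} p q = ≤-respʳ (*-comm y x) (x≤y*x p q)

  x*y≤x : ∀ {x y} → 0# ≤ x → y ≤ 1# → x * y ≤ x
  x*y≤x {x} p q = ≤-respʳ (*-identityʳ x) (*-monoʳ-≤ p q)

  y*x≤x : ∀ {x y} → 0# ≤ x → y ≤ 1# → y * x ≤ x
  y*x≤x {x} {y} p q = ≤-respˡ (*-comm x y) (x*y≤x p q)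

  1≤x*y : ∀ {x y} → 1# ≤ x → 1# ≤ y → 1# ≤ x * y
  1≤x*y p q = ≤-trans q (x≤y*x (≤-trans 0≤1 q) p)

  ^-pos : ∀ {x} n → 0# < x → 0# < x ^ n
  ^-pos zero    p = 0<1
  ^-pos (suc n) p = *-pos p (^-pos n p)

  ^-≤1 : ∀ {x} n → 0# < x → x ≤ 1# → x ^ n ≤ 1#
  ^-≤1 zero    p q = ≤-refl
  ^-≤1 (suc n) p q = ≤-trans (x*y≤x (proj₁ p) (^-≤1 n p q)) q

  1≤^ : ∀ {x} n → 1# ≤ x → 1# ≤ x ^ n
  1≤^ zero    p = ≤-refl
  1≤^ (suc n) p = 1≤x*y p (1≤^ n p)

  ^-anti : ∀ {x m n} → 0# < x → x ≤ 1# → m ℕ.≤ n → x ^ n ≤ x ^ m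
  ^-anti {n = n} p q z≤n = ^-≤1 n p q
  ^-anti p q (s≤s m≤n) = *-monoʳ-≤ (proj₁ p) (^-anti p q m≤n)

  ^-mono-exp : ∀ {x m n} → 1# ≤ x → m ℕ.≤ n → x ^ m ≤ x ^ n
  ^-mono-exp {n = n} p z≤n = 1≤^ n p
  ^-mono-exp p (s≤s m≤n) = *-monoʳ-≤ (≤-trans 0≤1 p) (^-mono-exp p m≤n)

  fromℕ-nonNeg : ∀ n → 0# ≤ fromℕ n
  fromℕ-nonNeg zero  = ≤-refl
  fromℕ-nonNeg (suc n) = +-nonNeg 0≤1 (fromℕ-nonNeg n)

  fromℕ-mono : ∀ {m n} → m ℕ.≤ n → fromℕ m ≤ fromℕ n
  fromℕ-mono {n = n} z≤n = fromℕ-nonNeg n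
  fromℕ-mono (s≤s p) = +-monoʳ-≤ 1# (fromℕ-mono p)

  1≤fromℕ : ∀ {n} → 1 ℕ.≤ n → 1# ≤ fromℕ n
  1≤fromℕ {n} p = ≤-respˡ (+-identityʳ 1#) (fromℕ-mono p)

  ½-pos : 0# < ½
  ½-pos = ⁻¹-pos (<-≤-trans 0<1 (1≤fromℕ {2} (s≤s z≤n)))

  ½+½ : ∀ x → ½ * x + ½ * x ≈ x
  ½+½ x = begin-equality
    ½ * x + ½ * x  ≈⟨ +-cong (sym (*-identityʳ _)) (sym (*-identityʳ _)) ⟩
    ½ * x * 1# + ½ * x * 1#  ≈⟨ +-congˡ (*-congˡ (+-identityʳ 1#)) ⟨
    ½ * x * 1# + ½ * x * (1# + 0#)  ≈⟨ distribˡ (½ * x) 1# (1# + 0#) ⟨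
    ½ * x * fromℕ 2  ≈⟨ solve 3 (λ h y t → h :* y :* t := h :* t :* y) refl ½ x (fromℕ 2) ⟩
    ½ * fromℕ 2 * x  ≈⟨ *-congʳ (*-inverseˡ (pos⇒≉0 (<-≤-trans 0<1 (1≤fromℕ {2} (s≤s z≤n))))) ⟩
    1# * x  ≈⟨ *-identityˡ x ⟩
    x  ∎

  ½*x≤x : ∀ {x} → 0# ≤ x → ½ * x ≤ x
  ½*x≤x {x} p = ≤-respʳ (½+½ x) (x≤x+y (*-nonNeg (proj₁ ½-pos) p))

  ½≤1 : ½ ≤ 1#
  ½≤1 = ≤-respˡ (*-identityʳ ½) (½*x≤x 0≤1)

  ≤-½⇒≤0 : ∀ {x} → x ≤ ½ * x → x ≤ 0#
  ≤-½⇒≤0 {x} p = *-cancelˡ-≤ ½-pos (≤-respʳ (sym (zeroʳ ½))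
    (+-cancelʳ-≤ (½ * x) (≤-respˡ (sym (½+½ x)) (≤-respʳ (sym (+-identityˡ _)) p))))

  module _ {p} {S : Pred |ℝ| p} where

    -- The lower bound `0#` covers the default value that `inf` takes when no infimum exists.
    inf≤ : ∀ {s} → IsLowerBound S 0# → s ∈ₚ S → inf S ≤ s
    inf≤ 0≤S s∈S with lem {P = ∃ (IsInfimum S)}
    ... | yes (_ , lower , _) = lower s∈S
    ... | no  _  = 0≤S s∈S

    -- The supremum of the set of lower bounds. `complete` accepts only predicates of level `0ℓ`,
    -- hence the encoding through `True`.
    infimum-exists : ∀ {b} → Satisfiable S → IsLowerBound S b → ∃ (IsInfimum S)
    infimum-exists {b} (s , s∈S) b≤S =
      let (i , i-upper , i-least) = complete Lower (b , fromWitness (λ {x} → b≤S {x})) (s , λ x∈ → toWitness x∈ s∈S)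
      in i , (λ {x} x∈S → i-least λ y∈ → toWitness y∈ x∈S) , (λ y∈ → i-upper (fromWitness (λ {x} → y∈ {x})))
      where
      Lower : Pred |ℝ| 0ℓ
      Lower x = True (lem {P = IsLowerBound S x})

    ≤inf : ∀ {b} → Satisfiable S → IsLowerBound S b → b ≤ inf S
    ≤inf ne b≤S with lem {P = ∃ (IsInfimum S)}
    ... | yes (_ , _ , greatest) = greatest b≤S
    ... | no  none  = contradiction (infimum-exists ne b≤S) none

    inf<⇒∃< : ∀ {b} → Satisfiable S → inf S < b → ∃[ s ] s ∈ₚ S × s < b
    inf<⇒∃< {b} ne inf<b with lem {P = ∃[ s ] s ∈ₚ S × s < b}
    ... | yes found = found
    ... | no  none  = contradiction (≤inf ne λ {s} s∈S → ≮⇒≥ λ s<b → none (s , s∈S , s<b)) (<⇒≱ inf<b)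

  -- The indicator of P times r. With weights of sets written as masked sums over all of `elements`,
  -- the double counts below reduce to `∑-swap`.
  mask : ∀ {p} → Set p → |ℝ| → |ℝ|
  mask P r = if does (lem {P = P}) then r else 0#

  module _ {p} {P : Set p} where

    mask-yes : ∀ {r} → P → mask P r ≈ r
    mask-yes px with lem {P = P}
    ... | yes _  = refl
    ... | no ¬px = contradiction px ¬px

    mask-no : ∀ {r} → ¬ P → mask P r ≈ 0#
    mask-no ¬px with lem {P = P}
    ... | yes px = contradiction px ¬px
    ... | no _  = refl

    mask≤ : ∀ {r s} → 0# ≤ s → (P → r ≤ s) → mask P r ≤ s
    mask≤ 0≤s r≤s with lem {P = P}
    ... | yes px = r≤s px
    ... | no _  = 0≤s

    mask-nonNeg : ∀ {r} → (P → 0# ≤ r) → 0# ≤ mask P r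
    mask-nonNeg 0≤r with lem {P = P}
    ... | yes px = 0≤r px
    ... | no _  = ≤-refl

    mask-* : ∀ c {r} → c * mask P r ≈ mask P (c * r)
    mask-* c with lem {P = P}
    ... | yes _ = refl
    ... | no _  = zeroʳ c

    mask-+ : ∀ {r s} → mask P (r + s) ≈ mask P r + mask P s
    mask-+ with lem {P = P}
    ... | yes _ = refl
    ... | no _  = sym (+-identityˡ 0#)

    mask-0 : mask P 0# ≈ 0#
    mask-0 with lem {P = P}
    ... | yes _ = refl
    ... | no _  = refl

    module _ {q} {Q : Set q} where

      mask-split : ∀ {r} → mask P r ≈ mask (P × Q) r + mask (P × ¬ Q) r
      mask-split with lem {P = P} | lem {P = Q} | lem {P = P × Q} | lem {P = P × ¬ Q}
      ... | yes _ | yes _ | yes _ | no _  = sym (+-identityʳ _)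
      ... | yes _ | no _  | no _  | yes _ = sym (+-identityˡ _)
      ... | no _  | _     | no _  | no _  = sym (+-identityˡ _)
      ... | yes p | yes q | no ¬pq | _  = contradiction (p , q) ¬pq
      ... | yes p | yes q | _ | yes (_ , ¬q) = contradiction q ¬q
      ... | yes p | no ¬q | yes (_ , q) | _ = contradiction q ¬q
      ... | yes p | no ¬q | _ | no ¬pq  = contradiction (p , ¬q) ¬pq
      ... | no ¬p | _ | yes (p , _) | _ = contradiction p ¬p
      ... | no ¬p | _ | _ | yes (p , _) = contradiction p ¬p

  mask-mono : ∀ {p q} {P : Set p} {Q : Set q} {r s} →
              (P → Q) → (Q → 0# ≤ s) → (P → r ≤ s) → mask P r ≤ mask Q s
  mask-mono P⇒Q 0≤s r≤s = mask≤ (mask-nonNeg 0≤s) λ px → ≤-respʳ (sym (mask-yes (P⇒Q px))) (r≤s px)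

  mask-cong : ∀ {p q} {P : Set p} {Q : Set q} {r s} → (P → Q) → (Q → P) → (P → r ≈ s) → mask P r ≈ mask Q s
  mask-cong {P = P} {Q} P⇒Q Q⇒P e with lem {P = P} | lem {P = Q}
  ... | yes p | yes q = e p
  ... | yes p | no ¬q = contradiction (P⇒Q p) ¬q
  ... | no ¬p | yes q = contradiction (Q⇒P q) ¬p
  ... | no _  | no _  = refl

  mask-mask : ∀ {p q} {P : Set p} {Q : Set q} {r} → mask P (mask Q r) ≈ mask (P × Q) r
  mask-mask {P = P} {Q} with lem {P = P} | lem {P = Q} | lem {P = P × Q}
  ... | yes _ | yes _ | yes _ = refl
  ... | yes p | yes q | no ¬pq = contradiction (p , q) ¬pq
  ... | yes _ | no ¬q | yes (_ , q) = contradiction q ¬q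
  ... | yes _ | no _  | no _ = refl
  ... | no ¬p | _ | yes (p , _) = contradiction p ¬p
  ... | no _  | _ | no _ = refl

  module _ {a} {A : Set a} where

    ∑-mono : ∀ {f g : A → |ℝ|} xs → (∀ x → f x ≤ g x) → ∑ xs f ≤ ∑ xs g
    ∑-mono []       p = ≤-refl
    ∑-mono (x ∷ xs) p = +-mono-≤ (p x) (∑-mono xs p)

    ∑-nonNeg : ∀ {f : A → |ℝ|} xs → (∀ x → 0# ≤ f x) → 0# ≤ ∑ xs f
    ∑-nonNeg []       p = ≤-refl
    ∑-nonNeg (x ∷ xs) p = +-nonNeg (p x) (∑-nonNeg xs p)

    ∑-*ˡ : ∀ c (f : A → |ℝ|) xs → c * ∑ xs f ≈ ∑ xs (λ x → c * f x)
    ∑-*ˡ c f []  = zeroʳ c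
    ∑-*ˡ c f (x ∷ xs) = trans (distribˡ c _ _) (+-congˡ (∑-*ˡ c f xs))

    ∑-*ʳ : ∀ c (f : A → |ℝ|) xs → ∑ xs f * c ≈ ∑ xs (λ x → f x * c)
    ∑-*ʳ c f []  = zeroˡ c
    ∑-*ʳ c f (x ∷ xs) = trans (distribʳ c _ _) (+-congˡ (∑-*ʳ c f xs))

    ∑-1 : ∀ (xs : List A) → ∑ xs (λ _ → 1#) ≈ fromℕ (length xs)
    ∑-1 []  = refl
    ∑-1 (x ∷ xs) = +-congˡ (∑-1 xs)

    ∑-const : ∀ c (xs : List A) → ∑ xs (λ _ → c) ≈ fromℕ (length xs) * c
    ∑-const c []  = sym (zeroˡ c)
    ∑-const c (x ∷ xs) = trans (+-cong (sym (*-identityˡ c)) (∑-const c xs)) (sym (distribʳ c _ _))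

    ∑-bound : ∀ {f : A → |ℝ|} {c} xs → (∀ x → f x ≤ c) → ∑ xs f ≤ fromℕ (length xs) * c
    ∑-bound {c = c} xs p = ≤-respʳ (∑-const c xs) (∑-mono xs p)

    term≤∑ : ∀ {f : A → |ℝ|} {x} xs → (∀ x → 0# ≤ f x) → x ∈ xs → f x ≤ ∑ xs f
    term≤∑ (x ∷ xs) p (here ≡-refl) = x≤x+y (∑-nonNeg xs p)
    term≤∑ (x ∷ xs) p (there x∈)  = ≤-trans (term≤∑ xs p x∈) (x≤y+x (p x))

    mask-∑ : ∀ {p} {P : Set p} (f : A → |ℝ|) xs → mask P (∑ xs f) ≈ ∑ xs (λ x → mask P (f x))
    mask-∑ f []  = mask-0
    mask-∑ f (x ∷ xs) = trans mask-+ (+-congˡ (mask-∑ f xs))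

    ∑-subset : ∀ {p} {P : Pred A p} (f : A → |ℝ|) xs → ∑ (subset xs P) f ≈ ∑ xs (λ x → mask (P x) (f x))
    ∑-subset f xs = ∑-filter _ xs (λ x px → sym (mask-yes px)) (λ x ¬px → mask-no ¬px)

    ∑-mask-collect : ∀ {p} {P : Pred A p} (P? : Decidable P) {q} {Q : Pred [ x ∈ A ∣ P x ] q} (f : A → |ℝ|) xs →
                     ∑ (collect P? xs) (λ x → mask (Q x) (f (value x))) ≈
                     ∑ xs (λ x → mask (Σ[ px ∈ P x ] Q (x , [ px ])) (f x))
    ∑-mask-collect P? f xs = ∑-collect P? xs
      (λ x px → mask-cong (λ q → px , q) proj₂ (λ _ → refl))
      (λ x ¬px → mask-no (¬px ∘ proj₁))

    mask≤∑ : ∀ {p q} {P : Set p} {Q : A → Set q} {r} {s : A → |ℝ|} js → (∀ j → 0# ≤ s j) →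
             (P → ∃[ j ] j ∈ js × Q j × r ≤ s j) → mask P r ≤ ∑ js (λ j → mask (Q j) (s j))
    mask≤∑ js 0≤s cover = mask≤ (∑-nonNeg js λ j → mask-nonNeg λ _ → 0≤s j) λ p →
      let (j , j∈ , q , r≤s) = cover p
      in ≤-trans (≤-respʳ (sym (mask-yes q)) r≤s) (term≤∑ js (λ j → mask-nonNeg λ _ → 0≤s j) j∈)

    ∑-filter-mono : ∀ {p} {P : Pred A p} (P? : Decidable P) {f g : A → |ℝ|} xs →
                    (∀ x → P x → f x ≤ g x) → ∑ (filter P? xs) f ≤ ∑ (filter P? xs) g
    ∑-filter-mono P? []       e = ≤-refl
    ∑-filter-mono P? (x ∷ xs) e with P? x
    ... | yes px = +-mono-≤ (e x px) (∑-filter-mono P? xs e)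
    ... | no _  = ∑-filter-mono P? xs e

    ∑-filter-mask : ∀ {p} {P : Pred A p} (P? : Decidable P) (f : A → |ℝ|) xs →
                    ∑ (filter P? xs) f ≈ ∑ xs (λ x → mask (P x) (f x))
    ∑-filter-mask P? f xs = ∑-filter P? xs (λ x px → sym (mask-yes px)) (λ x ¬px → mask-no ¬px)

  m*[x/c]≤x : ∀ {x c m} → 0# ≤ x → 0# < c → m ≤ c → m * (x / c) ≤ x
  m*[x/c]≤x {x} {c} {m} 0≤x 0<c m≤c = ≤-respʳ (x/y*y≈x 0<c)
    (≤-respˡ (*-comm (x / c) m)
      (*-monoʳ-≤ (*-nonNeg 0≤x (proj₁ (⁻¹-pos 0<c))) m≤c))

  x≤m*[x/c] : ∀ {x c m} → 0# ≤ x → 0# < c → c ≤ m → x ≤ m * (x / c)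
  x≤m*[x/c] {x} {c} {m} 0≤x 0<c c≤m = ≤-respˡ (x/y*y≈x 0<c)
    (≤-respʳ (*-comm (x / c) m)
      (*-monoʳ-≤ (*-nonNeg 0≤x (proj₁ (⁻¹-pos 0<c))) c≤m))

  -- No-intersection hypergraphs

  module NoIntersection (Y : GradedPoset) (w : GradedPoset.Carrier Y → |ℝ|) (i j k : ℤ) where
    open GradedPoset Y using (Carrier; dim; elements; ∅; ∅-min; Inf₂) renaming (_≤_ to _⊑_)
    open WeightedHypergraph (NIH Y w i j k) hiding (IsSkeletonExpander)

    vertexWeight≤ : ∀ x → 0# ≤ w (value x) → wᵛ x ≤ w (value x)
    vertexWeight≤ x 0≤wx with i ℤ.≟ j
    ... | yes _ = ≤-refl
    ... | no _  = ½*x≤x 0≤wx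

    vertexWeight-nonNeg : ∀ x → 0# ≤ w (value x) → 0# ≤ wᵛ x
    vertexWeight-nonNeg x 0≤wx with i ℤ.≟ j
    ... | yes _ = 0≤wx
    ... | no _  = *-nonNeg (proj₁ ½-pos) 0≤wx

    module _ (G : Pred Carrier 0ℓ) (0≤w : ∀ x → G x → 0# ≤ w x) where

      -- The factor ½ for i ≠ j is dropped, and for i = j the right side counts each vertex twice; a
      -- factor of two is harmless.
      vertices≤ : ∑ (subset vertices (λ x → G (value x))) wᵛ ≤
                  ∑ elements (λ x → mask (G x × dim x ≡ i) (w x)) + ∑ elements (λ x → mask (G x × dim x ≡ j) (w x))
      vertices≤ = begin
        ∑ (subset vertices (λ x → G (value x))) wᵛ  ≈⟨ ∑-subset wᵛ vertices ⟩
        ∑ vertices (λ x → mask (G (value x)) (wᵛ x))  ≤⟨ ∑-mono vertices (λ x → mask-mono id (λ g → 0≤w (value x) g)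
                        λ g → vertexWeight≤ x (0≤w (value x) g)) ⟩
        ∑ vertices (λ x → mask (G (value x)) (w (value x)))  ≈⟨ ∑-mask-collect _ w elements ⟩
        ∑ elements (λ x → mask ((dim x ≡ i ⊎ dim x ≡ j) × G x) (w x))  ≤⟨ ∑-mono elements (λ x → mask≤
          (+-nonNeg (mask-nonNeg λ (g , _) → 0≤w x g) (mask-nonNeg λ (g , _) → 0≤w x g)) λ
          { (inj₁ e , g) → ≤-respˡ (mask-yes (g , e)) (x≤x+y (mask-nonNeg λ (g , _) → 0≤w x g))
          ; (inj₂ e , g) → ≤-respˡ (mask-yes (g , e)) (x≤y+x (mask-nonNeg λ (g , _) → 0≤w x g)) }) ⟩
        ∑ elements (λ x → mask (G x × dim x ≡ i) (w x) + mask (G x × dim x ≡ j) (w x))  ≈⟨ ∑-+ _ _ elements ⟩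
        ∑ elements (λ x → mask (G x × dim x ≡ i) (w x)) + ∑ elements (λ x → mask (G x × dim x ≡ j) (w x)) ∎

      vertices-nonNeg : 0# ≤ ∑ (subset vertices (λ x → G (value x))) wᵛ
      vertices-nonNeg = ≤-respʳ (sym (∑-subset wᵛ vertices)) (∑-nonNeg vertices λ x →
        mask-nonNeg λ g → vertexWeight-nonNeg x (0≤w (value x) g))

      edges≥ : (M : Pred Carrier 0ℓ) → (∀ x → dim x ≡ k → 0# ≤ w x) →
               (∀ x → M x → dim x ≡ k × ∃₂ λ y z → (G y × dim y ≡ i) × (G z × dim z ≡ j) × y ⊑ x × z ⊑ x × ∅ ∈ₚ Inf₂ y z × y ≢ z) →
               ∑ elements (λ x → mask (M x) (w x)) ≤ ∑ (subset edges (E₂ (λ x → G (value x)))) wᴱ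
      edges≥ M 0≤wₖ M⇒ = ≤-respʳ (sym (trans (∑-subset wᴱ edges) (∑-mask-collect (λ x → dim x ℤ.≟ k) w elements)))
        (∑-mono elements λ x → mask-mono (edge x) (λ (e , _) → 0≤wₖ x e) (λ _ → ≤-refl))
        where
        edge : ∀ x → M x → Σ[ e ∈ dim x ≡ k ] E₂ (λ x → G (value x)) (x , [ e ])
        edge x mx =
          let (dx , y , z , (gy , dy) , (gz , dz) , y⊑x , z⊑x , inf , y≢z) = M⇒ x mx
          -- ∅ lies below every maximal lower bound v and is itself a maximal lower bound, so v is
          -- ∅; this gives the condition that the infima form the set of ∅ alone.
          in dx , (y , [ inj₁ dy ]) , (z , [ inj₂ dz ]) , gy , gz , y⊑x , z⊑x , (λ e → y≢z (cong value e)) ,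
             ((x , [ dx ]) , y⊑x , z⊑x) , ((λ {v} v-inf → proj₂ inf (proj₁ v-inf) (∅-min v)) , λ { ≡-refl → inf }) , inj₁ (dy , dz)

  -- Thinness makes the quadratic term linear: a p ≤ 2P and β P ≤ B p² give β a ≤ 2B p. In the
  -- applications p is the threshold π r, and P is the threshold of the infimum, divided by B′ when
  -- the infimum is ∅.
  expander-bound : ∀ {s α β a p b₁ b₂ P B} → 0# ≤ β → 0# ≤ a → 0# < p → a ≤ b₁ + b₂ → b₁ * p ≤ P → b₂ * p ≤ P →
                   α ≤ p → β * P ≤ B * (p * p) → s ≤ α * a + β * (a * a) → 0# ≤ B → s ≤ (1# + B + B) * (p * (b₁ + b₂))
  expander-bound {s} {α} {β} {a} {p} {b₁} {b₂} {P} {B} 0≤β 0≤a 0<p a≤ b₁p≤ b₂p≤ α≤p βP≤ s≤ 0≤B = begin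
    s  ≤⟨ s≤ ⟩
    α * a + β * (a * a)  ≤⟨ +-mono-≤ (*-monoˡ-≤ 0≤a α≤p) (≤-respˡ (*-assoc _ _ _) (*-monoˡ-≤ 0≤a βa≤)) ⟩
    p * a + (B * p + B * p) * a  ≈⟨ solve 3 (λ p a b → p :* a :+ (b :* p :+ b :* p) :* a := (con 1 :+ b :+ b) :* (p :* a)) refl p a B ⟩
    (1# + B + B) * (p * a)  ≤⟨ *-monoʳ-≤ (+-nonNeg (+-nonNeg 0≤1 0≤B) 0≤B) (*-monoʳ-≤ (proj₁ 0<p) a≤) ⟩
    (1# + B + B) * (p * (b₁ + b₂))  ∎
    where
    βa≤ : β * a ≤ B * p + B * p
    βa≤ = *-cancelʳ-≤ 0<p (begin
      β * a * p  ≈⟨ *-assoc _ _ _ ⟩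
      β * (a * p)  ≤⟨ *-monoʳ-≤ 0≤β (*-monoˡ-≤ (proj₁ 0<p) a≤) ⟩
      β * ((b₁ + b₂) * p)  ≈⟨ *-congˡ (distribʳ p b₁ b₂) ⟩
      β * (b₁ * p + b₂ * p)  ≤⟨ *-monoʳ-≤ 0≤β (+-mono-≤ b₁p≤ b₂p≤) ⟩
      β * (P + P)  ≈⟨ distribˡ β P P ⟩
      β * P + β * P  ≤⟨ +-mono-≤ βP≤ βP≤ ⟩
      B * (p * p) + B * (p * p)  ≈⟨ solve 2 (λ b p → b :* (p :* p) :+ b :* (p :* p) := (b :* p :+ b :* p) :* p) refl B p ⟩
      (B * p + B * p) * p  ∎)

  module _ {a} {A : Set a} (φ : A → |ℝ|) where

    -- The finite set of values that ‖df‖ can take; it makes the Correction Algorithm terminate.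
    subsetSums : List A → List |ℝ|
    subsetSums []  = 0# ∷ []
    subsetSums (x ∷ xs) = subsetSums xs ++ map (λ s → φ x + s) (subsetSums xs)

    ∑∈subsetSums : ∀ {p} {P : Pred A p} (P? : Decidable P) xs → ∑ (filter P? xs) φ ∈ subsetSums xs
    ∑∈subsetSums P? []  = here ≡-refl
    ∑∈subsetSums P? (x ∷ xs) with P? x
    ... | yes _ = ∈-++⁺ʳ (subsetSums xs) (∈-map⁺ (λ s → φ x + s) (∑∈subsetSums P? xs))
    ... | no _  = ∈-++⁺ˡ (∑∈subsetSums P? xs)

  rank : List |ℝ| → |ℝ| → ℕ
  rank vs v = length (filter (λ s → lem {P = s < v}) vs)

  rank-< : ∀ {vs v v′} → v′ ∈ vs → v′ < v → rank vs v′ ℕ.< rank vs v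
  rank-< {v = v} {v′} v′∈ v′<v = length-filter-< (λ s → lem {P = s < v′}) (λ s → lem {P = s < v})
    (λ s<v′ → <-trans s<v′ v′<v) v′∈ (λ v′<v′ → <⇒≱ v′<v′ ≤-refl) v′<v

  private
    k+2 : ∀ k → 2 ℕ.^ (k ℕ.+ 2) ≡ 2 ℕ.^ (k ℕ.+ 1) ℕ.+ 2 ℕ.^ (k ℕ.+ 1)
    k+2 k = ≡-trans (cong (2 ℕ.^_) (ℕ.+-suc k 1)) (cong (2 ℕ.^ (k ℕ.+ 1) ℕ.+_) (ℕ.+-identityʳ _))

  ^-pred : ∀ κ n → κ * κ ^ (2 ℕ.^ n ℕ.∸ 1) ≈ κ ^ (2 ℕ.^ n)
  ^-pred κ n = reflexive (cong (κ ^_) (ℕ.m+[n∸m]≡n (ℕ.m^n>0 2 n)))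

  ^-double : ∀ κ k → κ ^ (2 ℕ.^ (k ℕ.+ 2)) ≈ κ ^ (2 ℕ.^ (k ℕ.+ 1)) * κ ^ (2 ℕ.^ (k ℕ.+ 1))
  ^-double κ k = trans (reflexive (cong (κ ^_) (k+2 k))) (^-homo-* κ (2 ℕ.^ (k ℕ.+ 1)) _)

  ^-double-pred : ∀ κ k → κ ^ (2 ℕ.^ (k ℕ.+ 2) ℕ.∸ 1) ≈ κ ^ (2 ℕ.^ (k ℕ.+ 1)) * κ ^ (2 ℕ.^ (k ℕ.+ 1) ℕ.∸ 1)
  ^-double-pred κ k = trans
    (reflexive (cong (κ ^_) (≡-trans (cong (ℕ._∸ 1) (k+2 k)) (ℕ.+-∸-assoc (2 ℕ.^ (k ℕ.+ 1)) (ℕ.m^n>0 2 (k ℕ.+ 1))))))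
    (^-homo-* κ (2 ℕ.^ (k ℕ.+ 1)) _)

-- Coboundary expansion as an inequality

module CoboundaryExpansion (lem : ∀ {ℓ} → ExcludedMiddle ℓ) (ℝ : CompleteOrderedField)
  {r ℓr m ℓm} {R : CommutativeRing r ℓr} (X : GradedPoset)
  (w : GradedPoset.Carrier X → CompleteOrderedField.Carrier ℝ)
  (o : GradedPoset.Carrier X → GradedPoset.Carrier X → CommutativeRing.Carrier R) (ℱ : Sheaf R X m ℓm) where
  open Reals lem ℝ
  open Cochains X o ℱ
  open Classical.Expansion lem ℝ X w o ℱ

  dist-≤ : ∀ {i p} {f : C i} {T : Pred (C i) p} {c} → Satisfiable T → (∀ g → T g → c ≤ ‖ f -ᶜ g ‖) → c ≤ dist f T
  dist-≤ {f = f} (g , tg) bound = ≤inf (‖ f -ᶜ g ‖ , g , tg , refl) λ { (g , tg , e) → ≤-respʳ (sym e) (bound g tg) }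

  -- The supremum in `_≤cbe_` still bounds each single f: if the distance D is positive, ‖df‖ / D is
  -- an upper bound for the admissible μ, hence for η; otherwise the left side is not positive.
  cbe-bound : ∀ {i η} (f : C i) → 0# ≤ η → 0# ≤ ‖ d f ‖ → (∀ g → 0# ≤ ‖ f -ᶜ g ‖) → η ≤cbe i →
              η * dist f (B i) ≤ ‖ d f ‖
  cbe-bound {i} {η} f 0≤η 0≤df 0≤‖‖ cbe with lem {P = dist f (B i) ≤ 0#}
  ... | yes D≤0 = ≤-trans (≤-respʳ (zeroʳ η) (*-monoʳ-≤ 0≤η D≤0)) 0≤df
  ... | no D≰0  = ≤-respʳ (x/y*y≈x 0<D) (*-monoˡ-≤ (proj₁ 0<D) (cbe _ λ (_ , bound) → x≤y/z 0<D (bound f)))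
    where
    0<D : 0# < dist f (B i)
    0<D = ≰⇒> D≰0

  B-0 : ∀ {i} → B i 0ᶜ
  B-0 {i} = 0ᶜ , λ x → 𝓕.≈ᴹ-sym (value x) (d-0 (≈ᶜ-refl {f = 0ᶜ}) (cast (≡-sym (ℤ.suc-pred i)) x))
    where open GradedPoset X using (cast)

-- Constants

module Constants (lem : ∀ {ℓ} → ExcludedMiddle ℓ) (ℝ : CompleteOrderedField)
  (L : CompleteOrderedField.Carrier ℝ) (1≤L : CompleteOrderedField._≤_ ℝ (CompleteOrderedField.1# ℝ) L)
  (F : ℕ) (1≤F : 1 ℕ.≤ F) (k : ℕ) where
  open Reals lem ℝ

  -- The cost of exchanging w(x) for w(u) wᵤ(x): three comparisons of a maximal with a minimal
  -- count, and one count bounded by F.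
  C : |ℝ|
  C = L * L * L * fromℕ F

  0≤L : 0# ≤ L
  0≤L = ≤-trans 0≤1 1≤L

  1≤C : 1# ≤ C
  1≤C = 1≤x*y (1≤x*y (1≤x*y 1≤L 1≤L) 1≤L) (1≤fromℕ 1≤F)

  0≤C : 0# ≤ C
  0≤C = ≤-trans 0≤1 1≤C

  -- The number of dimensions -1, …, k+2.
  D : |ℝ|
  D = fromℕ (4 ℕ.+ k)

  1≤D : 1# ≤ D
  1≤D = 1≤fromℕ {4 ℕ.+ k} (s≤s z≤n)

  0≤D : 0# ≤ D
  0≤D = ≤-trans 0≤1 1≤D

  -- Bounds the number of faces below a face of dimension at most k+2: at most F in each of D
  -- dimensions.
  Φ : |ℝ|
  Φ = D * fromℕ F

  0≤Φ : 0# ≤ Φ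
  0≤Φ = *-nonNeg 0≤D (fromℕ-nonNeg F)

  -- The growth of the potential `V` when one more dimension of fat faces is added; `Γ` bounds the
  -- growth over all stages.
  γ : |ℝ|
  γ = 1# + C * Φ

  1≤γ : 1# ≤ γ
  1≤γ = x≤x+y (*-nonNeg 0≤C 0≤Φ)

  Γ : |ℝ|
  Γ = γ ^ (k ℕ.+ 1)

  1≤Γ : 1# ≤ Γ
  1≤Γ = 1≤^ (k ℕ.+ 1) 1≤γ

  -- From the outside: C C Φ for the local estimates summed over terminal faces, one D for each of
  -- t, ℓ, r, C for passing to the (n+1)-faces above x, E for skeleton expansion, and C Φ Γ for the
  -- potential, once for ℓ and once for r. The last Γ pays for the defect q of local minimality.
  totalLoss : |ℝ| → |ℝ|
  totalLoss E = C * (C * (Φ * (D * (D * (D * (C * (E * (C * Φ * Γ + C * Φ * Γ)))))))) + Γ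

  1≤totalLoss : ∀ {E} → 0# ≤ E → 1# ≤ totalLoss E
  1≤totalLoss 0≤E = ≤-trans 1≤Γ (x≤y+x (*-nonNeg 0≤C (*-nonNeg 0≤C (*-nonNeg 0≤Φ (*-nonNeg 0≤D (*-nonNeg 0≤D (*-nonNeg 0≤D
    (*-nonNeg 0≤C (*-nonNeg 0≤E (+-nonNeg CΦΓ CΦΓ))))))))))
    where
    CΦΓ : 0# ≤ C * Φ * Γ
    CΦΓ = *-nonNeg (*-nonNeg 0≤C 0≤Φ) (≤-trans 0≤1 1≤Γ)

module Parameters (lem : ∀ {ℓ} → ExcludedMiddle ℓ) (ℝ : CompleteOrderedField)
  (B : CompleteOrderedField.Carrier ℝ) (0<B : CompleteOrderedField._<_ ℝ (CompleteOrderedField.0# ℝ) B)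
  (F : ℕ) (1≤F : 1 ℕ.≤ F)
  (L : CompleteOrderedField.Carrier ℝ) (1≤L : CompleteOrderedField._≤_ ℝ (CompleteOrderedField.1# ℝ) L) (k : ℕ) where
  open Reals lem ℝ
  open Constants lem ℝ L 1≤L F 1≤F k

  loss : |ℝ|
  loss = totalLoss (C * (1# + B + B))

  1≤loss : 1# ≤ loss
  1≤loss = 1≤totalLoss (*-nonNeg 0≤C (+-nonNeg (+-nonNeg 0≤1 (proj₁ 0<B)) (proj₁ 0<B)))

  0<loss : 0# < loss
  0<loss = <-≤-trans 0<1 1≤loss

  -- Makes the relative loss at most ½, so that the final estimate bounds the weight of the support
  -- by half of itself.
  K : |ℝ|
  K = ½ / loss

  0<K : 0# < K
  0<K = *-pos ½-pos (⁻¹-pos 0<loss)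

  loss*K≤½ : loss * K ≤ ½
  loss*K≤½ = ≤-reflexive (trans (*-comm _ _) (x/y*y≈x 0<loss))

  K≤1 : K ≤ 1#
  K≤1 = ≤-trans (x≤y*x (proj₁ 0<K) 1≤loss) (≤-trans loss*K≤½ ½≤1)

  1≤CCΓ : 1# ≤ C * C * Γ
  1≤CCΓ = 1≤x*y (1≤x*y 1≤C 1≤C) 1≤Γ

  0<CCΓ : 0# < C * C * Γ
  0<CCΓ = <-≤-trans 0<1 1≤CCΓ

  -- C C Γ is the cost of decoding: one C for the movement in correction steps, one for bounding
  -- ‖df‖ by the distance to the code, Γ for the potential. K matches the factor K in q, and ½ makes
  -- room for two error terms.
  K′ : |ℝ|
  K′ = (½ * K) / (C * C * Γ)

  0<K′ : 0# < K′
  0<K′ = *-pos (*-pos ½-pos 0<K) (⁻¹-pos 0<CCΓ)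

  K′CCΓ≈½K : K′ * (C * C * Γ) ≈ ½ * K
  K′CCΓ≈½K = x/y*y≈x 0<CCΓ

  K′≤1 : K′ ≤ 1#
  K′≤1 = ≤-trans (x≤x*y (proj₁ 0<K′) 1≤CCΓ) (≤-trans (≤-reflexive K′CCΓ≈½K) (≤-trans (½*x≤x (proj₁ 0<K)) K≤1))

record WeightedPoset (lem : ∀ {ℓ} → ExcludedMiddle ℓ) (ℝ : CompleteOrderedField) : Set₁ where
  open CompleteOrderedField ℝ using (1#; fromℕ; _/_) renaming (Carrier to |ℝ|; _≤_ to _≤ᵣ_)
  field
    X : GradedPoset
  open GradedPoset X using (Carrier; IsDPoset; Fᵐᵃˣ; Fᵐⁱⁿ)
  field
    d : ℕ
    isDPoset : IsDPoset d
    w : Carrier → |ℝ|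
    proper : Classical.IsProperWeight lem ℝ d X w
    L : |ℝ|
    1≤L : 1# ≤ᵣ L
    -- The bound on L(X) is used only through these ratios.
    ratio≤L : ∀ {b i} → -1ℤ ℤ.≤ b → b ℤ.≤ i → i ℤ.≤ + d →
              fromℕ (Fᵐᵃˣ b i (+ d)) / fromℕ (Fᵐⁱⁿ b i (+ d)) ≤ᵣ L
    k : ℕ
    k+2≤d : k ℕ.+ 2 ℕ.≤ d
    F : ℕ
    1≤F : 1 ℕ.≤ F
    Fᵐᵃˣ≤F : ∀ i j → -1ℤ ℤ.≤ i → i ℤ.≤ j → j ℤ.≤ + k ℤ.+ + 2 → Fᵐᵃˣ -1ℤ i j ℕ.≤ F

-- Weights

module Weighted (lem : ∀ {ℓ} → ExcludedMiddle ℓ) (ℝ : CompleteOrderedField)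
  (S : WeightedPoset lem ℝ) where
  open Reals lem ℝ
  open Classical lem ℝ
    using (IsSkeletonExpander; linkNIH; NIH; linkWeight; subset; module Expansion; module CocycleCode)
  open WeightedPoset S
  open Constants lem ℝ L 1≤L F 1≤F k
  module P = PosetProperties lem X
  open GradedPoset X renaming (_≤_ to _⊑_; ≤-refl to ⊑-refl; ≤-trans to ⊑-trans; _<_ to _⊏_; antisym to ⊑-antisym)

  ≤k+2⇒≤d : ∀ {i} → i ℤ.≤ + k ℤ.+ + 2 → i ℤ.≤ + d
  ≤k+2⇒≤d p = ℤ.≤-trans p (ℤ.+≤+ k+2≤d)

  w-pos : ∀ x → 0# < w x
  w-pos = proj₁ proper

  0≤w : ∀ x → 0# ≤ w x
  0≤w x = proj₁ (w-pos x)

  count : Carrier → ℤ → Carrier → |ℝ|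
  count u i y = fromℕ (length (facesBetween u i y))

  count-∑ : ∀ u i y → count u i y ≈ ∑ elements (λ x → mask (dim x ≡ i × u ⊑ x × x ⊑ y) 1#)
  count-∑ u i y = begin-equality
    fromℕ (length (facesBetween u i y))  ≈⟨ ∑-1 (facesBetween u i y) ⟨
    ∑ (facesBetween u i y) (λ _ → 1#)  ≈⟨ ∑-filter-mask _ (λ _ → 1#) (faces i) ⟩
    ∑ (faces i) (λ x → mask (u ⊑ value x × value x ⊑ y) 1#)  ≈⟨ ∑-mask-collect _ (λ _ → 1#) elements ⟩
    ∑ elements (λ x → mask (dim x ≡ i × u ⊑ x × x ⊑ y) 1#)  ∎

  count-facesBelow : ∀ i y → fromℕ (length (facesBelow y i)) ≈ count ∅ i y
  count-facesBelow i y = begin-equality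
    fromℕ (length (facesBelow y i))  ≈⟨ ∑-1 (facesBelow y i) ⟨
    ∑ (facesBelow y i) (λ _ → 1#)  ≈⟨ ∑-collect _ elements
      (λ x (e , x⊑y) → sym (mask-yes (e , ∅-min x , x⊑y))) (λ x ne → mask-no λ (e , _ , x⊑y) → ne (e , x⊑y)) ⟩
    ∑ elements (λ x → mask (dim x ≡ i × ∅ ⊑ x × x ⊑ y) 1#)  ≈⟨ count-∑ ∅ i y ⟨
    count ∅ i y  ∎

  Fmax Fmin : ℤ → ℤ → |ℝ|
  Fmax b i = fromℕ (Fᵐᵃˣ b i (+ d))
  Fmin b i = fromℕ (Fᵐⁱⁿ b i (+ d))

  0≤Fmax : ∀ b i → 0# ≤ Fmax b i
  0≤Fmax b i = fromℕ-nonNeg (Fᵐᵃˣ b i (+ d))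

  0≤Fmin : ∀ b i → 0# ≤ Fmin b i
  0≤Fmin b i = fromℕ-nonNeg (Fᵐⁱⁿ b i (+ d))

  0≤count : ∀ u i y → 0# ≤ count u i y
  0≤count u i y = fromℕ-nonNeg (length (facesBetween u i y))

  module _ (u : Carrier) (i : ℤ) (y : Face (+ d)) (u⊑y : u ⊑ value y) where

    count≤Fmax : count u i (value y) ≤ Fmax (dim u) i
    count≤Fmax = fromℕ-mono (P.facesBetween≤Fᵐᵃˣ (u , [ ≡-refl ]) y u⊑y)

    Fmin≤count : Fmin (dim u) i ≤ count u i (value y)
    Fmin≤count = fromℕ-mono (P.Fᵐⁱⁿ≤facesBetween (u , [ ≡-refl ]) y u⊑y)

  count-∅≤F : ∀ {i} x → -1ℤ ℤ.≤ i → i ℤ.≤ dim x → dim x ℤ.≤ + k ℤ.+ + 2 → count ∅ i x ≤ fromℕ F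
  count-∅≤F {i} x -1≤i i≤dx dx≤k+2 = fromℕ-mono (ℕ.≤-trans
    (P.facesBetween≤Fᵐᵃˣ (∅ , [ ∅-dim ]) (x , [ ≡-refl ]) (∅-min x)) (Fᵐᵃˣ≤F i (dim x) -1≤i i≤dx dx≤k+2))

  module _ {b i : ℤ} (-1≤b : -1ℤ ℤ.≤ b) (b≤i : b ℤ.≤ i) (i≤d : i ℤ.≤ + d) where

    1≤Fmin : 1# ≤ Fmin b i
    1≤Fmin = 1≤fromℕ (P.≤Fᵐⁱⁿ (nonempty (elements-complete ∅)) between)
      where
      nonempty : ∀ {a} {A : Set a} {x : A} {xs : List A} → x ∈ xs → 1 ℕ.≤ length xs
      nonempty (here _)  = s≤s z≤n
      nonempty (there _) = s≤s z≤n
      between : (x : Face b) (z : Face (+ d)) → value x ⊑ value z → 1 ℕ.≤ length (facesBetween (value x) i (value z))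
      between x z x⊑z =
        let (v , x⊑v , v⊑z , e) = P.interpolate x⊑z (subst (ℤ._≤ i) (≡-sym (P.face-dim x)) b≤i)
                        (subst (i ℤ.≤_) (≡-sym (P.face-dim z)) i≤d)
        in nonempty (∈-filter⁺ (λ y → value x ≤? value y ×-dec value y ≤? value z)
                      (P.face∈ (v , [ e ])) (x⊑v , v⊑z))

    Fmin-pos : 0# < Fmin b i
    Fmin-pos = <-≤-trans 0<1 1≤Fmin

    Fmax≤L*Fmin : Fmax b i ≤ L * Fmin b i
    Fmax≤L*Fmin = ≤-respˡ (x/y*y≈x Fmin-pos) (*-monoˡ-≤ (proj₁ Fmin-pos) (ratio≤L -1≤b b≤i i≤d))

  K+2 : ℤ
  K+2 = + k ℤ.+ + 2

  module _ {b i : ℤ} (-1≤b : -1ℤ ℤ.≤ b) (b≤i : b ℤ.≤ i) (y : Carrier) (i≤dy : i ℤ.≤ dim y) where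

    -- Both sides count the chains u ⊑ x ⊑ y with dim u = b and dim x = i.
    double-count : ∑ elements (λ u → mask (dim u ≡ b × ∅ ⊑ u × u ⊑ y) (count u i y)) ≈
                   ∑ elements (λ x → mask (dim x ≡ i × ∅ ⊑ x × x ⊑ y) (count ∅ b x))
    double-count = begin-equality
      ∑ elements (λ u → mask (dim u ≡ b × ∅ ⊑ u × u ⊑ y) (count u i y))
        ≈⟨ ∑-cong elements (λ u → trans (mask-cong id id λ _ → count-∑ u i y) (mask-∑ _ elements)) ⟩
      ∑ elements (λ u → ∑ elements (λ x → mask (dim u ≡ b × ∅ ⊑ u × u ⊑ y) (mask (dim x ≡ i × u ⊑ x × x ⊑ y) 1#)))
        ≈⟨ ∑-swap _ elements elements ⟩
      ∑ elements (λ x → ∑ elements (λ u → mask (dim u ≡ b × ∅ ⊑ u × u ⊑ y) (mask (dim x ≡ i × u ⊑ x × x ⊑ y) 1#)))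
        ≈⟨ ∑-cong elements (λ x → ∑-cong elements λ u → trans mask-mask (trans (mask-cong
             (λ ((du , _ , _) , dx , u⊑x , x⊑y) → (dx , ∅-min x , x⊑y) , du , ∅-min u , u⊑x)
             (λ ((dx , _ , x⊑y) , du , _ , u⊑x) → (du , ∅-min u , ⊑-trans u⊑x x⊑y) , dx , u⊑x , x⊑y)
             (λ _ → refl)) (sym mask-mask))) ⟩
      ∑ elements (λ x → ∑ elements (λ u → mask (dim x ≡ i × ∅ ⊑ x × x ⊑ y) (mask (dim u ≡ b × ∅ ⊑ u × u ⊑ x) 1#)))
        ≈⟨ ∑-cong elements (λ x → trans (mask-cong id id λ _ → count-∑ ∅ b x) (mask-∑ _ elements)) ⟨
      ∑ elements (λ x → mask (dim x ≡ i × ∅ ⊑ x × x ⊑ y) (count ∅ b x))  ∎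

    count-∅-scale : ∀ j c → c * count ∅ j y ≈ ∑ elements (λ u → mask (dim u ≡ j × ∅ ⊑ u × u ⊑ y) c)
    count-∅-scale j c = trans (*-congˡ (count-∑ ∅ j y)) (trans (∑-*ˡ c _ elements)
      (∑-cong elements λ u → trans (mask-* c) (mask-cong id id λ _ → *-identityʳ c)))

    1≤count-∅ : ∀ x → dim x ≡ i → 1# ≤ count ∅ b x
    1≤count-∅ x dx =
      let (u , _ , u⊑x , du) = P.interpolate (∅-min x) (subst (ℤ._≤ b) (≡-sym ∅-dim) -1≤b)
                                 (subst (b ℤ.≤_) (≡-sym dx) b≤i)
      in ≤-respʳ (sym (count-∑ ∅ b x)) (≤-respˡ (mask-yes (du , ∅-min u , u⊑x))
           (term≤∑ elements (λ u → mask-nonNeg λ _ → 0≤1) (elements-complete u)))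

    -- Every i-face below y lies above some b-face, so the i-faces are at most as many as the chains
    -- u ⊑ x ⊑ y, of which each u has at most c.
    count-mono-dim : ∀ {c} → 0# ≤ c → (∀ u → dim u ≡ b → u ⊑ y → count u i y ≤ c) → count ∅ i y ≤ c * count ∅ b y
    count-mono-dim {c} 0≤c bound = begin
      count ∅ i y  ≈⟨ count-∑ ∅ i y ⟩
      ∑ elements (λ x → mask (dim x ≡ i × ∅ ⊑ x × x ⊑ y) 1#)  ≤⟨ ∑-mono elements (λ x →
        mask-mono id (λ _ → 0≤count ∅ b x) λ (dx , _) → 1≤count-∅ x dx) ⟩
      ∑ elements (λ x → mask (dim x ≡ i × ∅ ⊑ x × x ⊑ y) (count ∅ b x))  ≈⟨ double-count ⟨
      ∑ elements (λ u → mask (dim u ≡ b × ∅ ⊑ u × u ⊑ y) (count u i y))  ≤⟨ ∑-mono elements (λ u →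
        mask-mono id (λ _ → 0≤c) λ (du , _ , u⊑y) → bound u du u⊑y) ⟩
      ∑ elements (λ u → mask (dim u ≡ b × ∅ ⊑ u × u ⊑ y) c)  ≈⟨ count-∅-scale b c ⟨
      c * count ∅ b y  ∎

    -- The chains u ⊑ x ⊑ y number at least c for each u, while each i-face x has at most F faces of
    -- dimension b below it.
    count-anti-dim : ∀ {c} → i ℤ.≤ K+2 → (∀ u → dim u ≡ b → u ⊑ y → c ≤ count u i y) →
                     c * count ∅ b y ≤ fromℕ F * count ∅ i y
    count-anti-dim {c} i≤k+2 bound = begin
      c * count ∅ b y  ≈⟨ count-∅-scale b c ⟩
      ∑ elements (λ u → mask (dim u ≡ b × ∅ ⊑ u × u ⊑ y) c)  ≤⟨ ∑-mono elements (λ u →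
        mask-mono id (λ _ → 0≤count u i y) λ (du , _ , u⊑y) → bound u du u⊑y) ⟩
      ∑ elements (λ u → mask (dim u ≡ b × ∅ ⊑ u × u ⊑ y) (count u i y))  ≈⟨ double-count ⟩
      ∑ elements (λ x → mask (dim x ≡ i × ∅ ⊑ x × x ⊑ y) (count ∅ b x))  ≤⟨ ∑-mono elements (λ x →
        mask-mono id (λ _ → fromℕ-nonNeg F) λ { (≡-refl , _ , _) → count-∅≤F x -1≤b b≤i i≤k+2 }) ⟩
      ∑ elements (λ x → mask (dim x ≡ i × ∅ ⊑ x × x ⊑ y) (fromℕ F))  ≈⟨ count-∅-scale i (fromℕ F) ⟨
      fromℕ F * count ∅ i y  ∎

  topFace : ∀ x → ∃[ y ] x ⊑ value {P = λ y → dim y ≡ + d} y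
  topFace x = let (y , dy , x⊑y) = isDPoset x in (y , [ dy ]) , x⊑y

  module _ {b i : ℤ} (-1≤b : -1ℤ ℤ.≤ b) (b≤i : b ℤ.≤ i) (i≤k+2 : i ℤ.≤ K+2) where
    private
      i≤d : i ℤ.≤ + d
      i≤d = ≤k+2⇒≤d i≤k+2

      b≤d : b ℤ.≤ + d
      b≤d = ℤ.≤-trans b≤i i≤d

      -1≤i : -1ℤ ℤ.≤ i
      -1≤i = ℤ.≤-trans -1≤b b≤i

      -- Any top face will do: the counts below it lie between the extremal ones.
      y : Carrier
      y = value (proj₁ (topFace ∅))

      dy : dim y ≡ + d
      dy = P.face-dim (proj₁ (topFace ∅))

      i≤dy : i ℤ.≤ dim y
      i≤dy = subst (i ℤ.≤_) (≡-sym dy) i≤d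

      count-∅≤ : ∀ j → count ∅ j y ≤ Fmax -1ℤ j
      count-∅≤ j = subst (λ z → count ∅ j y ≤ Fmax z j) ∅-dim (count≤Fmax ∅ j (y , [ dy ]) (∅-min y))

      ≤count-∅ : ∀ j → Fmin -1ℤ j ≤ count ∅ j y
      ≤count-∅ j = subst (λ z → Fmin z j ≤ count ∅ j y) ∅-dim (Fmin≤count ∅ j (y , [ dy ]) (∅-min y))

    -- Chains ∅ ⊑ u ⊑ x below one top face are counted in two ways. Three comparisons of extremal
    -- counts cost L each, and the number of b-faces below an i-face costs F.
    Fmax*Fmax≤ : Fmax -1ℤ b * Fmax b i ≤ C * Fmin -1ℤ i
    Fmax*Fmax≤ = begin
      Fmax -1ℤ b * Fmax b i  ≤⟨ *-mono-≤ (*-nonNeg 0≤L (0≤Fmin _ _)) (0≤Fmax _ _)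
                        (Fmax≤L*Fmin ℤ.≤-refl -1≤b b≤d) (Fmax≤L*Fmin -1≤b b≤i i≤d) ⟩
      L * Fmin -1ℤ b * (L * Fmin b i)  ≤⟨ *-monoˡ-≤ (*-nonNeg 0≤L (0≤Fmin _ _)) (*-monoʳ-≤ 0≤L (≤count-∅ b)) ⟩
      L * count ∅ b y * (L * Fmin b i)  ≈⟨ solve 3 (λ l c m → l :* c :* (l :* m) := l :* l :* (m :* c)) refl L (count ∅ b y) (Fmin b i) ⟩
      L * L * (Fmin b i * count ∅ b y)  ≤⟨ *-monoʳ-≤ (*-nonNeg 0≤L 0≤L) (count-anti-dim -1≤b b≤i y i≤dy i≤k+2
                        λ { u ≡-refl u⊑y → Fmin≤count u i (y , [ dy ]) u⊑y }) ⟩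
      L * L * (fromℕ F * count ∅ i y)  ≤⟨ *-monoʳ-≤ (*-nonNeg 0≤L 0≤L) (*-monoʳ-≤ (fromℕ-nonNeg F)
                        (≤-trans (count-∅≤ i) (Fmax≤L*Fmin ℤ.≤-refl -1≤i i≤d))) ⟩
      L * L * (fromℕ F * (L * Fmin -1ℤ i))  ≈⟨ solve 3 (λ l f m → l :* l :* (f :* (l :* m)) := l :* l :* l :* f :* m) refl L (fromℕ F) (Fmin -1ℤ i) ⟩
      C * Fmin -1ℤ i  ∎

    Fmax≤Fmin*Fmin : Fmax -1ℤ i ≤ C * (Fmin -1ℤ b * Fmin b i)
    Fmax≤Fmin*Fmin = begin
      Fmax -1ℤ i  ≤⟨ Fmax≤L*Fmin ℤ.≤-refl -1≤i i≤d ⟩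
      L * Fmin -1ℤ i  ≤⟨ *-monoʳ-≤ 0≤L (≤count-∅ i) ⟩
      L * count ∅ i y  ≤⟨ *-monoʳ-≤ 0≤L (count-mono-dim -1≤b b≤i y i≤dy (0≤Fmax b i)
                        λ { u ≡-refl u⊑y → count≤Fmax u i (y , [ dy ]) u⊑y }) ⟩
      L * (Fmax b i * count ∅ b y)  ≤⟨ *-monoʳ-≤ 0≤L (*-monoʳ-≤ (0≤Fmax b i)
                        (≤-trans (count-∅≤ b) (Fmax≤L*Fmin ℤ.≤-refl -1≤b b≤d))) ⟩
      L * (Fmax b i * (L * Fmin -1ℤ b))  ≤⟨ *-monoʳ-≤ 0≤L (*-monoˡ-≤ (*-nonNeg 0≤L (0≤Fmin _ _)) (Fmax≤L*Fmin -1≤b b≤i i≤d)) ⟩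
      L * (L * Fmin b i * (L * Fmin -1ℤ b))  ≈⟨ solve 3 (λ l m n → l :* (l :* m :* (l :* n)) := l :* l :* l :* (n :* m)) refl L (Fmin b i) (Fmin -1ℤ b) ⟩
      L * L * L * (Fmin -1ℤ b * Fmin b i)  ≤⟨ *-monoˡ-≤ (*-nonNeg (0≤Fmin _ _) (0≤Fmin _ _))
                        (x≤x*y (*-nonNeg (*-nonNeg 0≤L 0≤L) 0≤L) (1≤fromℕ 1≤F)) ⟩
      C * (Fmin -1ℤ b * Fmin b i)  ∎

  topSum : Carrier → (Face (+ d) → |ℝ|) → |ℝ|
  topSum x = ∑ (facesAbove (+ d) x)

  topWeight : Carrier → |ℝ|
  topWeight x = topSum x (λ y → w (value y))

  topWeight-pos : ∀ x → 0# < topWeight x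
  topWeight-pos x =
    let (y , x⊑y) = topFace x
    in <-≤-trans (w-pos (value y)) (term≤∑ (facesAbove (+ d) x) (λ y → 0≤w (value y))
         (∈-filter⁺ (λ y → x ≤? value y) (P.face∈ y) x⊑y))

  -- The weight wᵤ of the link at u, as a function on all of X.
  wˡ : Carrier → Carrier → |ℝ|
  wˡ u x = topSum x (λ y → w (value y) / count u (dim x) (value y)) / topWeight u

  module _ (u x : Carrier) (u⊑x : u ⊑ x) (dx≤k+2 : dim x ℤ.≤ K+2) where
    private
      b i : ℤ
      b = dim u
      i = dim x
      i≤d : i ℤ.≤ + d
      i≤d = ≤k+2⇒≤d dx≤k+2

      num : |ℝ|
      num = topSum x (λ y → w (value y) / count u i (value y))

      count-pos : ∀ y → x ⊑ value y → 0# < count u i (value y)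
      count-pos y x⊑y = <-≤-trans (Fmin-pos (P.-1≤dim u) (dim-mono u⊑x) i≤d) (Fmin≤count u i y (⊑-trans u⊑x x⊑y))

    Fmin*num≤ : Fmin b i * num ≤ topWeight x
    Fmin*num≤ = ≤-respˡ (sym (∑-*ˡ _ _ (facesAbove (+ d) x))) (∑-filter-mono (λ y → x ≤? value y) (faces (+ d)) λ y x⊑y →
      m*[x/c]≤x (0≤w (value y)) (count-pos y x⊑y) (Fmin≤count u i y (⊑-trans u⊑x x⊑y)))

    ≤Fmax*num : topWeight x ≤ Fmax b i * num
    ≤Fmax*num = ≤-respʳ (sym (∑-*ˡ _ _ (facesAbove (+ d) x))) (∑-filter-mono (λ y → x ≤? value y) (faces (+ d)) λ y x⊑y →
      x≤m*[x/c] (0≤w (value y)) (count-pos y x⊑y) (count≤Fmax u i y (⊑-trans u⊑x x⊑y)))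

    0≤num : 0# ≤ num
    0≤num = ≤-respʳ (sym (∑-filter-mask _ _ (faces (+ d)))) (∑-nonNeg (faces (+ d)) λ y →
      mask-nonNeg λ x⊑y → *-nonNeg (0≤w (value y)) (proj₁ (⁻¹-pos (count-pos y x⊑y))))

    wˡ*topWeight : wˡ u x * topWeight u ≈ num
    wˡ*topWeight = x/y*y≈x (topWeight-pos u)

    0≤wˡ : 0# ≤ wˡ u x
    0≤wˡ = *-nonNeg 0≤num (proj₁ (⁻¹-pos (topWeight-pos u)))

  w≈num : ∀ x → w x ≈ topSum x (λ y → w (value y) / count ∅ (dim x) (value y))
  w≈num x = trans (proj₂ (proj₂ proper) x) (∑-cong (facesAbove (+ d) x) λ y →
    *-congˡ (⁻¹-cong (count-facesBelow (dim x) (value y))))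

  Fmin*w≤ : ∀ x → dim x ℤ.≤ K+2 → Fmin -1ℤ (dim x) * w x ≤ topWeight x
  Fmin*w≤ x p = subst (λ z → Fmin z (dim x) * w x ≤ topWeight x) ∅-dim
    (≤-respˡ (*-congˡ (sym (w≈num x))) (Fmin*num≤ ∅ x (∅-min x) p))

  ≤Fmax*w : ∀ x → dim x ℤ.≤ K+2 → topWeight x ≤ Fmax -1ℤ (dim x) * w x
  ≤Fmax*w x p = subst (λ z → topWeight x ≤ Fmax z (dim x) * w x) ∅-dim
    (≤-respʳ (*-congˡ (sym (w≈num x))) (≤Fmax*num ∅ x (∅-min x) p))

  module _ (u x : Carrier) (u⊑x : u ⊑ x) (dx≤k+2 : dim x ℤ.≤ K+2) where
    private
      b i : ℤ
      b = dim u
      i = dim x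
      i≤d : i ℤ.≤ + d
      i≤d = ≤k+2⇒≤d dx≤k+2
      b≤k+2 : b ℤ.≤ K+2
      b≤k+2 = ℤ.≤-trans (dim-mono u⊑x) dx≤k+2
      N : |ℝ|
      N = topSum x (λ y → w (value y) / count u i (value y))
      -1≤b : -1ℤ ℤ.≤ b
      -1≤b = P.-1≤dim u
      0≤N : 0# ≤ N
      0≤N = 0≤num u x u⊑x dx≤k+2

    -- All weights are sums over top faces, hence comparable with `topWeight` up to extremal counts;
    -- the counts that remain are those of `Fmax*Fmax≤`. With its converse below, this stands in for
    -- a product formula relating weights in X to weights in links.
    w≤C*w*wˡ : w x ≤ C * (w u * wˡ u x)
    w≤C*w*wˡ = *-cancelʳ-≤ (*-pos (Fmin-pos ℤ.≤-refl (P.-1≤dim x) i≤d) (topWeight-pos u)) (begin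
      w x * (Fmin -1ℤ i * topWeight u)  ≈⟨ solve 3 (λ a m t → a :* (m :* t) := m :* a :* t) refl (w x) (Fmin -1ℤ i) (topWeight u) ⟩
      Fmin -1ℤ i * w x * topWeight u  ≤⟨ *-mono-≤ (proj₁ (topWeight-pos x)) (proj₁ (topWeight-pos u)) (Fmin*w≤ x dx≤k+2) (≤Fmax*w u b≤k+2) ⟩
      topWeight x * (Fmax -1ℤ b * w u)  ≤⟨ *-monoˡ-≤ (*-nonNeg (0≤Fmax -1ℤ b) (0≤w u)) (≤Fmax*num u x u⊑x dx≤k+2) ⟩
      Fmax b i * N * (Fmax -1ℤ b * w u)  ≈⟨ solve 4 (λ m n m′ a → m :* n :* (m′ :* a) := m′ :* m :* (n :* a)) refl (Fmax b i) N (Fmax -1ℤ b) (w u) ⟩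
      Fmax -1ℤ b * Fmax b i * (N * w u)  ≤⟨ *-monoˡ-≤ (*-nonNeg 0≤N (0≤w u)) (Fmax*Fmax≤ -1≤b (dim-mono u⊑x) dx≤k+2) ⟩
      C * Fmin -1ℤ i * (N * w u)  ≈⟨ *-congˡ (*-congʳ (wˡ*topWeight u x u⊑x dx≤k+2)) ⟨
      C * Fmin -1ℤ i * (wˡ u x * topWeight u * w u)  ≈⟨ solve 5 (λ c m l t a → c :* m :* (l :* t :* a) := c :* (a :* l) :* (m :* t)) refl C (Fmin -1ℤ i) (wˡ u x) (topWeight u) (w u) ⟩
      C * (w u * wˡ u x) * (Fmin -1ℤ i * topWeight u)  ∎)

    w*wˡ≤C*w : w u * wˡ u x ≤ C * w x
    w*wˡ≤C*w = *-cancelʳ-≤ (*-pos (*-pos (Fmin-pos ℤ.≤-refl -1≤b (ℤ.≤-trans (dim-mono u⊑x) i≤d))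
                        (Fmin-pos -1≤b (dim-mono u⊑x) i≤d)) (topWeight-pos u)) (begin
      w u * wˡ u x * (m * topWeight u)  ≈⟨ solve 5 (λ a l p q t → a :* l :* (p :* q :* t) := p :* a :* (q :* (l :* t))) refl (w u) (wˡ u x) (Fmin -1ℤ b) (Fmin b i) (topWeight u) ⟩
      Fmin -1ℤ b * w u * (Fmin b i * (wˡ u x * topWeight u))  ≈⟨ *-congˡ (*-congˡ (wˡ*topWeight u x u⊑x dx≤k+2)) ⟩
      Fmin -1ℤ b * w u * (Fmin b i * N)  ≤⟨ *-mono-≤ (proj₁ (topWeight-pos u)) (*-nonNeg (0≤Fmin b i) 0≤N)
                        (Fmin*w≤ u b≤k+2) (≤-trans (Fmin*num≤ u x u⊑x dx≤k+2) (≤Fmax*w x dx≤k+2)) ⟩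
      topWeight u * (Fmax -1ℤ i * w x)  ≤⟨ *-monoʳ-≤ (proj₁ (topWeight-pos u)) (*-monoˡ-≤ (0≤w x) (Fmax≤Fmin*Fmin -1≤b (dim-mono u⊑x) dx≤k+2)) ⟩
      topWeight u * (C * m * w x)  ≈⟨ solve 4 (λ t c m a → t :* (c :* m :* a) := c :* a :* (m :* t)) refl (topWeight u) C m (w x) ⟩
      C * w x * (m * topWeight u)  ∎)
      where
      m : |ℝ|
      m = Fmin -1ℤ b * Fmin b i

  wt : ∀ {p} → Pred Carrier p → |ℝ|
  wt P = ∑ elements (λ x → mask (P x) (w x))

  lwt : ∀ {p} → Carrier → Pred Carrier p → |ℝ|
  lwt u P = ∑ elements (λ x → mask (u ⊑ x × P x) (wˡ u x))

  wt-mono : ∀ {p q} {P : Pred Carrier p} {Q : Pred Carrier q} → (∀ x → P x → Q x) → wt P ≤ wt Q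
  wt-mono P⇒Q = ∑-mono elements λ x → mask-mono (P⇒Q x) (λ _ → 0≤w x) (λ _ → ≤-refl)

  wt-nonNeg : ∀ {p} (P : Pred Carrier p) → 0# ≤ wt P
  wt-nonNeg P = ∑-nonNeg elements λ x → mask-nonNeg λ _ → 0≤w x

  wt-split : ∀ {p q} (P : Pred Carrier p) (Q : Pred Carrier q) →
             wt P ≈ wt (λ x → P x × Q x) + wt (λ x → P x × ¬ Q x)
  wt-split P Q = trans (∑-cong elements λ x → mask-split) (∑-+ _ _ elements)

  w≤wt : ∀ {p} {P : Pred Carrier p} x → P x → w x ≤ wt P
  w≤wt x px = ≤-respˡ (mask-yes px) (term≤∑ elements (λ x → mask-nonNeg λ _ → 0≤w x) (elements-complete x))

  wt-⊎ : ∀ {p q s} {P : Pred Carrier p} {Q : Pred Carrier q} {T : Pred Carrier s} →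
         (∀ x → P x → Q x ⊎ T x) → wt P ≤ wt Q + wt T
  wt-⊎ {P = P} {Q} {T} cover = ≤-respˡ (sym (wt-split P Q)) (+-mono-≤ (wt-mono λ x → proj₂) (wt-mono λ x (px , ¬qx) →
    case cover x px of λ { (inj₁ qx) → contradiction qx ¬qx ; (inj₂ tx) → tx }))

  module _ {p} (u : Carrier) (P : Pred Carrier p) (P⇒≤k+2 : ∀ x → P x → dim x ℤ.≤ K+2) where

    lwt-nonNeg : 0# ≤ lwt u P
    lwt-nonNeg = ∑-nonNeg elements λ x → mask-nonNeg λ (u⊑x , px) → 0≤wˡ u x u⊑x (P⇒≤k+2 x px)

    wt≤C*w*lwt : wt (λ x → u ⊑ x × P x) ≤ C * (w u * lwt u P)
    wt≤C*w*lwt = ≤-respʳ (sym (trans (*-congˡ (∑-*ˡ (w u) _ elements)) (∑-*ˡ C _ elements)))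
      (∑-mono elements λ x → ≤-respʳ (sym (trans (*-congˡ (mask-* (w u))) (mask-* C)))
        (mask-mono id (λ (u⊑x , px) → ≤-trans (0≤w x) (w≤C*w*wˡ u x u⊑x (P⇒≤k+2 x px)))
                      (λ (u⊑x , px) → w≤C*w*wˡ u x u⊑x (P⇒≤k+2 x px))))

    w*lwt≤C*wt : w u * lwt u P ≤ C * wt (λ x → u ⊑ x × P x)
    w*lwt≤C*wt = ≤-respˡ (sym (∑-*ˡ (w u) _ elements)) (≤-respʳ (sym (∑-*ˡ C _ elements))
      (∑-mono elements λ x → ≤-respˡ (sym (mask-* (w u))) (≤-respʳ (sym (mask-* C))
        (mask-mono id (λ (u⊑x , px) → *-nonNeg 0≤C (0≤w x))
                      (λ (u⊑x , px) → w*wˡ≤C*w u x u⊑x (P⇒≤k+2 x px))))))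

  module _ {j : ℤ} (x : Carrier) (dx≤j : dim x ℤ.≤ j) (j≤k+2 : j ℤ.≤ K+2) where
    private
      j≤d : j ℤ.≤ + d
      j≤d = ≤k+2⇒≤d j≤k+2

      q : Face (+ d) → |ℝ|
      q y = w (value y) / count x j (value y)

    -- Both sides are the sum of w y / #{z : x ⊑ z ⊑ y, dim z = j} over pairs z ⊑ y.
    star-num : ∑ elements (λ z → mask (x ⊑ z × dim z ≡ j) (topSum z (λ y → w (value y) / count x (dim z) (value y)))) ≈
               topWeight x
    star-num = begin-equality
      ∑ elements (λ z → mask (x ⊑ z × dim z ≡ j) (topSum z (λ y → w (value y) / count x (dim z) (value y))))
        ≈⟨ ∑-cong elements (λ z → mask-cong id id λ { (_ , ≡-refl) → ∑-filter-mask _ _ (faces (+ d)) }) ⟩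
      ∑ elements (λ z → mask (x ⊑ z × dim z ≡ j) (∑ (faces (+ d)) (λ y → mask (z ⊑ value y) (q y))))
        ≈⟨ ∑-cong elements (λ z → mask-∑ _ (faces (+ d))) ⟩
      ∑ elements (λ z → ∑ (faces (+ d)) (λ y → mask (x ⊑ z × dim z ≡ j) (mask (z ⊑ value y) (q y))))
        ≈⟨ ∑-swap _ elements (faces (+ d)) ⟩
      ∑ (faces (+ d)) (λ y → ∑ elements (λ z → mask (x ⊑ z × dim z ≡ j) (mask (z ⊑ value y) (q y))))
        ≈⟨ ∑-cong (faces (+ d)) (λ y → trans (∑-cong elements (λ z → trans mask-mask (regroup y z))) (inner y (lem {P = x ⊑ value y}))) ⟩
      ∑ (faces (+ d)) (λ y → mask (x ⊑ value y) (w (value y)))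
        ≈⟨ ∑-filter-mask _ _ (faces (+ d)) ⟨
      topWeight x ∎
      where
      regroup : ∀ y z → mask ((x ⊑ z × dim z ≡ j) × z ⊑ value y) (q y) ≈
                        q y * mask (dim z ≡ j × x ⊑ z × z ⊑ value y) 1#
      regroup y z = trans (mask-cong (λ ((a , b) , c) → b , a , c) (λ (b , a , c) → (a , b) , c)
        λ _ → sym (*-identityʳ (q y))) (sym (mask-* (q y)))
      inner : ∀ y → Dec (x ⊑ value y) →
              ∑ elements (λ z → q y * mask (dim z ≡ j × x ⊑ z × z ⊑ value y) 1#) ≈ mask (x ⊑ value y) (w (value y))
      inner y (yes x⊑y) = begin-equality
        ∑ elements (λ z → q y * mask (dim z ≡ j × x ⊑ z × z ⊑ value y) 1#)  ≈⟨ ∑-*ˡ (q y) _ elements ⟨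
        q y * ∑ elements (λ z → mask (dim z ≡ j × x ⊑ z × z ⊑ value y) 1#)  ≈⟨ *-congˡ (count-∑ x j (value y)) ⟨
        q y * count x j (value y)  ≈⟨ x/y*y≈x (<-≤-trans (Fmin-pos (P.-1≤dim x) dx≤j j≤d) (Fmin≤count x j y x⊑y)) ⟩
        w (value y)  ≈⟨ mask-yes x⊑y ⟨
        mask (x ⊑ value y) (w (value y))  ∎
      inner y (no x⋢y) = trans (∑-0 elements λ z → trans (*-congˡ (mask-no λ (_ , x⊑z , z⊑y) → x⋢y (⊑-trans x⊑z z⊑y))) (zeroʳ (q y)))
                               (sym (mask-no x⋢y))

    lwt-star : lwt x (λ z → dim z ≡ j) ≈ 1#
    lwt-star = begin-equality
      lwt x (λ z → dim z ≡ j)  ≈⟨ ∑-cong elements (λ z → trans (mask-cong id id λ _ → *-comm _ _) (sym (mask-* _))) ⟩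
      ∑ elements (λ z → topWeight x ⁻¹ * mask (x ⊑ z × dim z ≡ j) (topSum z (λ y → w (value y) / count x (dim z) (value y))))
        ≈⟨ ∑-*ˡ _ _ elements ⟨
      topWeight x ⁻¹ * ∑ elements (λ z → mask (x ⊑ z × dim z ≡ j) (topSum z (λ y → w (value y) / count x (dim z) (value y))))
        ≈⟨ *-congˡ star-num ⟩
      topWeight x ⁻¹ * topWeight x  ≈⟨ *-inverseˡ (pos⇒≉0 (topWeight-pos x)) ⟩
      1#  ∎

    wt-star : wt (λ z → x ⊑ z × dim z ≡ j) ≤ C * w x
    wt-star = begin
      wt (λ z → x ⊑ z × dim z ≡ j)  ≤⟨ wt≤C*w*lwt x (λ z → dim z ≡ j) (λ { z ≡-refl → j≤k+2 }) ⟩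
      C * (w x * lwt x (λ z → dim z ≡ j))  ≈⟨ *-congˡ (trans (*-congˡ lwt-star) (*-identityʳ (w x))) ⟩
      C * w x  ∎

  wt-dim : ∀ {j} → -1ℤ ℤ.≤ j → j ℤ.≤ K+2 → wt (λ z → dim z ≡ j) ≈ 1#
  wt-dim {j} -1≤j j≤k+2 = begin-equality
    wt (λ z → dim z ≡ j)  ≈⟨ ∑-cong elements (λ z → mask-cong (∅-min z ,_) proj₂ λ _ → w≈num z) ⟩
    ∑ elements (λ z → mask (∅ ⊑ z × dim z ≡ j) (topSum z (λ y → w (value y) / count ∅ (dim z) (value y))))
                             ≈⟨ star-num ∅ (subst (ℤ._≤ j) (≡-sym ∅-dim) -1≤j) j≤k+2 ⟩
    topWeight ∅  ≈⟨ ∑-filter-mask _ _ (faces (+ d)) ⟩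
    ∑ (faces (+ d)) (λ y → mask (∅ ⊑ value y) (w (value y)))  ≈⟨ ∑-cong (faces (+ d)) (λ y → mask-yes (∅-min (value y))) ⟩
    ∑ (faces (+ d)) (λ y → w (value y))  ≈⟨ proj₁ (proj₂ proper) ⟩
    1#  ∎

  dims : List ℤ
  dims = map (λ n → ℤ.pred (+ n)) (upTo (4 ℕ.+ k))

  ∈-dims : ∀ {j} → -1ℤ ℤ.≤ j → j ℤ.≤ K+2 → j ∈ dims
  ∈-dims {+ n}            _         (ℤ.+≤+ n≤) =
    ∈-map⁺ (λ n → ℤ.pred (+ n)) (∈-upTo⁺ (s≤s (s≤s (subst (n ℕ.≤_) (ℕ.+-comm k 2) n≤))))
  ∈-dims { ℤ.-[1+ 0 ]}     _         _ = ∈-map⁺ (λ n → ℤ.pred (+ n)) {x = 0} (∈-upTo⁺ (s≤s z≤n))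
  ∈-dims { ℤ.-[1+ suc n ]} (ℤ.-≤- ()) _

  ∑-dims : ∀ {f : ℤ → |ℝ|} {c} → (∀ j → f j ≤ c) → ∑ dims f ≤ D * c
  ∑-dims {f} {c} bound = subst (λ n → ∑ dims f ≤ fromℕ n * c)
    (≡-trans (length-map (λ n → ℤ.pred (+ n)) (upTo (4 ℕ.+ k))) (length-upTo (4 ℕ.+ k))) (∑-bound dims bound)

  down-count : ∀ x → dim x ℤ.≤ K+2 → ∑ elements (λ u → mask (u ⊑ x) 1#) ≤ Φ
  down-count x dx≤ = begin
    ∑ elements (λ u → mask (u ⊑ x) 1#)
      ≤⟨ ∑-mono elements (λ u → mask≤∑ dims (λ _ → 0≤1) λ u⊑x →
           dim u , ∈-dims (P.-1≤dim u) (ℤ.≤-trans (dim-mono u⊑x) dx≤) , (≡-refl , ∅-min u , u⊑x) , ≤-refl) ⟩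
    ∑ elements (λ u → ∑ dims (λ j → mask (dim u ≡ j × ∅ ⊑ u × u ⊑ x) 1#))  ≈⟨ ∑-swap _ elements dims ⟩
    ∑ dims (λ j → ∑ elements (λ u → mask (dim u ≡ j × ∅ ⊑ u × u ⊑ x) 1#))  ≈⟨ ∑-cong dims (λ j → count-∑ ∅ j x) ⟨
    ∑ dims (λ j → count ∅ j x)  ≤⟨ ∑-dims bound ⟩
    Φ  ∎
    where
    bound : ∀ j → count ∅ j x ≤ fromℕ F
    bound j with lem {P = -1ℤ ℤ.≤ j × j ℤ.≤ dim x}
    ... | yes (p , q) = count-∅≤F x p q dx≤
    ... | no out  = ≤-respˡ (sym (trans (count-∑ ∅ j x) (∑-0 elements λ u → mask-no λ { (≡-refl , _ , u⊑x) →
                          out (P.-1≤dim u , dim-mono u⊑x) }))) (fromℕ-nonNeg F)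

  -- After the sums are exchanged, z is counted once for each face u below it, which happens at most
  -- Φ times.
  ∑-up : ∀ {p} (Q : Pred Carrier p) → (∀ z → Q z → dim z ℤ.≤ K+2) → (f : Carrier → |ℝ|) → (∀ z → 0# ≤ f z) →
         ∑ elements (λ u → ∑ elements (λ z → mask (u ⊑ z × Q z) (f z))) ≤ Φ * ∑ elements (λ z → mask (Q z) (f z))
  ∑-up Q Q⇒≤ f 0≤f = begin
    ∑ elements (λ u → ∑ elements (λ z → mask (u ⊑ z × Q z) (f z)))
      ≈⟨ ∑-swap _ elements elements ⟩
    ∑ elements (λ z → ∑ elements (λ u → mask (u ⊑ z × Q z) (f z)))
      ≈⟨ ∑-cong elements (λ z → trans (∑-cong elements λ u → regroup u z) (sym (mask-∑ _ elements))) ⟩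
    ∑ elements (λ z → mask (Q z) (∑ elements (λ u → f z * mask (u ⊑ z) 1#)))
      ≤⟨ ∑-mono elements (λ z → mask-mono id (λ _ → *-nonNeg 0≤Φ (0≤f z)) λ qz →
           ≤-respˡ (∑-*ˡ (f z) _ elements) (≤-respʳ (*-comm (f z) Φ) (*-monoʳ-≤ (0≤f z) (down-count z (Q⇒≤ z qz))))) ⟩
    ∑ elements (λ z → mask (Q z) (Φ * f z))
      ≈⟨ trans (∑-*ˡ Φ _ elements) (∑-cong elements λ z → mask-* Φ) ⟨
    Φ * ∑ elements (λ z → mask (Q z) (f z))  ∎
    where
    regroup : ∀ u z → mask (u ⊑ z × Q z) (f z) ≈ mask (Q z) (f z * mask (u ⊑ z) 1#)
    regroup u z = trans (trans (mask-cong (λ (a , b) → b , a) (λ (b , a) → a , b) (λ _ → refl)) (sym mask-mask))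
      (mask-cong id id λ _ → trans (mask-cong id id λ _ → sym (*-identityʳ (f z))) (sym (mask-* (f z))))

  ∑-w*lwt : ∀ {p} (A : Pred Carrier p) → (∀ x → A x → dim x ℤ.≤ K+2) →
            ∑ elements (λ u → w u * lwt u A) ≤ C * Φ * wt A
  ∑-w*lwt A A⇒≤ = begin
    ∑ elements (λ u → w u * lwt u A)  ≤⟨ ∑-mono elements (λ u → w*lwt≤C*wt u A A⇒≤) ⟩
    ∑ elements (λ u → C * wt (λ x → u ⊑ x × A x))  ≈⟨ ∑-*ˡ C _ elements ⟨
    C * ∑ elements (λ u → wt (λ x → u ⊑ x × A x))  ≤⟨ *-monoʳ-≤ 0≤C (∑-up A A⇒≤ w 0≤w) ⟩
    C * (Φ * wt A)  ≈⟨ *-assoc C Φ (wt A) ⟨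
    C * Φ * wt A  ∎

  -- Fat faces

  -- A stands for the support of an n-cochain, and the constants π bound the
  -- densities of fat faces: u is fat if π (dim u) ≤ wᵤ(A_i) π i for some i.

  record FatData : Set₁ where
    field
      n : ℕ
      n≤k+1 : n ℕ.≤ k ℕ.+ 1
      𝓘 : AbstractIntersectionProfile n
      isProfile : IsIntersectionProfileFor 𝓘 X
      π : ℤ → |ℝ|
      π-pos : ∀ i → 0# < π i
      π-mono : ∀ {i j} → i ℤ.≤ j → j ℤ.≤ + n → π i ≤ π j
      A : Pred Carrier 0ℓ
      A-dim : ∀ x → A x → dim x ≡ + n

  module Fatness (𝓓 : FatData) where
    open FatData 𝓓
    open AbstractIntersectionProfile 𝓘

    n<k+2 : n ℕ.< k ℕ.+ 2
    n<k+2 = subst (suc n ℕ.≤_) (≡-sym (ℕ.+-suc k 1)) (s≤s n≤k+1)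

    n≤K+2 : + n ℤ.≤ K+2
    n≤K+2 = ℤ.+≤+ (ℕ.<⇒≤ n<k+2)

    sn≤K+2 : + suc n ℤ.≤ K+2
    sn≤K+2 = ℤ.+≤+ n<k+2

    0≤π : ∀ i → 0# ≤ π i
    0≤π i = proj₁ (π-pos i)

    -- Fats c consists of the fat faces of dimension at least n - c.
    Fats : ℕ → Pred Carrier 0ℓ
    Fats zero    x = A x
    Fats (suc c) x = Fats c x ⊎ (dim x ℤ.+ + suc c ≡ + n × 0ℤ ℤ.≤ dim x ×
      ∃[ i ] dim x ℤ.< i × (i , dim x) ∈ₚ Ad × π (dim x) ≤ lwt x (λ y → Fats c y × dim y ≡ i) * π i)

    -- ∅ is excluded by `0ℤ ℤ.≤ dim x`: coboundary expansion is assumed only for links of faces of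
    -- dimension at least 0, and descents must end at such faces.
    Fat : Pred Carrier 0ℓ
    Fat = Fats n

    Fatᵢ : ℤ → Pred Carrier 0ℓ
    Fatᵢ i x = Fat x × dim x ≡ i

    Fats-dim : ∀ c {x} → Fats c x → 0ℤ ℤ.≤ dim x × dim x ℤ.≤ + n
    Fats-dim zero    {x} a rewrite A-dim x a = ℤ.+≤+ z≤n , ℤ.≤-refl
    Fats-dim (suc c) (inj₁ f) = Fats-dim c f
    Fats-dim (suc c) {x} (inj₂ (e , 0≤ , _)) = 0≤ , subst (dim x ℤ.≤_) e (ℤ.i≤i+j (dim x) (+ suc c))

    Fats-mono : ∀ {c c′} → c ℕ.≤ c′ → ∀ {x} → Fats c x → Fats c′ x
    Fats-mono {c} {c′} c≤c′ {x} = go (ℕ.≤⇒≤′ c≤c′)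
      where
      go : ∀ {c′} → c ℕ.≤′ c′ → Fats c x → Fats c′ x
      go (ℕ.≤′-reflexive ≡-refl) f = f
      go (ℕ.≤′-step p)           f = inj₁ (go p f)

    -- Stage c settles all faces of dimension at least n - c; later stages only add faces of smaller
    -- dimension.
    Fats-stable : ∀ c c′ {x} → + n ℤ.≤ dim x ℤ.+ + c → Fats c′ x → Fats c x
    Fats-stable c zero     p a  = Fats-mono {0} {c} z≤n a
    Fats-stable c (suc c′) p (inj₁ f) = Fats-stable c c′ p f
    Fats-stable c (suc c′) {x} p f@(inj₂ (e , _)) =
      Fats-mono {suc c′} {c} (ℤ.drop‿+≤+ (+ᶻ-cancelˡ-≤ (dim x) (subst (ℤ._≤ dim x ℤ.+ + c) (≡-sym e) p))) f

    A⇒Fat : ∀ {x} → A x → Fat x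
    A⇒Fat = Fats-mono {0} {n} z≤n

    Fat-0≤dim : ∀ {x} → Fat x → 0ℤ ℤ.≤ dim x
    Fat-0≤dim f = proj₁ (Fats-dim n f)

    Fat-dim≤n : ∀ {x} → Fat x → dim x ℤ.≤ + n
    Fat-dim≤n f = proj₂ (Fats-dim n f)

    Fats⇒≤k+2 : ∀ c x → Fats c x → dim x ℤ.≤ K+2
    Fats⇒≤k+2 c x f = ℤ.≤-trans (proj₂ (Fats-dim c f)) n≤K+2

    Fatᵢ⇒≤k+2 : ∀ i x → Fatᵢ i x → dim x ℤ.≤ K+2
    Fatᵢ⇒≤k+2 i x (f , _) = Fats⇒≤k+2 n x f

    -- The recursion measures density with the fat faces known at the stage of u. Faces of dimension
    -- i > dim u are settled by then, so density with respect to all of `Fat` amounts to the same.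
    heavy⇒Fat : ∀ {u i} → 0ℤ ℤ.≤ dim u → dim u ℤ.< + n → dim u ℤ.< i → (i , dim u) ∈ₚ Ad →
                π (dim u) ≤ lwt u (Fatᵢ i) * π i → Fat u
    heavy⇒Fat {u} {i} 0≤du du<n du<i ad heavy = go (dim u) ≡-refl 0≤du du<n
      where
      go : ∀ a → dim u ≡ a → 0ℤ ℤ.≤ a → a ℤ.< + n → Fat u
      go (+ a) e (ℤ.+≤+ _) (ℤ.+<+ a<n) = Fats-mono {suc c} {n} (ℕ.≤-trans (ℕ.≤-reflexive (ℕ.m+[n∸m]≡n (ℕ.m<n⇒0<n∸m a<n))) (ℕ.m∸n≤m n a))
        (inj₂ (codim , 0≤du , i , du<i , ad , ≤-trans heavy (*-monoˡ-≤ (0≤π i)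
          (∑-mono elements λ y → mask-mono (λ (u⊑y , f , dy) → u⊑y , Fats-stable c n (above dy) f , dy)
            (λ (u⊑y , f , dy) → 0≤wˡ u y u⊑y (Fats⇒≤k+2 c y f)) (λ _ → ≤-refl)))))
        where
        -- Stage `suc c` is the one that decides the faces of dimension a = n - (c + 1).
        c : ℕ
        c = n ℕ.∸ a ℕ.∸ 1
        a+sc : a ℕ.+ suc c ≡ n
        a+sc = ≡-trans (cong (a ℕ.+_) (ℕ.m+[n∸m]≡n (ℕ.m<n⇒0<n∸m a<n))) (ℕ.m+[n∸m]≡n (ℕ.<⇒≤ a<n))
        codim : dim u ℤ.+ + suc c ≡ + n
        codim = ≡-trans (cong (ℤ._+ + suc c) e) (cong +_ a+sc)
        above : ∀ {y} → dim y ≡ i → + n ℤ.≤ dim y ℤ.+ + c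
        above {y} ≡-refl = ℤ.≤-trans (ℤ.≤-reflexive (≡-trans (≡-sym (cong +_ a+sc)) (cong +_ (ℕ.+-suc a c))))
          (ℤ.+-monoˡ-≤ (+ c) (ℤ.i<j⇒suc[i]≤j (subst (ℤ._< dim y) e du<i)))

    -- A potential in which each fat face counts with its threshold. In these units the fatness of x
    -- bounds w(x) π (dim x) by a sum of w(x) wₓ(y) π (dim y) over fat y above x, which is
    -- comparable with what these y contribute.
    V : ℕ → |ℝ|
    V c = ∑ elements (λ x → mask (Fats c x) (w x * π (dim x)))

    wπ-nonNeg : ∀ x → 0# ≤ w x * π (dim x)
    wπ-nonNeg x = *-nonNeg (0≤w x) (0≤π (dim x))

    V-zero : V 0 ≈ π (+ n) * wt A
    V-zero = sym (trans (∑-*ˡ _ _ elements) (∑-cong elements λ x → trans (mask-* _)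
      (mask-cong id id λ a → trans (*-comm _ _) (*-congˡ (reflexive (cong π (≡-sym (A-dim x a))))))))

    -- Each new fat face is charged to the fat faces above it that make it fat.
    V-suc : ∀ c → V (suc c) ≤ (1# + C * Φ) * V c
    V-suc c = begin
      V (suc c)  ≤⟨ ∑-mono elements (λ x → mask≤ (+-nonNeg (0≤old x) (0≤new x)) λ
        { (inj₁ f) → ≤-trans (≤-reflexive (sym (mask-yes f))) (x≤x+y (0≤new x))
        ; (inj₂ (_ , _ , i , _ , _ , heavy)) → ≤-trans (*-monoʳ-≤ (0≤w x) (≤-trans heavy (weighted x i))) (x≤y+x (0≤old x)) }) ⟩
      ∑ elements (λ x → old x + w x * new x)  ≈⟨ ∑-+ old _ elements ⟩
      V c + ∑ elements (λ x → w x * new x)  ≤⟨ +-monoʳ-≤ (V c) (∑-mono elements λ x →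
        ≤-respˡ (sym (∑-*ˡ (w x) _ elements)) (∑-mono elements λ y → ≤-respˡ (sym (mask-* (w x)))
          (mask-mono id (λ _ → *-nonNeg 0≤C (wπ-nonNeg y)) (λ (x⊑y , f) → pointwise x y x⊑y (Fats⇒≤k+2 c y f))))) ⟩
      V c + ∑ elements (λ x → ∑ elements (λ y → mask (x ⊑ y × Fats c y) (C * (w y * π (dim y)))))
                        ≤⟨ +-monoʳ-≤ (V c) (∑-up (Fats c) (Fats⇒≤k+2 c) _ λ y → *-nonNeg 0≤C (wπ-nonNeg y)) ⟩
      V c + Φ * ∑ elements (λ y → mask (Fats c y) (C * (w y * π (dim y))))
                        ≈⟨ +-congˡ (*-congˡ (trans (∑-*ˡ C _ elements) (∑-cong elements λ y → mask-* C))) ⟨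
      V c + Φ * (C * V c)  ≈⟨ solve 3 (λ v p c → v :+ p :* (c :* v) := (con 1 :+ c :* p) :* v) refl (V c) Φ C ⟩
      (1# + C * Φ) * V c  ∎
      where
      old new : Carrier → |ℝ|
      old x = mask (Fats c x) (w x * π (dim x))
      new x = ∑ elements (λ y → mask (x ⊑ y × Fats c y) (wˡ x y * π (dim y)))
      0≤old : ∀ x → 0# ≤ old x
      0≤old x = mask-nonNeg λ _ → wπ-nonNeg x
      0≤newterm : ∀ x y → x ⊑ y × Fats c y → 0# ≤ wˡ x y * π (dim y)
      0≤newterm x y (x⊑y , f) = *-nonNeg (0≤wˡ x y x⊑y (Fats⇒≤k+2 c y f)) (0≤π (dim y))
      0≤new : ∀ x → 0# ≤ w x * new x
      0≤new x = *-nonNeg (0≤w x) (∑-nonNeg elements λ y → mask-nonNeg (0≤newterm x y))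
      weighted : ∀ x i → lwt x (λ y → Fats c y × dim y ≡ i) * π i ≤ new x
      weighted x i = ≤-respˡ (trans (sym (∑-*ˡ (π i) _ elements)) (*-comm _ _)) (∑-mono elements λ y →
        ≤-respˡ (sym (mask-* (π i))) (mask-mono (λ (p , f , _) → p , f) (0≤newterm x y)
          (λ { (_ , _ , ≡-refl) → ≤-reflexive (*-comm _ _) })))
      pointwise : ∀ x y → x ⊑ y → dim y ℤ.≤ K+2 → w x * (wˡ x y * π (dim y)) ≤ C * (w y * π (dim y))
      pointwise x y x⊑y dy≤ = ≤-respˡ (*-assoc _ _ _) (≤-respʳ (*-assoc _ _ _)
        (*-monoˡ-≤ (0≤π (dim y)) (w*wˡ≤C*w x y x⊑y dy≤)))

    V≤ : ∀ c → V c ≤ γ ^ c * (π (+ n) * wt A)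
    V≤ zero  = ≤-reflexive (trans V-zero (sym (*-identityˡ _)))
    V≤ (suc c) = ≤-trans (V-suc c) (≤-respʳ (sym (*-assoc _ _ _)) (*-monoʳ-≤ (≤-trans 0≤1 1≤γ) (V≤ c)))

    Fatᵢ≤V : ∀ i → wt (Fatᵢ i) * π i ≤ V n
    Fatᵢ≤V i = ≤-respˡ (trans (sym (∑-*ˡ (π i) _ elements)) (*-comm _ _)) (∑-mono elements λ y →
      ≤-respˡ (sym (mask-* (π i))) (mask-mono proj₁ (λ _ → wπ-nonNeg y) λ { (_ , ≡-refl) → ≤-reflexive (*-comm _ _) }))

    Fat≤V : π 0ℤ * wt Fat ≤ V n
    Fat≤V = ≤-respˡ (sym (∑-*ˡ _ _ elements)) (∑-mono elements λ y → ≤-respˡ (sym (mask-* _))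
      (mask-mono id (λ _ → wπ-nonNeg y) λ f → ≤-respˡ (*-comm _ _)
        (*-monoʳ-≤ (0≤w y) (π-mono (Fat-0≤dim f) (Fat-dim≤n f)))))

    Meets : Carrier → ℤ → ℤ → ℤ → Pred Carrier 0ℓ
    Meets u t ℓ r x = dim x ≡ t × u ⊑ x × ∃₂ λ y z →
      Fatᵢ ℓ y × Fatᵢ r z × y ⊑ x × z ⊑ x × u ∈ₚ Inf₂ y z × y ≢ z

    Bad : Carrier → ℤ → ℤ → ℤ → Pred Carrier 0ℓ
    Bad u t ℓ r x = ((t , ℓ , r , dim u) ∈ₚ 𝒫 × ¬ Fat u) × Meets u t ℓ r x

    -- A fork of the descent below z may start at any face x of z, so the obstruction is sought at
    -- all x ⊑ z and not just at z.
    Contaminated : Pred Carrier 0ℓ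
    Contaminated z = dim z ≡ + suc n × ∃[ x ] x ⊑ z × ∃[ u ] ∃[ t ] ∃[ ℓ ] ∃[ r ] Bad u t ℓ r x

    lwtFat : Carrier → ℤ → |ℝ|
    lwtFat u i = lwt u (Fatᵢ i)

    lwtFat-nonNeg : ∀ u i → 0# ≤ lwtFat u i
    lwtFat-nonNeg u i = lwt-nonNeg u (Fatᵢ i) (Fatᵢ⇒≤k+2 i)

    -- The only consequence of skeleton expansion that is used.
    FewMeets : |ℝ| → Set
    FewMeets E = ∀ {t ℓ r u} → (t , ℓ , r , dim u) ∈ₚ 𝒫 → ¬ Fat u →
      wt (Meets u t ℓ r) ≤ E * (π r * (w u * (lwtFat u ℓ + lwtFat u r)))

    sn≡n+1 : + n ℤ.+ 1ℤ ≡ + suc n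
    sn≡n+1 = cong +_ (ℕ.+-comm n 1)

    𝒫-dims : ∀ {t ℓ r b} → (t , ℓ , r , b) ∈ₚ 𝒫 →
             (-1ℤ ℤ.≤ t × t ℤ.≤ + suc n) × (-1ℤ ℤ.≤ ℓ × ℓ ℤ.≤ + n) × (-1ℤ ℤ.≤ r × r ℤ.≤ ℓ)
    𝒫-dims {t} {ℓ} {r} p with 𝒫-range p
    ... | t≤ , ℓ<t , r≤ℓ , b<r , -1≤b =
      (ℤ.≤-trans -1≤ℓ (ℤ.<⇒≤ ℓ<t) , t≤sn) , (-1≤ℓ , ℓ≤n) , (-1≤r , r≤ℓ)
      where
      -1≤r : -1ℤ ℤ.≤ r
      -1≤r = ℤ.≤-trans -1≤b (ℤ.<⇒≤ b<r)
      -1≤ℓ : -1ℤ ℤ.≤ ℓ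
      -1≤ℓ = ℤ.≤-trans -1≤r r≤ℓ
      t≤sn : t ℤ.≤ + suc n
      t≤sn = subst (t ℤ.≤_) sn≡n+1 t≤
      ℓ≤n : ℓ ℤ.≤ + n
      ℓ≤n = +ᶻ-cancelˡ-≤ 1ℤ (ℤ.≤-trans (ℤ.i<j⇒suc[i]≤j ℓ<t) t≤sn)

    module _ (E : |ℝ|) (0≤E : 0# ≤ E) (fewMeets : FewMeets E) where

      -- Raising π r to π ℓ in the first summand charges each density at its own threshold, the form
      -- in which the sum over u is bounded by a multiple of the potential.
      wt-Bad≤ : ∀ u t ℓ r → wt (Bad u t ℓ r) ≤ E * (w u * lwtFat u ℓ * π ℓ + w u * lwtFat u r * π r)
      wt-Bad≤ u t ℓ r with lem {P = (t , ℓ , r , dim u) ∈ₚ 𝒫 × ¬ Fat u}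
      ... | no no𝒫 = ≤-respˡ (sym (∑-0 elements λ x → mask-no (no𝒫 ∘ proj₁)))
        (*-nonNeg 0≤E (+-nonNeg (*-nonNeg (*-nonNeg (0≤w u) (lwtFat-nonNeg u ℓ)) (0≤π ℓ))
                                 (*-nonNeg (*-nonNeg (0≤w u) (lwtFat-nonNeg u r)) (0≤π r))))
      ... | yes (p , ¬f) = begin
        wt (Bad u t ℓ r)  ≤⟨ wt-mono (λ x → proj₂) ⟩
        wt (Meets u t ℓ r)  ≤⟨ fewMeets p ¬f ⟩
        E * (π r * (w u * (lwtFat u ℓ + lwtFat u r)))  ≈⟨ *-congˡ (solve 4 (λ p w a b →
          p :* (w :* (a :+ b)) := w :* a :* p :+ w :* b :* p) refl (π r) (w u) (lwtFat u ℓ) (lwtFat u r)) ⟩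
        E * (w u * lwtFat u ℓ * π r + w u * lwtFat u r * π r)  ≤⟨ *-monoʳ-≤ 0≤E (+-monoˡ-≤ _
          (*-monoʳ-≤ (*-nonNeg (0≤w u) (lwtFat-nonNeg u ℓ)) (π-mono r≤ℓ ℓ≤n))) ⟩
        E * (w u * lwtFat u ℓ * π ℓ + w u * lwtFat u r * π r)  ∎
        where
        r≤ℓ : r ℤ.≤ ℓ
        r≤ℓ = proj₂ (proj₂ (proj₂ (𝒫-dims p)))
        ℓ≤n : ℓ ℤ.≤ + n
        ℓ≤n = proj₂ (proj₁ (proj₂ (𝒫-dims p)))

      ∑-wlwtπ≤ : ∀ i → ∑ elements (λ u → w u * lwtFat u i * π i) ≤ C * Φ * V n
      ∑-wlwtπ≤ i = begin
        ∑ elements (λ u → w u * lwtFat u i * π i)  ≈⟨ ∑-*ʳ (π i) _ elements ⟨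
        ∑ elements (λ u → w u * lwtFat u i) * π i  ≤⟨ *-monoˡ-≤ (0≤π i) (∑-w*lwt (Fatᵢ i) (Fatᵢ⇒≤k+2 i)) ⟩
        C * Φ * wt (Fatᵢ i) * π i  ≈⟨ *-assoc _ _ _ ⟩
        C * Φ * (wt (Fatᵢ i) * π i)  ≤⟨ *-monoʳ-≤ (*-nonNeg 0≤C 0≤Φ) (Fatᵢ≤V i) ⟩
        C * Φ * V n  ∎

      -- A union bound over the witnesses t, ℓ, r, u, x. The (n+1)-faces above x weigh at most C
      -- w(x), the bad x for given u are few by skeleton expansion, and the densities sum up to the
      -- potential.
      wt-Contaminated≤ : wt Contaminated ≤ D * (D * (D * (C * (E * (C * Φ * V n + C * Φ * V n)))))
      wt-Contaminated≤ = begin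
        wt Contaminated
          ≤⟨ ∑-mono elements (λ z → mask≤ (nonNeg z) (cover z)) ⟩
        ∑ elements (λ z → ∑ dims (λ t → ∑ dims (λ ℓ → ∑ dims (λ r → ∑ elements (λ u → ∑ elements (λ x → term t ℓ r u x z))))))
          ≈⟨ trans (∑-swap _ elements dims) (∑-cong dims λ t → trans (∑-swap _ elements dims) (∑-cong dims λ ℓ →
               trans (∑-swap _ elements dims) (∑-cong dims λ r → trans (∑-swap _ elements elements) (∑-cong elements λ u →
               ∑-swap _ elements elements)))) ⟩
        ∑ dims (λ t → ∑ dims (λ ℓ → ∑ dims (λ r → ∑ elements (λ u → ∑ elements (λ x → ∑ elements (λ z → term t ℓ r u x z))))))
          ≤⟨ ∑-dims (λ t → ∑-dims (λ ℓ → ∑-dims (λ r → bound t ℓ r))) ⟩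
        D * (D * (D * (C * (E * (C * Φ * V n + C * Φ * V n))))) ∎
        where
        term : ℤ → ℤ → ℤ → Carrier → Carrier → Carrier → |ℝ|
        term t ℓ r u x z = mask (Bad u t ℓ r x) (mask (x ⊑ z × dim z ≡ + suc n) (w z))
        0≤term : ∀ t ℓ r u x z → 0# ≤ term t ℓ r u x z
        0≤term t ℓ r u x z = mask-nonNeg λ _ → mask-nonNeg λ _ → 0≤w z
        nonNeg : ∀ z → 0# ≤ ∑ dims (λ t → ∑ dims (λ ℓ → ∑ dims (λ r → ∑ elements (λ u → ∑ elements (λ x → term t ℓ r u x z)))))
        nonNeg z = ∑-nonNeg dims λ t → ∑-nonNeg dims λ ℓ → ∑-nonNeg dims λ r → ∑-nonNeg elements λ u → ∑-nonNeg elements λ x →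
          0≤term t ℓ r u x z
        cover : ∀ z → Contaminated z →
                w z ≤ ∑ dims (λ t → ∑ dims (λ ℓ → ∑ dims (λ r → ∑ elements (λ u → ∑ elements (λ x → term t ℓ r u x z)))))
        cover z (dz , x , x⊑z , u , t , ℓ , r , bad) =
          let ((-1≤t , t≤) , (-1≤ℓ , ℓ≤n) , -1≤r , r≤ℓ) = 𝒫-dims (proj₁ (proj₁ bad))
          in ≤-trans (≤-reflexive (sym (trans (mask-yes bad) (mask-yes (x⊑z , dz)))))
            (≤-trans (term≤∑ elements (λ x → 0≤term t ℓ r u x z) (elements-complete x))
            (≤-trans (term≤∑ elements (λ u → ∑-nonNeg elements λ x → 0≤term t ℓ r u x z) (elements-complete u))
            (≤-trans (term≤∑ dims (λ r → ∑-nonNeg elements λ u → ∑-nonNeg elements λ x → 0≤term t ℓ r u x z)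
                       (∈-dims -1≤r (ℤ.≤-trans r≤ℓ (ℤ.≤-trans ℓ≤n n≤K+2))))
            (≤-trans (term≤∑ dims (λ ℓ → ∑-nonNeg dims λ r → ∑-nonNeg elements λ u → ∑-nonNeg elements λ x → 0≤term t ℓ r u x z)
                       (∈-dims -1≤ℓ (ℤ.≤-trans ℓ≤n n≤K+2)))
              (term≤∑ dims (λ t → ∑-nonNeg dims λ ℓ → ∑-nonNeg dims λ r → ∑-nonNeg elements λ u → ∑-nonNeg elements λ x → 0≤term t ℓ r u x z)
                       (∈-dims -1≤t (ℤ.≤-trans t≤ sn≤K+2)))))))
        above : ∀ t ℓ r u x → ∑ elements (λ z → term t ℓ r u x z) ≤ C * mask (Bad u t ℓ r x) (w x)
        above t ℓ r u x = ≤-respˡ (mask-∑ _ elements) (≤-respʳ (sym (mask-* C))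
          (mask-mono id (λ _ → *-nonNeg 0≤C (0≤w x)) λ (( p , _) , dx , _) →
            wt-star x (subst (ℤ._≤ + suc n) (≡-sym dx) (proj₂ (proj₁ (𝒫-dims p)))) sn≤K+2))
        bound : ∀ t ℓ r → ∑ elements (λ u → ∑ elements (λ x → ∑ elements (λ z → term t ℓ r u x z))) ≤
                          C * (E * (C * Φ * V n + C * Φ * V n))
        bound t ℓ r = begin
          ∑ elements (λ u → ∑ elements (λ x → ∑ elements (λ z → term t ℓ r u x z)))
            ≤⟨ ∑-mono elements (λ u → ∑-mono elements λ x → above t ℓ r u x) ⟩
          ∑ elements (λ u → ∑ elements (λ x → C * mask (Bad u t ℓ r x) (w x)))
            ≈⟨ trans (∑-*ˡ C _ elements) (∑-cong elements λ u → ∑-*ˡ C _ elements) ⟨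
          C * ∑ elements (λ u → wt (Bad u t ℓ r))
            ≤⟨ *-monoʳ-≤ 0≤C (∑-mono elements λ u → wt-Bad≤ u t ℓ r) ⟩
          C * ∑ elements (λ u → E * (w u * lwtFat u ℓ * π ℓ + w u * lwtFat u r * π r))
            ≈⟨ *-congˡ (trans (*-congˡ (sym (∑-+ _ _ elements))) (∑-*ˡ E _ elements)) ⟨
          C * (E * (∑ elements (λ u → w u * lwtFat u ℓ * π ℓ) + ∑ elements (λ u → w u * lwtFat u r * π r)))
            ≤⟨ *-monoʳ-≤ 0≤C (*-monoʳ-≤ 0≤E (+-mono-≤ (∑-wlwtπ≤ ℓ) (∑-wlwtπ≤ r))) ⟩
          C * (E * (C * Φ * V n + C * Φ * V n)) ∎

    infix 4 _⇒_
    -- Only the target is required to be fat, so that an (n+1)-face, which is never fat, can start a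
    -- descent.
    _⇒_ : Rel Carrier 0ℓ
    x ⇒ y = Fat y × Admissible 𝓘 X x y

    Terminal : Pred Carrier 0ℓ
    Terminal u = ∀ v → ¬ (u ⇒ v)

    ⇒*⇒⊒ : ∀ {x y} → Star _⇒_ x y → y ⊑ x
    ⇒*⇒⊒ ε = ⊑-refl
    ⇒*⇒⊒ ((_ , y⊏x , _) ◅ s) = ⊑-trans (⇒*⇒⊒ s) (proj₁ y⊏x)

    ⇒*-Fat : ∀ {x y} → Fat x → Star _⇒_ x y → Fat y
    ⇒*-Fat f ε = f
    ⇒*-Fat _ ((f , _) ◅ s) = ⇒*-Fat f s

    terminal-exists : ∀ x → ∃[ u ] Star _⇒_ x u × Terminal u
    terminal-exists x = go (P.<-wellFounded x)
      where
      go : ∀ {x} → Acc _⊏_ x → ∃[ u ] Star _⇒_ x u × Terminal u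
      go {x} (acc rs) with lem {P = ∃[ v ] x ⇒ v}
      ... | no none = x , ε , λ v s → none (v , s)
      ... | yes (v , s@(_ , v⊏x , _)) = let (u , v⇒*u , ter) = go (rs v⊏x) in u , s ◅ v⇒*u , ter

    module _ (z : Carrier) (dz : dim z ≡ + suc n) (clean : ¬ Contaminated z) where
      private
        _⟶_ : Rel Carrier 0ℓ
        x ⟶ y = x ⇒ y × x ⊑ z

        ⟶⁺⇒⊐ : ∀ {x y} → Plus _⟶_ x y → y ⊏ x
        ⟶⁺⇒⊐ [ (_ , y⊏x , _) , _ ] = y⊏x
        ⟶⁺⇒⊐ (_ ∼⁺⟨ p ⟩ q) = P.<-≤-trans (⟶⁺⇒⊐ q) (proj₁ (⟶⁺⇒⊐ p))

        embed : ∀ {x y} → x ⊑ z → Star _⇒_ x y → Star _⟶_ x y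
        embed x⊑z ε = ε
        embed x⊑z (s@(_ , y⊏x , _) ◅ rest) = (s , x⊑z) ◅ embed (⊑-trans (proj₁ y⊏x) x⊑z) rest

        -- Fat faces y and y′ below x are joined through their infimum, which is fat as z is clean.
        join : ∀ {x y y′} → dim y′ ℤ.≤ dim y → x ⟶ y → x ⟶ y′ → ∃[ v ] Star _⟶_ y v × Star _⟶_ y′ v
        join {x} {y} {y′} dy′≤dy ((fy , y⊏x , ad) , x⊑z) ((fy′ , y′⊏x , ad′) , _)
          with lem {P = y ≡ y′} | isProfile (y⊏x , ad) (y′⊏x , ad′) dy′≤dy
        ... | yes ≡-refl | _ = y , ε , ε
        ... | no y≢y′ | inj₁ y′⊑y = y′ , ((fy′ , y′⊏y , Ad-inner (P.dim-< y⊏x) (P.dim-< y′⊏y) (P.-1≤dim y′) ad ad′)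
                        , ⊑-trans (proj₁ y⊏x) x⊑z) ◅ ε , ε
          where
          y′⊏y : y′ ⊏ y
          y′⊏y = y′⊑y , λ e → y≢y′ (≡-sym e)
        ... | no y≢y′ | inj₂ inf∈𝒫 = u , ((fu , u⊏y , adℓ) , ⊑-trans (proj₁ y⊏x) x⊑z) ◅ ε
                        , ((fu , u⊏y′ , adr) , ⊑-trans (proj₁ y′⊏x) x⊑z) ◅ ε
          where
          u : Carrier
          u = proj₁ (P.Inf₂-exists y y′)
          u-inf : u ∈ₚ Inf₂ y y′
          u-inf = proj₂ (P.Inf₂-exists y y′)
          q : (dim x , dim y , dim y′ , dim u) ∈ₚ 𝒫
          q = inf∈𝒫 u u-inf
          b<r : dim u ℤ.< dim y′
          b<r = proj₁ (proj₂ (proj₂ (proj₂ (𝒫-range q))))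
          adℓ : (dim y , dim u) ∈ₚ Ad
          adℓ = proj₁ (proj₂ (proj₂ (𝒫⇒Ad q)))
          adr : (dim y′ , dim u) ∈ₚ Ad
          adr = proj₂ (proj₂ (proj₂ (𝒫⇒Ad q)))
          u⊏y : u ⊏ y
          u⊏y = proj₁ (P.Inf₂-≤ {y} {y′} u-inf) , λ { e → ℤ.<-irrefl (cong dim e) (ℤ.<-≤-trans b<r dy′≤dy) }
          u⊏y′ : u ⊏ y′
          u⊏y′ = proj₂ (P.Inf₂-≤ {y} {y′} u-inf) , λ { e → ℤ.<-irrefl (cong dim e) b<r }
          fu : Fat u
          fu = decidable-stable lem λ ¬fu → clean (dz , x , x⊑z , u , dim x , dim y , dim y′ , (q , ¬fu) ,
            ≡-refl , ⊑-trans (proj₁ u⊏y) (proj₁ y⊏x) , y , y′ , (fy , ≡-refl) , (fy′ , ≡-refl) ,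
            proj₁ y⊏x , proj₁ y′⊏x , u-inf , y≢y′)

        weaklyConfluent : WeaklyConfluent _⟶_
        weaklyConfluent {x} {y} {y′} s s′ with ℤ.≤-total (dim y′) (dim y)
        ... | inj₁ p = join p s s′
        ... | inj₂ p = let (v , a , b) = join p s′ s in v , b , a

        confluent : Confluent _⟶_
        confluent = sn&wcr⇒cr (WF.Subrelation.wellFounded ⟶⁺⇒⊐ P.<-wellFounded) weaklyConfluent

        terminal-≡ : ∀ {u v} → Terminal u → Star _⟶_ u v → u ≡ v
        terminal-≡ ter ε = ≡-refl
        terminal-≡ ter ((s , _) ◅ _) = contradiction s (ter _)

      -- As (n+1, n) is admissible, both descents can be prolonged upwards to start at z; confluence
      -- joins u and v, and terminal faces admit no further step.
      terminal-unique : ∀ {x y u v} → A x → A y → x ⊑ z → y ⊑ z → Star _⇒_ x u → Star _⇒_ y v → Terminal u → Terminal v → u ≡ v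
      terminal-unique {x} {y} ax ay x⊑z y⊑z x⇒*u y⇒*v ter-u ter-v =
        let (_ , a , b) = confluent (step ax x⊑z ◅ embed x⊑z x⇒*u) (step ay y⊑z ◅ embed y⊑z y⇒*v)
        in ≡-trans (terminal-≡ ter-u a) (≡-sym (terminal-≡ ter-v b))
        where
        step : ∀ {x} → A x → x ⊑ z → z ⟶ x
        step {x} ax x⊑z = (A⇒Fat ax , (x⊑z , λ e → ℤ.<-irrefl (≡-trans (≡-sym (A-dim x ax)) (≡-trans (cong dim e) dz)) (ℤ.+<+ ℕ.≤-refl)) ,
          subst₂ (λ i j → (i , j) ∈ₚ Ad) (≡-trans sn≡n+1 (≡-sym dz)) (≡-sym (A-dim x ax)) Ad-top) , ⊑-refl

  -- Skeleton expansion

  module Skeletons (𝓓 : FatData) (B B′ : |ℝ|) (0≤B : 0# ≤ B) (1≤B′ : 1# ≤ B′) where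
    open FatData 𝓓
    open AbstractIntersectionProfile 𝓘
    open Fatness 𝓓

    -- Records the two inequalities between α, β and the thresholds on which the estimate rests; the
    -- powers of κ that satisfy them enter later.
    LinkExpander : Set₁
    LinkExpander = ∀ t ℓ r u → (t , ℓ , r , dim u) ∈ₚ 𝒫 → -1ℤ ℤ.< dim u → ∃₂ λ α β →
      0# ≤ β × α ≤ π r × β * π (dim u) ≤ B * (π r * π r) × IsSkeletonExpander (linkNIH d X w u ℓ r t) α β

    GlobalExpander : Set₁
    GlobalExpander = ∀ t ℓ r → (t , ℓ , r , -1ℤ) ∈ₚ 𝒫 → ∃₂ λ α β →
      0# ≤ β × α ≤ π r × β * π -1ℤ ≤ B′ * B * (π r * π r) × IsSkeletonExpander (NIH X w ℓ r t) α β

    E : |ℝ|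
    E = C * (1# + B + B)

    0≤1+2B : 0# ≤ 1# + B + B
    0≤1+2B = +-nonNeg (+-nonNeg 0≤1 0≤B) 0≤B

    0≤E : 0# ≤ E
    0≤E = *-nonNeg 0≤C 0≤1+2B

    private
      r≤ℓ≤n : ∀ {t ℓ r b} → (t , ℓ , r , b) ∈ₚ 𝒫 → r ℤ.≤ ℓ × ℓ ℤ.≤ + n
      r≤ℓ≤n p = proj₂ (proj₂ (proj₂ (𝒫-dims p))) , proj₂ (proj₁ (proj₂ (𝒫-dims p)))

      Meets⇒≤k+2 : ∀ {t ℓ r u b} → (t , ℓ , r , b) ∈ₚ 𝒫 → ∀ x → Meets u t ℓ r x → dim x ℤ.≤ K+2
      Meets⇒≤k+2 p x (dx , _) = subst (ℤ._≤ K+2) (≡-sym dx) (ℤ.≤-trans (proj₂ (proj₁ (𝒫-dims p))) sn≤K+2)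

    module _ {t ℓ r : ℤ} {u : Carrier} (p : (t , ℓ , r , dim u) ∈ₚ 𝒫) where
      private
        b<r : dim u ℤ.< r
        b<r = proj₁ (proj₂ (proj₂ (proj₂ (𝒫-range p))))

        -- Contrapositive of `heavy⇒Fat`: this is where the non-fatness of u enters.
        thin : ∀ i → dim u ℤ.< i → i ℤ.≤ + n → (i , dim u) ∈ₚ Ad → 0ℤ ℤ.≤ dim u → ¬ Fat u → lwtFat u i * π i ≤ π (dim u)
        thin i b<i i≤n ad 0≤b ¬f = ≮⇒≥ λ heavy → ¬f (heavy⇒Fat 0≤b (ℤ.<-≤-trans b<i i≤n) b<i ad (proj₁ heavy))

      module _ (link-exp : LinkExpander) (-1<b : -1ℤ ℤ.< dim u) (¬f : ¬ Fat u) where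
        private
          shifted : ℤ → ℤ
          shifted i = i ℤ.- dim u ℤ.- 1ℤ

          open module N = NoIntersection (link X u) (linkWeight d X u w) (shifted ℓ) (shifted r) (shifted t)

          G : Pred (GradedPoset.Carrier (link X u)) 0ℓ
          G x = Fat (value x)

          above : ∀ x → u ⊑ value {P = λ x → u ⊑ x} x
          above x = GradedPoset.∅-min (link X u) x

          unshift : ∀ {i j} → shifted i ≡ shifted j → i ≡ j
          unshift {i} {j} e = begin-≡ i j (cong (ℤ._+ (1ℤ ℤ.+ dim u)) e)
            where
            cancel : ∀ i a → (i ℤ.- a ℤ.- 1ℤ) ℤ.+ (1ℤ ℤ.+ a) ≡ i
            cancel = ℤ.solve-∀
            begin-≡ : ∀ i j → shifted i ℤ.+ (1ℤ ℤ.+ dim u) ≡ shifted j ℤ.+ (1ℤ ℤ.+ dim u) → i ≡ j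
            begin-≡ i j e = ≡-trans (≡-sym (cancel i (dim u))) (≡-trans e (cancel j (dim u)))

          0≤w-G : ∀ x → G x → 0# ≤ wˡ u (value x)
          0≤w-G x f = 0≤wˡ u (value x) (above x) (Fats⇒≤k+2 n (value x) f)

          part : ∀ i → ∑ (GradedPoset.elements (link X u)) (λ x → mask (G x × GradedPoset.dim (link X u) x ≡ shifted i) (wˡ u (value x))) ≤ lwtFat u i
          part i = ≤-respˡ (sym (∑-mask-collect (u ≤?_) (wˡ u) elements)) (∑-mono elements λ x →
            mask-mono (λ (u⊑x , f , e) → u⊑x , f , unshift e) (λ (u⊑x , f , _) → 0≤wˡ u x u⊑x (Fats⇒≤k+2 n x f)) (λ _ → ≤-refl))

          lwt-Meets≤ : lwt u (Meets u t ℓ r) ≤ (1# + B + B) * (π r * (lwtFat u ℓ + lwtFat u r))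
          lwt-Meets≤ =
            let (α , β , 0≤β , α≤ , β≤ , exp) = link-exp t ℓ r u p -1<b
                (r≤ℓ , ℓ≤n) = r≤ℓ≤n p
                (_ , _ , adℓ , adr) = 𝒫⇒Ad p
                0≤b = ℤ.i<j⇒suc[i]≤j -1<b
            in expander-bound 0≤β (vertices-nonNeg G 0≤w-G) (π-pos r)
                 (≤-trans (vertices≤ G 0≤w-G) (+-mono-≤ (part ℓ) (part r)))
                 (≤-trans (*-monoʳ-≤ (lwtFat-nonNeg u ℓ) (π-mono r≤ℓ ℓ≤n)) (thin ℓ (ℤ.<-≤-trans b<r r≤ℓ) ℓ≤n adℓ 0≤b ¬f))
                 (thin r b<r (ℤ.≤-trans r≤ℓ ℓ≤n) adr 0≤b ¬f) α≤ β≤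
                 (≤-trans (≤-respˡ (trans (∑-mask-collect (u ≤?_) (wˡ u) elements) (∑-cong elements λ x →
                     mask-cong id id (λ _ → refl)))
                   (edges≥ G 0≤w-G (λ x → Meets u t ℓ r (value x)) 0≤w-edge edge)) (exp (λ x → G (value x)))) 0≤B
            where
            0≤w-edge : ∀ x → GradedPoset.dim (link X u) x ≡ shifted t → 0# ≤ wˡ u (value x)
            0≤w-edge x e = 0≤wˡ u (value x) (above x)
              (subst (ℤ._≤ K+2) (≡-sym (unshift e)) (ℤ.≤-trans (proj₂ (proj₁ (𝒫-dims p))) sn≤K+2))
            edge : ∀ x → Meets u t ℓ r (value x) → GradedPoset.dim (link X u) x ≡ shifted t × ∃₂ λ y z →
              (G y × GradedPoset.dim (link X u) y ≡ shifted ℓ) × (G z × GradedPoset.dim (link X u) z ≡ shifted r) ×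
              value y ⊑ value x × value z ⊑ value x × GradedPoset.∅ (link X u) ∈ₚ GradedPoset.Inf₂ (link X u) y z × y ≢ z
            edge x (dx , _ , y , z , (fy , dy) , (fz , dz) , y⊑x , z⊑x , inf , y≢z) =
              cong shifted dx , ŷ , ẑ , (fy , cong shifted dy) , (fz , cong shifted dz) , y⊑x , z⊑x ,
              ((λ { (inj₁ ≡-refl) → u⊑y ; (inj₂ ≡-refl) → u⊑z }) ,
               λ {v} low u⊑v → value-injective (proj₂ inf (λ { (inj₁ ≡-refl) → low {ŷ} (inj₁ ≡-refl) ; (inj₂ ≡-refl) → low {ẑ} (inj₂ ≡-refl) }) u⊑v)) ,
              λ e → y≢z (cong value e)
              where
              u⊑y = proj₁ (P.Inf₂-≤ {y} {z} inf)
              u⊑z = proj₂ (P.Inf₂-≤ {y} {z} inf)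
              ŷ ẑ : GradedPoset.Carrier (link X u)
              ŷ = y , [ u⊑y ]
              ẑ = z , [ u⊑z ]

        few-local : wt (Meets u t ℓ r) ≤ E * (π r * (w u * (lwtFat u ℓ + lwtFat u r)))
        few-local = begin
          wt (Meets u t ℓ r)  ≤⟨ wt-mono (λ x m → proj₁ (proj₂ m) , m) ⟩
          wt (λ x → u ⊑ x × Meets u t ℓ r x)  ≤⟨ wt≤C*w*lwt u (Meets u t ℓ r) (Meets⇒≤k+2 p) ⟩
          C * (w u * lwt u (Meets u t ℓ r))  ≤⟨ *-monoʳ-≤ 0≤C (*-monoʳ-≤ (0≤w u) lwt-Meets≤) ⟩
          C * (w u * ((1# + B + B) * (π r * (lwtFat u ℓ + lwtFat u r))))  ≈⟨ solve 5 (λ c w e p a → c :* (w :* (e :* (p :* a))) := c :* e :* (p :* (w :* a)))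
                        refl C (w u) (1# + B + B) (π r) _ ⟩
          E * (π r * (w u * (lwtFat u ℓ + lwtFat u r)))  ∎

      module _ (global-exp : GlobalExpander) (b≡-1 : dim u ≡ -1ℤ) (small : B′ * V n ≤ π -1ℤ) where
        private
          p′ : (t , ℓ , r , -1ℤ) ∈ₚ 𝒫
          p′ = subst (λ b → (t , ℓ , r , b) ∈ₚ 𝒫) b≡-1 p

          0<B′ : 0# < B′
          0<B′ = <-≤-trans 0<1 1≤B′

          open module N = NoIntersection X w ℓ r t

          -- As ∅ is never fat, its non-fatness carries no information; the smallness of the whole
          -- potential takes its place, and the division by B′ compensates the factor B′ in β.
          thin-∅ : ∀ i → wt (Fatᵢ i) * π i ≤ π -1ℤ / B′
          thin-∅ i = x≤y/z 0<B′ (≤-respˡ (*-comm _ _) (≤-trans (*-monoʳ-≤ (proj₁ 0<B′) (Fatᵢ≤V i)) small))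

          u≡∅ : u ≡ ∅
          u≡∅ = P.dim≡-1⇒≡∅ b≡-1

          wt-Meets≤ : wt (Meets u t ℓ r) ≤ (1# + B + B) * (π r * (wt (Fatᵢ ℓ) + wt (Fatᵢ r)))
          wt-Meets≤ =
            let (α , β , 0≤β , α≤ , β≤ , exp) = global-exp t ℓ r p′
                (r≤ℓ , ℓ≤n) = r≤ℓ≤n p
            in expander-bound 0≤β (vertices-nonNeg Fat λ x _ → 0≤w x) (π-pos r)
                 (vertices≤ Fat λ x _ → 0≤w x)
                 (≤-trans (*-monoʳ-≤ (wt-nonNeg (Fatᵢ ℓ)) (π-mono r≤ℓ ℓ≤n)) (thin-∅ ℓ))
                 (thin-∅ r) α≤
                 (≤-respˡ (*-assoc _ _ _) (x/z≤y 0<B′ (≤-respʳ (solve 3 (λ b′ b q → b′ :* b :* q := b :* q :* b′) refl B′ B (π r * π r)) β≤)))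
                 (≤-trans (edges≥ Fat (λ x _ → 0≤w x) (Meets u t ℓ r) (λ x _ → 0≤w x)
                   λ { x (dx , _ , y , z , fy , fz , y⊑x , z⊑x , inf , y≢z) →
                       dx , y , z , fy , fz , y⊑x , z⊑x , subst (_∈ₚ Inf₂ y z) u≡∅ inf , y≢z }) (exp (λ x → Fat (value x)))) 0≤B

          -- Brings the bound at ∅ into the form common to all u; the factor C of `E` is spent here.
          toLwt : ∀ i → wt (Fatᵢ i) ≤ C * (w u * lwtFat u i)
          toLwt i = ≤-trans (wt-mono λ x f → subst (_⊑ x) (≡-sym u≡∅) (∅-min x) , f) (wt≤C*w*lwt u (Fatᵢ i) (Fatᵢ⇒≤k+2 i))

        few-global : wt (Meets u t ℓ r) ≤ E * (π r * (w u * (lwtFat u ℓ + lwtFat u r)))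
        few-global = begin
          wt (Meets u t ℓ r)  ≤⟨ wt-Meets≤ ⟩
          (1# + B + B) * (π r * (wt (Fatᵢ ℓ) + wt (Fatᵢ r)))  ≤⟨ *-monoʳ-≤ 0≤1+2B (*-monoʳ-≤ (0≤π r) (+-mono-≤ (toLwt ℓ) (toLwt r))) ⟩
          (1# + B + B) * (π r * (C * (w u * lwtFat u ℓ) + C * (w u * lwtFat u r)))
            ≈⟨ solve 6 (λ c w e p a b → e :* (p :* (c :* (w :* a) :+ c :* (w :* b))) := c :* e :* (p :* (w :* (a :+ b))))
                 refl C (w u) (1# + B + B) (π r) (lwtFat u ℓ) (lwtFat u r) ⟩
          E * (π r * (w u * (lwtFat u ℓ + lwtFat u r)))  ∎

    fewMeets : LinkExpander → GlobalExpander → B′ * V n ≤ π -1ℤ → FewMeets E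
    fewMeets link-exp global-exp small {u = u} p ¬f with dim u ℤ.≟ -1ℤ
    ... | yes b≡-1 = few-global p global-exp b≡-1 small
    ... | no b≢-1  = few-local p link-exp (ℤ.≤∧≢⇒< (P.-1≤dim u) (b≢-1 ∘ ≡-sym)) ¬f

  -- Weights against uniform counting

  module Counting (j : ℤ) (-1≤j : -1ℤ ℤ.≤ j) (j≤k+2 : j ℤ.≤ K+2) (M : |ℝ|) (0<M : 0# < M)
    (w≤M*w : ∀ (x y : Face j) → w (value x) ≤ M * w (value y)) where

    weight : Face j → |ℝ|
    weight x = w (value x)

    N : |ℝ|
    N = fromℕ (length (faces j))

    ∑-faces : ∑ (faces j) weight ≈ 1#
    ∑-faces = trans (∑-collect (λ x → dim x ℤ.≟ j) elements (λ x dx → sym (mask-yes dx)) (λ x ¬dx → mask-no ¬dx))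
                    (wt-dim -1≤j j≤k+2)

    someFace : Face j
    someFace =
      let (x , _ , _ , dx) = P.interpolate {∅} {value (proj₁ (topFace ∅))} (∅-min _) (subst (ℤ._≤ j) (≡-sym ∅-dim) -1≤j)
                               (subst (j ℤ.≤_) (≡-sym (P.face-dim (proj₁ (topFace ∅)))) (≤k+2⇒≤d j≤k+2))
      in x , [ dx ]

    0<N : 0# < N
    0<N = <-≤-trans 0<1 (≤-respʳ (∑-1 (faces j)) (term≤∑ {f = λ _ → 1#} (faces j) (λ _ → 0≤1) (P.face∈ someFace)))

    1≤M : 1# ≤ M
    1≤M = *-cancelʳ-≤ (w-pos (value someFace)) (≤-respˡ (sym (*-identityˡ _)) (w≤M*w someFace someFace))

    -- The weights of the N faces sum to 1 and differ by factors of at most M, so each is within a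
    -- factor M of 1 / N.
    N*w≤M : ∀ x → N * weight x ≤ M
    N*w≤M x = begin
      N * weight x  ≈⟨ ∑-const (weight x) (faces j) ⟨
      ∑ (faces j) (λ _ → weight x)  ≤⟨ ∑-mono (faces j) (w≤M*w x) ⟩
      ∑ (faces j) (λ y → M * weight y)  ≈⟨ ∑-*ˡ M weight (faces j) ⟨
      M * ∑ (faces j) weight  ≈⟨ trans (*-congˡ ∑-faces) (*-identityʳ M) ⟩
      M  ∎

    1≤M*N*w : ∀ x → 1# ≤ M * (N * weight x)
    1≤M*N*w x = begin
      1#  ≈⟨ ∑-faces ⟨
      ∑ (faces j) weight  ≤⟨ ∑-mono (faces j) (λ y → w≤M*w y x) ⟩
      ∑ (faces j) (λ _ → M * weight x)  ≈⟨ ∑-const _ (faces j) ⟩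
      N * (M * weight x)  ≈⟨ solve 3 (λ n m w → n :* (m :* w) := m :* (n :* w)) refl N M (weight x) ⟩
      M * (N * weight x)  ∎

    module _ (xs : List (Face j)) where

      proportion≤weight : fromℕ (length xs) / N ≤ M * ∑ xs weight
      proportion≤weight = x/z≤y 0<N (begin
        fromℕ (length xs)  ≈⟨ ∑-1 xs ⟨
        ∑ xs (λ _ → 1#)  ≤⟨ ∑-mono xs 1≤M*N*w ⟩
        ∑ xs (λ x → M * (N * weight x))  ≈⟨ trans (*-congˡ (∑-*ˡ N weight xs)) (∑-*ˡ M _ xs) ⟨
        M * (N * ∑ xs weight)  ≈⟨ solve 3 (λ n m w → m :* (n :* w) := m :* w :* n) refl N M (∑ xs weight) ⟩
        M * ∑ xs weight * N  ∎)

      weight≤proportion : ∑ xs weight ≤ M * (fromℕ (length xs) / N)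
      weight≤proportion = *-cancelʳ-≤ 0<N (begin
        ∑ xs weight * N  ≈⟨ trans (*-comm _ _) (∑-*ˡ N weight xs) ⟩
        ∑ xs (λ x → N * weight x)  ≤⟨ ∑-bound xs N*w≤M ⟩
        fromℕ (length xs) * M  ≈⟨ trans (*-comm _ _) (*-congˡ (sym (x/y*y≈x 0<N))) ⟩
        M * (fromℕ (length xs) / N * N)  ≈⟨ *-assoc _ _ _ ⟨
        M * (fromℕ (length xs) / N) * N  ∎)

    proportion-nonNeg : ∀ (xs : List (Face j)) → 0# ≤ fromℕ (length xs) / N
    proportion-nonNeg xs = *-nonNeg (fromℕ-nonNeg (length xs)) (proj₁ (⁻¹-pos 0<N))

    proportion≤1 : ∀ {p} (P : Pred (Face j) p) → fromℕ (length (subset (faces j) P)) / N ≤ 1#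
    proportion≤1 P = x/z≤y 0<N (≤-respʳ (sym (*-identityˡ N)) (fromℕ-mono (length-filter (λ x → lem {P = P x}) (faces j))))

  module Cocycles {r ℓr m ℓm} {R : CommutativeRing r ℓr}
    (o : Carrier → Carrier → CommutativeRing.Carrier R) (ℱ : Sheaf R X m ℓm) where
    module Cₓ = Cochains X o ℱ
    module Eₓ = Expansion X w o ℱ
    module _ (u : Carrier) where
      module Xᵤ = GradedPoset (link X u)
      module Cᵤ = Cochains (link X u) (linkOrientation {R = R} X u o) (linkSheaf X u ℱ)
      module Eᵤ = Expansion (link X u) (linkWeight d X u w)
                    (linkOrientation {R = R} X u o) (linkSheaf X u ℱ)
      module CBᵤ = CoboundaryExpansion lem ℝ (link X u) (linkWeight d X u w)
                    (linkOrientation {R = R} X u o) (linkSheaf X u ℱ)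

    supp : ∀ {i} → Cₓ.C i → Pred Carrier ℓm
    supp {i} f x = Σ[ dx ∈ dim x ≡ i ] Cₓ.Supp f (x , [ dx ])

    norm-wt : ∀ {i} (f : Cₓ.C i) → Eₓ.‖ f ‖ ≈ wt (supp f)
    norm-wt {i} f = trans (∑-subset _ (faces i)) (∑-mask-collect (λ x → dim x ℤ.≟ i) w elements)

    norm-nonNeg : ∀ {i} (f : Cₓ.C i) → 0# ≤ Eₓ.‖ f ‖
    norm-nonNeg f = ≤-respʳ (sym (norm-wt f)) (wt-nonNeg (supp f))

    norm-mono : ∀ {i} {f g : Cₓ.C i} → (∀ x → Cₓ.Supp f x → Cₓ.Supp g x) → Eₓ.‖ f ‖ ≤ Eₓ.‖ g ‖
    norm-mono {f = f} {g} f⇒g = ≤-respˡ (sym (norm-wt f)) (≤-respʳ (sym (norm-wt g)) (wt-mono λ x (dx , s) → dx , f⇒g _ s))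

    norm-cong : ∀ {i} {f g : Cₓ.C i} → f Cₓ.≈ᶜ g → Eₓ.‖ f ‖ ≈ Eₓ.‖ g ‖
    norm-cong e = antisym (norm-mono λ x s z → s (Cₓ.𝓕.≈ᴹ-trans (value x) (e x) z))
                          (norm-mono λ x s z → s (Cₓ.𝓕.≈ᴹ-trans (value x) (Cₓ.𝓕.≈ᴹ-sym (value x) (e x)) z))

    norm≤0⇒≈0 : ∀ {i} (f : Cₓ.C i) → Eₓ.‖ f ‖ ≤ 0# → f Cₓ.≈ᶜ Cₓ.0ᶜ
    norm≤0⇒≈0 f p x = decidable-stable lem λ s →
      <⇒≱ (w-pos (value x)) (≤-trans (≤-respʳ (sym (norm-wt f)) (w≤wt (value x) (P.face-dim x , s))) p)

    lsupp : ∀ u {i} → Cᵤ.C u i → Pred Carrier ℓm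
    lsupp u {i} g x = Σ[ u⊑x ∈ u ⊑ x ] Σ[ e ∈ dim x ℤ.- dim u ℤ.- 1ℤ ≡ i ] Cᵤ.Supp u g ((x , [ u⊑x ]) , [ e ])

    lnorm-lwt : ∀ u {i} (g : Cᵤ.C u i) → Eᵤ.‖_‖ u g ≈ lwt u (lsupp u g)
    lnorm-lwt u {i} g = trans (∑-subset _ (Xᵤ.faces u i))
      (trans (∑-mask-collect (λ x → Xᵤ.dim u x ℤ.≟ i) (λ x → wˡ u (value x)) (Xᵤ.elements u))
      (trans (∑-mask-collect (u ≤?_) (wˡ u) elements)
        (∑-cong elements λ x → mask-cong (λ s → proj₁ s , s) proj₂ (λ _ → refl))))

    lsupp-dim : ∀ u {j} (g : Cᵤ.C u (j ℤ.- dim u ℤ.- 1ℤ)) x → lsupp u g x → dim x ≡ j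
    lsupp-dim u g x (_ , e , _) = codim-cancel X o ℱ u e

    lsupp-dim-suc : ∀ u {j} (g : Cᵤ.C u (ℤ.suc (j ℤ.- dim u ℤ.- 1ℤ))) x → lsupp u g x → dim x ≡ ℤ.suc j
    lsupp-dim-suc u {j} g x (_ , e , _) = codim-suc X o ℱ u {j = j} e

    -- The cochains b range over the coboundaries of the link, the set from which its expansion
    -- measures distance. The defect q w(u) is what the loop condition of the Correction Algorithm
    -- leaves uncorrected.
    LocallyMinimal : ∀ n → |ℝ| → Cₓ.C (+ n) → Set (m ⊔ ℓm)
    LocallyMinimal n q h = ∀ u → 0ℤ ℤ.≤ dim u → dim u ℤ.≤ + n → ∀ b → Cᵤ.B u (+ n ℤ.- dim u ℤ.- 1ℤ) b →
      Eₓ.‖ h ‖ ≤ Eₓ.‖ h Cₓ.-ᶜ extendByZero X o ℱ u (+ n) b ‖ + q * w u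

    -- Locally minimal cocycles

    module LocalToGlobal (𝓓 : FatData) where
      open FatData 𝓓
      open AbstractIntersectionProfile 𝓘
      open Fatness 𝓓

      module _ (h : Cₓ.C (+ n)) (A⇒supp : ∀ x → A x → supp h x) (supp⇒A : ∀ x → supp h x → A x) where

        norm≈wtA : Eₓ.‖ h ‖ ≈ wt A
        norm≈wtA = trans (norm-wt h) (antisym (wt-mono supp⇒A) (wt-mono A⇒supp))

        module _ (u : Carrier) where
          private
            i : ℤ
            i = + n ℤ.- dim u ℤ.- 1ℤ

          Descends : Pred Carrier 0ℓ
          Descends y = A y × Star _⇒_ y u

          Descends⇒⊒ : ∀ {y} → Descends y → u ⊑ y
          Descends⇒⊒ (_ , s) = ⇒*⇒⊒ s

          restrict : (x : Xᵤ.Face u i) → Dec (Descends (value (value x))) → Cₓ.𝓕.Carrierᴹ (value (value x))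
          restrict x (yes _) = h (fromLink X o ℱ u x)
          restrict x (no _)  = Cₓ.𝓕.0ᴹ (value (value x))

          hᵤ : Cᵤ.C u i
          hᵤ x = restrict x lem

          restrict-yes : ∀ x (δ : Dec (Descends (value (value x)))) → Descends (value (value x)) →
                         Cₓ.𝓕._≈ᴹ_ (value (value x)) (restrict x δ) (h (fromLink X o ℱ u x))
          restrict-yes x (yes _) _ = Cₓ.𝓕.≈ᴹ-refl (value (value x))
          restrict-yes x (no ¬λ) l = contradiction l ¬λ

          restrict-no : ∀ x (δ : Dec (Descends (value (value x)))) → ¬ Descends (value (value x)) →
                        Cₓ.𝓕._≈ᴹ_ (value (value x)) (restrict x δ) (Cₓ.𝓕.0ᴹ (value (value x)))
          restrict-no x (yes l) ¬λ = contradiction l ¬λ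
          restrict-no x (no _)  _  = Cₓ.𝓕.≈ᴹ-refl (value (value x))

          -- If z is clean, all of the support of h below z descends to u as soon as one face
          -- does, so that dhᵤ agrees with dh at z.
          d-restrict⇒Contaminated : Cₓ.d h Cₓ.≈ᶜ Cₓ.0ᶜ → Terminal u →
            ∀ x → lsupp u (Cᵤ.d u hᵤ) x → Contaminated x
          d-restrict⇒Contaminated dh≈0 ter v sv@(u⊑v , e , dhᵤ≉0) = decidable-stable lem λ clean →
            case lem {P = ∃[ y ] y ⊑ v × Descends y} of λ
              { (no none) → dhᵤ≉0 (Cᵤ.d-local u hᵤ ((v , [ u⊑v ]) , [ e ]) λ x dx x⊑v →
                  restrict-no (x , [ dx ]) lem λ l → none (value x , x⊑v , l))
              ; (yes (y , y⊑v , ay , y⇒*u)) →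
                  let all : ∀ x → x ⊑ v → A x → Descends x
                      all x x⊑v ax =
                        let (t , x⇒*t , ter-t) = terminal-exists x
                        in ax , subst (Star _⇒_ x) (terminal-unique v dv clean ax ay x⊑v y⊑v x⇒*t y⇒*u ter-t ter) x⇒*t
                  in dhᵤ≉0 (Cₓ.𝓕.≈ᴹ-trans v (Cₓ.𝓕.≈ᴹ-sym v (link-d X o ℱ u h hᵤ v u⊑v dv
                       (λ x u⊑x x⊑v → agree x u⊑x (all (value x) x⊑v) lem)
                       (λ x u⋢x x⊑v → vanish x λ ax → u⋢x (Descends⇒⊒ (all (value x) x⊑v ax)))))
                       (dh≈0 (v , [ dv ]))) }
            where
            dv : dim v ≡ + suc n
            dv = lsupp-dim-suc u {j = + n} (Cᵤ.d u hᵤ) v sv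
            vanish : ∀ x → ¬ A (value x) → Cₓ.𝓕._≈ᴹ_ (value x) (h x) (Cₓ.𝓕.0ᴹ (value x))
            vanish x ¬a = decidable-stable lem λ s → ¬a (supp⇒A (value x) (P.face-dim x , s))
            agree : ∀ x (u⊑x : u ⊑ value x) → (A (value x) → Descends (value x)) → Dec (A (value x)) →
                    Cₓ.𝓕._≈ᴹ_ (value x) (h x) (hᵤ (toLink X o ℱ u x u⊑x))
            agree x u⊑x a⇒l (yes a) = Cₓ.𝓕.≈ᴹ-sym (value x) (restrict-yes (toLink X o ℱ u x u⊑x) lem (a⇒l a))
            agree x u⊑x a⇒l (no ¬a) = Cₓ.𝓕.≈ᴹ-trans (value x) (vanish x ¬a)
              (Cₓ.𝓕.≈ᴹ-sym (value x) (restrict-no (toLink X o ℱ u x u⊑x) lem (λ l → ¬a (proj₁ l))))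

          module _ (b : Cᵤ.C u i) where
            private
              bᵘ : Cₓ.C (+ n)
              bᵘ = extendByZero X o ℱ u (+ n) b

            -- Above u, h and hᵤ agree except where h is nonzero and the face does not descend to u;
            -- the first alternative absorbs those faces, whatever b is there.
            supp-change : ∀ x → supp (h Cₓ.-ᶜ bᵘ) x →
                          (A x × ¬ Descends x) ⊎ (u ⊑ x × lsupp u (Cᵤ._-ᶜ_ u hᵤ b) x)
            supp-change x (dx , s) = go (lem {P = Descends x}) (u ≤? x) lem
              where
              X̂ = (x , [ dx ])
              A-of : Cₓ.Supp h X̂ → A x
              A-of s = supp⇒A x (dx , s)
              e : dim x ℤ.- dim u ℤ.- 1ℤ ≡ i
              e = cong (λ j → j ℤ.- dim u ℤ.- 1ℤ) dx
              go : Dec (Descends x) → Dec (u ⊑ x) → Dec (Cₓ.Supp h X̂) →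
                   (A x × ¬ Descends x) ⊎ (u ⊑ x × lsupp u (Cᵤ._-ᶜ_ u hᵤ b) x)
              go (yes l) _ _ = inj₂ (Descends⇒⊒ l , Descends⇒⊒ l , e , λ z → s (Cₓ.𝓕.≈ᴹ-trans x
                (Cₓ.𝓕.+ᴹ-cong x (Cₓ.𝓕.≈ᴹ-sym x (restrict-yes (toLink X o ℱ u X̂ (Descends⇒⊒ l)) lem l))
                                (Cₓ.𝓕.-ᴹ‿cong x (extend-above X o ℱ u b X̂ (Descends⇒⊒ l)))) z))
              go (no ¬l) _ (yes sh) = inj₁ (A-of sh , ¬l)
              go (no ¬l) (no u⋢x) (no ¬sh) = contradiction (Cₓ.𝓕.≈ᴹ-trans x
                (Cₓ.𝓕.+ᴹ-cong x (decidable-stable lem ¬sh) (Cₓ.𝓕.-ᴹ‿cong x (extend-outside X o ℱ u b X̂ u⋢x)))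
                (Cₓ.𝓕.-ᴹ‿inverseʳ x _)) s
              go (no ¬l) (yes u⊑x) (no ¬sh) = inj₂ (u⊑x , u⊑x , e , λ z → s (Cₓ.𝓕.≈ᴹ-trans x
                (Cₓ.𝓕.+ᴹ-cong x
                  (Cₓ.𝓕.≈ᴹ-trans x (decidable-stable lem ¬sh) (Cₓ.𝓕.≈ᴹ-sym x (restrict-no (toLink X o ℱ u X̂ u⊑x) lem ¬l)))
                  (Cₓ.𝓕.-ᴹ‿cong x (extend-above X o ℱ u b X̂ u⊑x))) z))

            -- Faces of A that do not descend to u occur on both sides of the minimality inequality
            -- and cancel.
            wt-Descends≤ : ∀ {q} → Eₓ.‖ h ‖ ≤ Eₓ.‖ h Cₓ.-ᶜ bᵘ ‖ + q * w u →
                           wt Descends ≤ C * (w u * Eᵤ.‖_‖ u (Cᵤ._-ᶜ_ u hᵤ b)) + q * w u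
            wt-Descends≤ {q} minimal = +-cancelʳ-≤ (wt rest) (begin
              wt Descends + wt rest  ≤⟨ +-monoˡ-≤ (wt rest) (wt-mono λ x l → proj₁ l , l) ⟩
              wt (λ x → A x × Descends x) + wt rest  ≈⟨ trans norm≈wtA (wt-split A Descends) ⟨
              Eₓ.‖ h ‖  ≤⟨ minimal ⟩
              Eₓ.‖ h Cₓ.-ᶜ bᵘ ‖ + q * w u  ≤⟨ +-monoˡ-≤ _ (≤-respˡ (sym (norm-wt _)) (wt-⊎ supp-change)) ⟩
              (wt rest + wt (λ x → u ⊑ x × lsupp u c x)) + q * w u  ≤⟨ +-monoˡ-≤ _ (+-monoʳ-≤ (wt rest)
                (wt≤C*w*lwt u (lsupp u c) λ x s → subst (ℤ._≤ K+2) (≡-sym (lsupp-dim u c x s)) n≤K+2)) ⟩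
              (wt rest + C * (w u * lwt u (lsupp u c))) + q * w u  ≈⟨ +-congʳ (+-congˡ (*-congˡ (*-congˡ (lnorm-lwt u c)))) ⟨
              (wt rest + C * (w u * Eᵤ.‖_‖ u c)) + q * w u  ≈⟨ solve 3 (λ r a b → (r :+ a) :+ b := (a :+ b) :+ r) refl (wt rest) _ (q * w u) ⟩
              (C * (w u * Eᵤ.‖_‖ u c) + q * w u) + wt rest  ∎)
              where
              rest : Pred Carrier 0ℓ
              rest x = A x × ¬ Descends x
              c : Cᵤ.C u i
              c = Cᵤ._-ᶜ_ u hᵤ b

          lnorm-nonNeg : ∀ (c : Cᵤ.C u i) → 0# ≤ Eᵤ.‖_‖ u c
          lnorm-nonNeg c = ≤-respʳ (sym (lnorm-lwt u c)) (lwt-nonNeg u (lsupp u c) λ x s →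
            subst (ℤ._≤ K+2) (≡-sym (lsupp-dim u c x s)) n≤K+2)

          lnorm-suc : ∀ (c : Cᵤ.C u (ℤ.suc i)) x → lsupp u c x → dim x ℤ.≤ K+2
          lnorm-suc c x s = subst (ℤ._≤ K+2) (≡-sym (lsupp-dim-suc u {j = + n} c x s)) sn≤K+2

          local-estimate : ∀ {q η} → 0# ≤ q → 0# ≤ η → LocallyMinimal n q h → Cₓ.d h Cₓ.≈ᶜ Cₓ.0ᶜ →
                           0ℤ ℤ.≤ dim u → dim u ℤ.≤ + n → Terminal u → Eᵤ._≤cbe_ u η i →
                           η * wt Descends ≤ C * (C * wt (λ x → u ⊑ x × Contaminated x)) + η * (q * w u)
          local-estimate {q} {η} 0≤q 0≤η minimal dh≈0 0≤du du≤n ter cbe = begin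
            η * wt Descends  ≤⟨ *-monoʳ-≤ 0≤η W≤ ⟩
            η * (C * (w u * δ) + q * w u)  ≈⟨ solve 5 (λ e c w d q → e :* (c :* (w :* d) :+ q) := c :* (w :* (e :* d)) :+ e :* q)
                        refl η C (w u) δ (q * w u) ⟩
            C * (w u * (η * δ)) + η * (q * w u)  ≤⟨ +-monoˡ-≤ _ (*-monoʳ-≤ 0≤C (*-monoʳ-≤ (0≤w u) expansion)) ⟩
            C * (w u * lwt u (lsupp u dhᵤ)) + η * (q * w u)  ≤⟨ +-monoˡ-≤ _ (*-monoʳ-≤ 0≤C (≤-trans
              (w*lwt≤C*wt u (lsupp u dhᵤ) (lnorm-suc dhᵤ))
              (*-monoʳ-≤ 0≤C (wt-mono λ x (u⊑x , s) → u⊑x , d-restrict⇒Contaminated dh≈0 ter x s)))) ⟩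
            C * (C * wt (λ x → u ⊑ x × Contaminated x)) + η * (q * w u)  ∎
            where
            δ : |ℝ|
            δ = Eᵤ.dist u hᵤ (Cᵤ.B u i)
            dhᵤ : Cᵤ.C u (ℤ.suc i)
            dhᵤ = Cᵤ.d u hᵤ
            Cw>0 : 0# < C * w u
            Cw>0 = *-pos (<-≤-trans 0<1 1≤C) (w-pos u)
            -- `wt-Descends≤` solved for the norm of hᵤ - b: the result does not depend on b, hence
            -- it is a lower bound for the infimum `δ`.
            base : |ℝ|
            base = (wt Descends + - (q * w u)) / (C * w u)
            base*Cw : base * (C * w u) + q * w u ≈ wt Descends
            base*Cw = trans (+-congʳ (x/y*y≈x Cw>0)) (x-y+y≈x _ _)
            base≤δ : base ≤ δ
            base≤δ = CBᵤ.dist-≤ u (Cᵤ.0ᶜ u , CBᵤ.B-0 u) λ b bB → x/z≤y Cw>0 (+-cancelʳ-≤ (q * w u)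
              (≤-respˡ (sym (x-y+y≈x _ _)) (≤-respʳ (+-congʳ (solve 3 (λ c w s → c :* (w :* s) := s :* (c :* w)) refl C (w u) _))
                (wt-Descends≤ b (minimal u 0≤du du≤n b bB)))))
            W≤ : wt Descends ≤ C * (w u * δ) + q * w u
            W≤ = ≤-respˡ base*Cw (+-monoˡ-≤ _ (≤-respʳ (solve 3 (λ c w s → s :* (c :* w) := c :* (w :* s)) refl C (w u) δ)
              (*-monoˡ-≤ (proj₁ Cw>0) base≤δ)))
            expansion : η * δ ≤ lwt u (lsupp u dhᵤ)
            expansion = ≤-respʳ (lnorm-lwt u dhᵤ) (CBᵤ.cbe-bound u hᵤ 0≤η
              (≤-respʳ (sym (lnorm-lwt u dhᵤ)) (lwt-nonNeg u (lsupp u dhᵤ) (lnorm-suc dhᵤ))) (λ g → lnorm-nonNeg _) cbe)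

        module _ {q η : |ℝ|} (0≤q : 0# ≤ q) (0≤η : 0# ≤ η) (minimal : LocallyMinimal n q h) (dh≈0 : Cₓ.d h Cₓ.≈ᶜ Cₓ.0ᶜ)
                 (cbe : ∀ u → 0ℤ ℤ.≤ dim u → dim u ℤ.≤ + n → Eᵤ._≤cbe_ u η (+ n ℤ.- dim u ℤ.- 1ℤ)) where

          -- Each face of A reaches at least one terminal fat face, possibly several, so the sets
          -- `Descends u` cover A; `∑-up` pays for a contaminated face being counted once for each u
          -- below it.
          global-estimate : η * wt A ≤ C * (C * (Φ * wt Contaminated)) + η * (q * wt Fat)
          global-estimate = begin
            η * wt A
              ≤⟨ *-monoʳ-≤ 0≤η (∑-mono elements λ y → mask≤ (∑-nonNeg elements (0≤term y)) (cover y)) ⟩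
            η * ∑ elements (λ y → ∑ elements (λ u → term u y))
              ≈⟨ *-congˡ (∑-swap _ elements elements) ⟩
            η * ∑ elements (λ u → ∑ elements (λ y → term u y))
              ≈⟨ trans (∑-*ˡ η _ elements) (∑-cong elements λ u → trans (*-congˡ (sym (mask-∑ _ elements))) (mask-* η)) ⟩
            ∑ elements (λ u → mask (T u) (η * wt (Descends u)))
              ≤⟨ ∑-mono elements (λ u → mask≤ (+-nonNeg (0≤con u) (mask-nonNeg λ _ → *-nonNeg 0≤η (*-nonNeg 0≤q (0≤w u)))) λ (f , ter) →
                   ≤-respʳ (+-congˡ (sym (mask-yes f)))
                     (local-estimate u 0≤q 0≤η minimal dh≈0 (Fat-0≤dim f) (Fat-dim≤n f) ter (cbe u (Fat-0≤dim f) (Fat-dim≤n f)))) ⟩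
            ∑ elements (λ u → C * (C * wt (λ x → u ⊑ x × Contaminated x)) + mask (Fat u) (η * (q * w u)))
              ≈⟨ ∑-+ _ _ elements ⟩
            ∑ elements (λ u → C * (C * wt (λ x → u ⊑ x × Contaminated x))) + ∑ elements (λ u → mask (Fat u) (η * (q * w u)))
              ≈⟨ +-cong (trans (*-congˡ (∑-*ˡ C _ elements)) (∑-*ˡ C _ elements))
                        (trans (*-congˡ (∑-*ˡ q _ elements)) (trans (∑-*ˡ η _ elements)
                          (∑-cong elements λ u → trans (*-congˡ (mask-* q)) (mask-* η)))) ⟨
            C * (C * ∑ elements (λ u → wt (λ x → u ⊑ x × Contaminated x))) + η * (q * wt Fat)
              ≤⟨ +-monoˡ-≤ _ (*-monoʳ-≤ 0≤C (*-monoʳ-≤ 0≤C (∑-up Contaminated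
                   (λ z (dz , _) → subst (ℤ._≤ K+2) (≡-sym dz) sn≤K+2) w 0≤w))) ⟩
            C * (C * (Φ * wt Contaminated)) + η * (q * wt Fat) ∎
            where
            T : Pred Carrier 0ℓ
            T u = Fat u × Terminal u
            term : Carrier → Carrier → |ℝ|
            term u y = mask (T u) (mask (Descends u y) (w y))
            0≤term : ∀ y u → 0# ≤ term u y
            0≤term y u = mask-nonNeg λ _ → mask-nonNeg λ _ → 0≤w y
            0≤con : ∀ u → 0# ≤ C * (C * wt (λ x → u ⊑ x × Contaminated x))
            0≤con u = *-nonNeg 0≤C (*-nonNeg 0≤C (wt-nonNeg _))
            cover : ∀ y → A y → w y ≤ ∑ elements (λ u → term u y)
            cover y ay =
              let (u , y⇒*u , ter) = terminal-exists y
              in ≤-respˡ (trans (mask-yes (⇒*-Fat (A⇒Fat ay) y⇒*u , ter)) (mask-yes (ay , y⇒*u)))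
                   (term≤∑ elements (0≤term y) (elements-complete u))

          module _ (E : |ℝ|) (0≤E : 0# ≤ E) (fewMeets : FewMeets E) (K : |ℝ|) (0≤K : 0# ≤ K) (πn≈Kη : π (+ n) ≈ K * η)
                   (qπ≤Kπ : q * π (+ n) ≤ K * π 0ℤ) where

            V≤Γ : V n ≤ Γ * (π (+ n) * wt A)
            V≤Γ = ≤-trans (V≤ n) (*-monoˡ-≤ (*-nonNeg (0≤π (+ n)) (wt-nonNeg A)) (^-mono-exp 1≤γ n≤k+1))

            -- Each fat face u contributes at least π 0 w(u) to the potential, so the defects q w(u)
            -- add up to at most q / π 0 times the potential.
            q*wtFat≤ : q * wt Fat ≤ K * (Γ * wt A)
            q*wtFat≤ = *-cancelʳ-≤ (π-pos (+ n)) (begin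
              q * wt Fat * π (+ n)  ≈⟨ solve 3 (λ q f p → q :* f :* p := q :* p :* f) refl q (wt Fat) (π (+ n)) ⟩
              q * π (+ n) * wt Fat  ≤⟨ *-monoˡ-≤ (wt-nonNeg Fat) qπ≤Kπ ⟩
              K * π 0ℤ * wt Fat  ≈⟨ *-assoc _ _ _ ⟩
              K * (π 0ℤ * wt Fat)  ≤⟨ *-monoʳ-≤ 0≤K (≤-trans Fat≤V V≤Γ) ⟩
              K * (Γ * (π (+ n) * wt A))  ≈⟨ solve 4 (λ k g p a → k :* (g :* (p :* a)) := k :* (g :* a) :* p) refl K Γ (π (+ n)) (wt A) ⟩
              K * (Γ * wt A) * π (+ n)  ∎)

            -- Both error terms carry the factor K η: the first since π n = K η, the second by
            -- `q*wtFat≤`. After cancelling η, wt A is at most half of itself.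
            wtA≤0 : 0# < η → totalLoss E * K ≤ ½ → wt A ≤ 0#
            wtA≤0 0<η small = ≤-½⇒≤0 (*-cancelˡ-≤ 0<η (begin
              η * wt A
                ≤⟨ global-estimate ⟩
              C * (C * (Φ * wt Contaminated)) + η * (q * wt Fat)
                ≤⟨ +-mono-≤ (*-monoʳ-≤ 0≤C (*-monoʳ-≤ 0≤C (*-monoʳ-≤ 0≤Φ (≤-trans (wt-Contaminated≤ E 0≤E fewMeets)
                     (*-monoʳ-≤ 0≤D (*-monoʳ-≤ 0≤D (*-monoʳ-≤ 0≤D (*-monoʳ-≤ 0≤C (*-monoʳ-≤ 0≤E
                       (+-mono-≤ CΦV≤ CΦV≤)))))))))) (*-monoʳ-≤ 0≤η q*wtFat≤) ⟩
              C * (C * (Φ * (D * (D * (D * (C * (E * (C * Φ * (Γ * (π (+ n) * wt A)) + C * Φ * (Γ * (π (+ n) * wt A)))))))))) + η * (K * (Γ * wt A))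
                ≈⟨ solve 8 (λ c f d e g p a t → c :* (c :* (f :* (d :* (d :* (d :* (c :* (e :* (c :* f :* (g :* (p :* a)) :+ c :* f :* (g :* (p :* a)))))))))) :+ t
                     := c :* (c :* (f :* (d :* (d :* (d :* (c :* (e :* (c :* f :* g :+ c :* f :* g)))))))) :* (p :* a) :+ t)
                     refl C Φ D E Γ (π (+ n)) (wt A) (η * (K * (Γ * wt A))) ⟩
              C * (C * (Φ * (D * (D * (D * (C * (E * (C * Φ * Γ + C * Φ * Γ)))))))) * (π (+ n) * wt A) + η * (K * (Γ * wt A))
                ≈⟨ +-congʳ (*-congˡ (*-congʳ πn≈Kη)) ⟩
              C * (C * (Φ * (D * (D * (D * (C * (E * (C * Φ * Γ + C * Φ * Γ)))))))) * (K * η * wt A) + η * (K * (Γ * wt A))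
                ≈⟨ solve 5 (λ l g k e a → l :* (k :* e :* a) :+ e :* (k :* (g :* a)) := e :* ((l :+ g) :* k :* a)) refl _ Γ K η (wt A) ⟩
              η * (totalLoss E * K * wt A)
                ≤⟨ *-monoʳ-≤ 0≤η (*-monoˡ-≤ (wt-nonNeg A) small) ⟩
              η * (½ * wt A) ∎))
              where
              CΦV≤ : C * Φ * V n ≤ C * Φ * (Γ * (π (+ n) * wt A))
              CΦV≤ = *-monoʳ-≤ (*-nonNeg 0≤C 0≤Φ) V≤Γ

    -- The Correction Algorithm

    open Cₓ using (_+ᶜ_; _-ᶜ_; _≈ᶜ_; 0ᶜ; Supp) renaming (d to δ; C to Cochain)
    open Eₓ using (‖_‖; CorrectionStep)

    sk≤K+2 : + suc k ℤ.≤ K+2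
    sk≤K+2 = ℤ.+≤+ (subst (suc k ℕ.≤_) (ℕ.+-comm 2 k) (ℕ.n≤1+n (suc k)))

    k≤sk : + k ℤ.≤ + suc k
    k≤sk = ℤ.+≤+ (ℕ.n≤1+n k)

    norm-triangle : ∀ {i} (f g h : Cochain i) → ‖ f -ᶜ h ‖ ≤ ‖ f -ᶜ g ‖ + ‖ g -ᶜ h ‖
    norm-triangle f g h = ≤-respˡ (sym (norm-wt (f -ᶜ h))) (≤-respʳ (sym (+-cong (norm-wt (f -ᶜ g)) (norm-wt (g -ᶜ h))))
      (wt-⊎ λ x (dx , s) → split x dx s lem))
      where
      split : ∀ x dx → Cₓ.Supp (f -ᶜ h) (x , [ dx ]) → Dec (Cₓ.Supp (f -ᶜ g) (x , [ dx ])) → supp (f -ᶜ g) x ⊎ supp (g -ᶜ h) x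
      split x dx s (yes t) = inj₁ (dx , t)
      split x dx s (no ¬t) = inj₂ (dx , λ z → s (Cₓ.𝓕.≈ᴹ-trans x (Cₓ.𝓕.+ᴹ-congʳ x f≈g) z))
        where
        f≈g : Cₓ.𝓕._≈ᴹ_ x (f (x , [ dx ])) (g (x , [ dx ]))
        f≈g = Cₓ.𝓕.≈ᴹ-trans x (Cₓ.𝓕.≈ᴹ-sym x (Cₓ.-ᶜ-+ᶜ f g (x , [ dx ])))
          (Cₓ.𝓕.≈ᴹ-trans x (Cₓ.𝓕.+ᴹ-congʳ x (decidable-stable lem ¬t)) (Cₓ.𝓕.+ᴹ-identityˡ x _))

    norm-self : ∀ {i} (f : Cochain i) → ‖ f -ᶜ f ‖ ≤ 0#
    norm-self f = ≤-respˡ (sym (norm-wt (f -ᶜ f))) (≤-reflexive (∑-0 elements λ x → mask-no λ (dx , s) → s (Cₓ.𝓕.-ᴹ‿inverseʳ x _)))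

    -- The support of δ f lies above that of f, and the (k+1)-faces above x weigh at most C w(x).
    d-bounded : ∀ (f : Cochain (+ k)) → ‖ δ f ‖ ≤ C * ‖ f ‖
    d-bounded f = begin
      ‖ δ f ‖
        ≈⟨ norm-wt (δ f) ⟩
      wt (supp (δ f))
        ≤⟨ ∑-mono elements (λ z → mask≤ (∑-nonNeg elements (0≤term z)) λ s → cover z s) ⟩
      ∑ elements (λ z → ∑ elements (λ x → mask (supp f x) (mask (x ⊑ z × dim z ≡ + suc k) (w z))))
        ≈⟨ trans (∑-swap _ elements elements) (∑-cong elements λ x → sym (mask-∑ _ elements)) ⟩
      ∑ elements (λ x → mask (supp f x) (wt (λ z → x ⊑ z × dim z ≡ + suc k)))
        ≤⟨ ∑-mono elements (λ x → mask-mono id (λ _ → *-nonNeg 0≤C (0≤w x)) λ (dx , _) →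
             wt-star x (subst (ℤ._≤ + suc k) (≡-sym dx) k≤sk) sk≤K+2) ⟩
      ∑ elements (λ x → mask (supp f x) (C * w x))
        ≈⟨ trans (*-congˡ (norm-wt f)) (trans (∑-*ˡ C _ elements) (∑-cong elements λ x → mask-* C)) ⟨
      C * ‖ f ‖ ∎
      where
      0≤term : ∀ z x → 0# ≤ mask (supp f x) (mask (x ⊑ z × dim z ≡ + suc k) (w z))
      0≤term z x = mask-nonNeg λ _ → mask-nonNeg λ _ → 0≤w z
      face : ∀ z → supp (δ f) z → ∃[ x ] x ⊑ z × supp f x
      face z (dz , s) = decidable-stable lem λ none → s (Cₓ.d-local f (z , [ dz ]) λ x dx x⊑z →
        decidable-stable lem λ t → none (x , x⊑z , dx , t))
      cover : ∀ z → supp (δ f) z → w z ≤ ∑ elements (λ x → mask (supp f x) (mask (x ⊑ z × dim z ≡ + suc k) (w z)))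
      cover z s = let (x , x⊑z , t) = face z s in
        ≤-respˡ (trans (mask-yes t) (mask-yes (x⊑z , proj₁ s))) (term≤∑ elements (0≤term z) (elements-complete x))

    module _ {q : |ℝ|} (0<q : 0# < q) where
      private
        Step : Rel (Cochain (+ k)) (m ⊔ ℓm)
        Step = CorrectionStep k q

      step-‖d‖ : ∀ {f f′} (s : Step f f′) → ‖ δ f′ ‖ + q * w (proj₁ s) ≤ ‖ δ f ‖ × ‖ δ f′ ‖ < ‖ δ f ‖
      step-‖d‖ {f} {f′} (u , _ , _ , g , decrease , f′≈) = drop , <-≤-trans (x<x+y , x≉x+y) drop
        where
        gᵘ : Cochain (+ k)
        gᵘ = extendByZero X o ℱ u (+ k) g
        ‖df′‖ : ‖ δ f′ ‖ ≈ ‖ δ f +ᶜ δ gᵘ ‖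
        ‖df′‖ = norm-cong (Cₓ.≈ᶜ-trans (Cₓ.d-cong f′≈) (Cₓ.d-+ f gᵘ))
        drop : ‖ δ f′ ‖ + q * w u ≤ ‖ δ f ‖
        drop = ≤-trans (+-monoˡ-≤ _ (≤-trans (≤-reflexive ‖df′‖) (proj₁ decrease))) (≤-reflexive (x-y+y≈x _ _))
        0<qw : 0# < q * w u
        0<qw = *-pos 0<q (w-pos u)
        x<x+y : ‖ δ f′ ‖ ≤ ‖ δ f′ ‖ + q * w u
        x<x+y = x≤x+y (proj₁ 0<qw)
        x≉x+y : ‖ δ f′ ‖ ≉ ‖ δ f′ ‖ + q * w u
        x≉x+y e = <⇒≱ 0<qw (+-cancelʳ-≤ (‖ δ f′ ‖) (≤-respˡ (+-comm _ _) (≤-respʳ (sym (+-identityˡ _)) (≤-reflexive (sym e)))))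

      step-moves : ∀ {f f′} (s : Step f f′) → ‖ f′ -ᶜ f ‖ ≤ C * w (proj₁ s)
      step-moves {f} {f′} (u , _ , du≤k , g , _ , f′≈) = ≤-respˡ (sym (norm-wt (f′ -ᶜ f)))
        (≤-trans (wt-mono λ x (dx , s) → decidable-stable lem (λ u⋢x → s (unchanged x dx (λ u⊑x → u⋢x (u⊑x , dx)))) )
          (wt-star u du≤k (ℤ.≤-trans k≤sk sk≤K+2)))
        where
        gᵘ : Cochain (+ k)
        gᵘ = extendByZero X o ℱ u (+ k) g
        unchanged : ∀ x dx → ¬ (u ⊑ x) → Cₓ.𝓕._≈ᴹ_ x ((f′ -ᶜ f) (x , [ dx ])) (Cₓ.𝓕.0ᴹ x)
        unchanged x dx u⋢x = Cₓ.𝓕.≈ᴹ-trans x (Cₓ.𝓕.+ᴹ-congʳ x (Cₓ.𝓕.≈ᴹ-trans x (f′≈ (x , [ dx ]))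
          (Cₓ.𝓕.≈ᴹ-trans x (Cₓ.𝓕.+ᴹ-congˡ x (extend-outside X o ℱ u g (x , [ dx ]) u⋢x)) (Cₓ.𝓕.+ᴹ-identityʳ x _)))) (Cₓ.𝓕.-ᴹ‿inverseʳ x _)

      -- A step at u costs C w(u) in distance and pays q w(u) in ‖δ f‖. Keeping the term C ‖δ h‖
      -- makes the inequality telescope, and it also yields ‖δ h‖ ≤ ‖δ f‖.
      steps-bound : ∀ {f h} → Star Step f h → q * ‖ h -ᶜ f ‖ + C * ‖ δ h ‖ ≤ C * ‖ δ f ‖
      steps-bound {f} ε = ≤-respʳ (+-identityˡ _) (+-monoˡ-≤ _ (≤-respʳ (zeroʳ q) (*-monoʳ-≤ (proj₁ 0<q) (norm-self f))))
      steps-bound {f} {h} (_◅_ {j = f′} s rest) = begin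
        q * ‖ h -ᶜ f ‖ + C * ‖ δ h ‖  ≤⟨ +-monoˡ-≤ _ (*-monoʳ-≤ (proj₁ 0<q) (≤-trans (norm-triangle h f′ f) (+-monoʳ-≤ _ (step-moves s)))) ⟩
        q * (‖ h -ᶜ f′ ‖ + C * w u) + C * ‖ δ h ‖  ≈⟨ solve 5 (λ q x c w y → q :* (x :+ c :* w) :+ c :* y := (q :* x :+ c :* y) :+ c :* (q :* w))
                        refl q (‖ h -ᶜ f′ ‖) C (w u) (‖ δ h ‖) ⟩
        (q * ‖ h -ᶜ f′ ‖ + C * ‖ δ h ‖) + C * (q * w u)  ≤⟨ +-monoˡ-≤ _ (steps-bound rest) ⟩
        C * ‖ δ f′ ‖ + C * (q * w u)  ≈⟨ distribˡ C _ _ ⟨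
        C * (‖ δ f′ ‖ + q * w u)  ≤⟨ *-monoʳ-≤ 0≤C (proj₁ (step-‖d‖ s)) ⟩
        C * ‖ δ f ‖  ∎
        where u = proj₁ s

      -- The weight of a support takes finitely many values, so a strict decrease of the real number
      -- ‖δ f‖ is a strict decrease of its rank in ℕ.
      terminates : WellFounded (flip Step)
      terminates = WF.Subrelation.wellFounded
        (λ {f′} {f} s → rank-< (∑∈subsetSums (λ x → w (value x)) (λ x → lem {P = Cₓ.Supp (δ f′) x}) (faces (+ suc k))) (proj₂ (step-‖d‖ s)))
        (On.wellFounded (λ f → rank (subsetSums (λ x → w (value x)) (faces (+ suc k))) (‖ δ f ‖)) ℕ.<-wellFounded)

      normalForm-exists : ∀ f → ∃[ h ] Star Step f h × IsNormalForm Step h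
      normalForm-exists f = go (terminates f)
        where
        go : ∀ {f} → Acc (flip Step) f → ∃[ h ] Star Step f h × IsNormalForm Step h
        go {f} (acc rs) with lem {P = ∃ (Step f)}
        ... | no nf = f , ε , nf
        ... | yes (f′ , s) = let (h , steps , nf) = go (rs s) in h , s ◅ steps , nf

      -- For dim u ≤ k a violation would be a correction step at u. For dim u = k+1 no step exists,
      -- but b then comes from cochains of degree -2 in the link, where there are no faces, so b is
      -- zero.
      normalForm⇒LocallyMinimal : ∀ {h} → IsNormalForm Step h → LocallyMinimal (suc k) q (δ h)
      normalForm⇒LocallyMinimal {h} nf u 0≤du du≤sk b b∈B = by-dim (dim u ℤ.≤? + k)
        where
        bᵘ : Cochain (+ suc k)
        bᵘ = extendByZero X o ℱ u (+ suc k) b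
        by-dim : Dec (dim u ℤ.≤ + k) → ‖ δ h ‖ ≤ ‖ δ h -ᶜ bᵘ ‖ + q * w u
        by-dim (yes du≤k) =
          let (g , -b≈dg) = -ᶜ-as-d X o ℱ u {j = + k} ≡-refl b b∈B
              gᵘ = extendByZero X o ℱ u (+ k) g
              minimal = ≮⇒≥ λ decrease → nf (h +ᶜ gᵘ , u , 0≤du , du≤k , g , decrease , Cₓ.≈ᶜ-refl {f = h +ᶜ gᵘ})
          in ≤-respˡ (x-y+y≈x _ _) (+-monoˡ-≤ (q * w u) (≤-respʳ (norm-cong λ x → Cₓ.𝓕.+ᴹ-congˡ (value x) (Cₓ.𝓕.≈ᴹ-sym (value x) (-b≈dg x))) minimal))
        by-dim (no du≰k) = ≤-trans (≤-reflexive (sym (norm-cong (Cₓ.-ᶜ-zeroʳ {f = δ h} {g = bᵘ} bᵘ≈0)))) (x≤x+y (*-nonNeg (proj₁ 0<q) (0≤w u)))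
          where
          du≡sk : dim u ≡ + suc k
          du≡sk = ℤ.≤-antisym du≤sk (ℤ.i<j⇒suc[i]≤j (ℤ.≰⇒> du≰k))
          bottom : ∀ a → -1ℤ ℤ.+ (a ℤ.- a ℤ.- 1ℤ) ≡ ℤ.- + 2
          bottom = ℤ.solve-∀
          no-face : ∀ (x : Xᵤ.Carrier u) → Xᵤ.dim u x ≢ ℤ.pred (+ suc k ℤ.- dim u ℤ.- 1ℤ)
          no-face x e = contradiction (subst (-1ℤ ℤ.≤_) (≡-trans e (≡-trans (cong (λ a → ℤ.pred (a ℤ.- dim u ℤ.- 1ℤ)) (≡-sym du≡sk)) (bottom (dim u))))
            (PosetProperties.-1≤dim lem (link X u) x)) λ { (ℤ.-≤- ()) }
          bᵘ≈0 : bᵘ ≈ᶜ 0ᶜ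
          bᵘ≈0 x = cases (u ≤? value x)
            where
            cases : Dec (u ⊑ value x) → Cₓ.𝓕._≈ᴹ_ (value x) (bᵘ x) (Cₓ.𝓕.0ᴹ (value x))
            cases (no u⋢x)  = extend-outside X o ℱ u b x u⋢x
            cases (yes u⊑x) = Cₓ.𝓕.≈ᴹ-trans (value x) (extend-above X o ℱ u b x u⊑x) (Cₓ.𝓕.≈ᴹ-trans (value x)
              (proj₂ b∈B (toLink X o ℱ u x u⊑x)) (Cᵤ.d-local u (proj₁ b∈B) (Xᵤ.cast u (≡-sym (ℤ.suc-pred _)) (toLink X o ℱ u x u⊑x)) λ y dy _ → contradiction dy (no-face y)))

    -- Vanishing of small locally minimal cocycles

    module Vanishing
      (κ : |ℝ|) (0<κ : 0# < κ) (κ≤1 : κ ≤ 1#) (B B′ : |ℝ|) (0≤B : 0# ≤ B) (1≤B′ : 1# ≤ B′) where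
      open AbstractIntersectionProfile using (𝒫)

      -- The thresholds π: κ in dimension n, squared with each step down, hence κ^(2^n) in dimension
      -- 0 and κ^(2^(n+1)) in dimension -1.
      codimPower : ℕ → ℤ → |ℝ|
      codimPower n i = κ ^ (2^ (+ n ℤ.- i))

      LinkSkeletons GlobalSkeletons : ∀ {n} → AbstractIntersectionProfile n → Set₁
      LinkSkeletons 𝓘 = ∀ t ℓ r b → 𝒫 𝓘 (t , ℓ , r , b) → -1ℤ ℤ.< b → (u : Face b) →
        IsSkeletonExpander (linkNIH d X w (value u) ℓ r t)
          (κ ^ (2^ (+ k ℤ.+ 1ℤ ℤ.- r)))
          (B / κ ^ ((2^ (+ k ℤ.+ 1ℤ ℤ.- r)) ℕ.* ((2^ (r ℤ.- 1ℤ ℤ.- b)) ℕ.∸ 1)))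
      GlobalSkeletons 𝓘 = ∀ t ℓ r b → 𝒫 𝓘 (t , ℓ , r , b) → b ≡ -1ℤ →
        IsSkeletonExpander (NIH X w ℓ r t)
          (κ ^ (2^ (+ k ℤ.+ 1ℤ ℤ.- r)))
          ((B′ * B) / κ ^ ((2^ (+ k ℤ.+ 1ℤ ℤ.- r)) ℕ.* ((2^ r) ℕ.∸ 1)))

      module _ {n : ℕ} (k≤n : k ℕ.≤ n) (n≤k+1 : n ℕ.≤ k ℕ.+ 1) where

        π-antitone : ∀ {i j} → i ℤ.≤ j → j ℤ.≤ + n → codimPower n i ≤ codimPower n j
        π-antitone i≤j j≤n = ^-anti 0<κ κ≤1 (ℕ.^-monoʳ-≤ 2 (∣∣-mono (ℤ.i≤j⇒0≤j-i j≤n) (ℤ.+-monoʳ-≤ (+ n) (ℤ.neg-mono-≤ i≤j))))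

        π-top : codimPower n (+ n) ≈ κ
        π-top = trans (reflexive (cong (λ i → κ ^ (2^ i)) (ℤ.i≡j⇒i-j≡0 {+ n} ≡-refl))) (*-identityʳ κ)

        module _ {r b : ℤ} (r≤n : r ℤ.≤ + n) (b<r : b ℤ.< r) where

          -- The exponents are 2^(k+1-r) and 2^(n-r), compared through n ≤ k+1; for n = k+1 they
          -- coincide.
          α≤π : κ ^ (2^ (+ k ℤ.+ 1ℤ ℤ.- r)) ≤ codimPower n r
          α≤π = ^-anti 0<κ κ≤1 (ℕ.^-monoʳ-≤ 2 (codim≤ k≤n n≤k+1 r≤n b<r))

          -- Moving the denominator to the right leaves a comparison of exponents of κ ≤ 1, which is
          -- `2^-exponents`; for n = k the exponents coincide.
          β*π≤ : ∀ {B₀} → 0# ≤ B₀ →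
                 B₀ / κ ^ ((2^ (+ k ℤ.+ 1ℤ ℤ.- r)) ℕ.* ((2^ (r ℤ.- 1ℤ ℤ.- b)) ℕ.∸ 1)) * codimPower n b ≤
                 B₀ * (codimPower n r * codimPower n r)
          β*π≤ {B₀} 0≤B₀ = ≤-respˡ (solve 3 (λ a i p → a :* p :* i := a :* i :* p) refl B₀ ((κ ^ e) ⁻¹) (codimPower n b))
            (x/z≤y (^-pos e 0<κ) (begin
              B₀ * codimPower n b  ≤⟨ *-monoʳ-≤ 0≤B₀ (^-anti 0<κ κ≤1 exponents) ⟩
              B₀ * κ ^ (2^j ℕ.+ 2^j ℕ.+ e)  ≈⟨ *-congˡ (trans (^-homo-* κ (2^j ℕ.+ 2^j) e) (*-congʳ (^-homo-* κ 2^j 2^j))) ⟩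
              B₀ * (codimPower n r * codimPower n r * κ ^ e)  ≈⟨ *-assoc _ _ _ ⟨
              B₀ * (codimPower n r * codimPower n r) * κ ^ e  ∎))
            where
            2^j e : ℕ
            2^j = 2^ (+ n ℤ.- r)
            e = (2^ (+ k ℤ.+ 1ℤ ℤ.- r)) ℕ.* ((2^ (r ℤ.- 1ℤ ℤ.- b)) ℕ.∸ 1)
            exponents : 2^j ℕ.+ 2^j ℕ.+ e ℕ.≤ 2^ (+ n ℤ.- b)
            exponents = subst (λ x → 2^j ℕ.+ 2^j ℕ.+ e ℕ.≤ 2 ℕ.^ x) (≡-sym (codim-+ k≤n n≤k+1 r≤n b<r))
              (2^-exponents ∣ r ℤ.- 1ℤ ℤ.- b ∣ (codim≥ k≤n n≤k+1 r≤n b<r))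

        module _ (𝓘 : AbstractIntersectionProfile n) (isProfile : IsIntersectionProfileFor 𝓘 X)
                 (links : LinkSkeletons 𝓘) (global : GlobalSkeletons 𝓘) (h : Cₓ.C (+ n)) where

          fatData : FatData
          fatData = record
            { n = n ; n≤k+1 = n≤k+1 ; 𝓘 = 𝓘 ; isProfile = isProfile
            ; π = codimPower n ; π-pos = λ i → ^-pos (2^ (+ n ℤ.- i)) 0<κ ; π-mono = π-antitone
            -- `FatData` takes a predicate of level `0ℓ`; `True` brings the support of h down to it.
            ; A = λ x → True (lem {P = supp h x}) ; A-dim = λ x a → proj₁ (toWitness a) }

          private
            module Con = Fatness fatData
            module Sk = Skeletons fatData B B′ 0≤B 1≤B′
            module LG = LocalToGlobal fatData

            0≤/ : ∀ {B₀} e → 0# ≤ B₀ → 0# ≤ B₀ / κ ^ e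
            0≤/ e 0≤B₀ = *-nonNeg 0≤B₀ (proj₁ (⁻¹-pos (^-pos e 0<κ)))

            range : ∀ {t ℓ r b} → 𝒫 𝓘 (t , ℓ , r , b) → r ℤ.≤ + n × b ℤ.< r
            range p = let (_ , (_ , ℓ≤n) , _ , r≤ℓ) = Con.𝒫-dims p in
              ℤ.≤-trans r≤ℓ ℓ≤n , proj₁ (proj₂ (proj₂ (proj₂ (AbstractIntersectionProfile.𝒫-range 𝓘 p))))

            linkExpander : Sk.LinkExpander
            linkExpander t ℓ r u p -1<b = let (r≤n , b<r) = range p in
              _ , _ , 0≤/ ((2^ (+ k ℤ.+ 1ℤ ℤ.- r)) ℕ.* ((2^ (r ℤ.- 1ℤ ℤ.- dim u)) ℕ.∸ 1)) 0≤B ,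
              α≤π r≤n b<r , β*π≤ r≤n b<r 0≤B , links t ℓ r (dim u) p -1<b (u , [ ≡-refl ])

            globalExpander : Sk.GlobalExpander
            globalExpander t ℓ r p = let (r≤n , b<r) = range p in
              _ , _ , 0≤/ ((2^ (+ k ℤ.+ 1ℤ ℤ.- r)) ℕ.* ((2^ r) ℕ.∸ 1)) 0≤B′B ,
              α≤π r≤n b<r ,
              -- At b = -1 the exponent r - 1 - b of the local bound is the r of the global one.
              subst (λ s → (B′ * B) / κ ^ ((2^ (+ k ℤ.+ 1ℤ ℤ.- r)) ℕ.* ((2^ s) ℕ.∸ 1)) * codimPower n -1ℤ ≤
                           (B′ * B) * (codimPower n r * codimPower n r)) (cancel r) (β*π≤ r≤n b<r 0≤B′B) ,
              global t ℓ r -1ℤ p ≡-refl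
              where
              0≤B′B : 0# ≤ B′ * B
              0≤B′B = *-nonNeg (≤-trans 0≤1 1≤B′) 0≤B
              cancel : ∀ r → r ℤ.- 1ℤ ℤ.- -1ℤ ≡ r
              cancel = ℤ.solve-∀

          -- The last smallness hypothesis bounds B′ times the potential by the threshold of
          -- dimension -1; it replaces non-fatness at ∅.
          vanishing : ∀ {K η q} → 0# ≤ K → 0# < η → κ ≈ K * η → totalLoss (C * (1# + B + B)) * K ≤ ½ →
                      0# ≤ q → q * κ ≤ K * κ ^ (2 ℕ.^ n) → LocallyMinimal n q h → Cₓ.d h Cₓ.≈ᶜ Cₓ.0ᶜ →
                      (∀ u → 0ℤ ℤ.≤ dim u → dim u ℤ.≤ + n → Eᵤ._≤cbe_ u η (+ n ℤ.- dim u ℤ.- 1ℤ)) →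
                      B′ * (Γ * (κ * Eₓ.‖ h ‖)) ≤ κ ^ (2 ℕ.^ (n ℕ.+ 1)) →
                      h Cₓ.≈ᶜ Cₓ.0ᶜ
          vanishing {K} {η} {q} 0≤K 0<η κ≈Kη lossK≤½ 0≤q qκ≤ minimal dh≈0 cbe small =
            norm≤0⇒≈0 h (≤-respˡ (sym ‖h‖≈) (LG.wtA≤0 h (λ x → toWitness) (λ x → fromWitness) 0≤q (proj₁ 0<η) minimal dh≈0 cbe
              Sk.E Sk.0≤E (Sk.fewMeets linkExpander globalExpander smallV) K 0≤K (trans π-top κ≈Kη) qπ≤ 0<η lossK≤½))
            where
            ‖h‖≈ : Eₓ.‖ h ‖ ≈ wt (λ x → True (lem {P = supp h x}))
            ‖h‖≈ = LG.norm≈wtA h (λ x → toWitness) (λ x → fromWitness)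
            qπ≤ : q * codimPower n (+ n) ≤ K * codimPower n 0ℤ
            qπ≤ = ≤-respˡ (*-congˡ (sym π-top)) (subst (λ e → q * κ ≤ K * κ ^ (2 ℕ.^ e)) (≡-sym (ℕ.+-identityʳ n)) qκ≤)
            smallV : B′ * Con.V n ≤ codimPower n -1ℤ
            smallV = ≤-trans (*-monoʳ-≤ (≤-trans 0≤1 1≤B′) (≤-trans (Con.V≤ n)
              (≤-trans (*-monoˡ-≤ (*-nonNeg (Con.0≤π (+ n)) (wt-nonNeg _)) (^-mono-exp 1≤γ n≤k+1))
                (≤-reflexive (*-congˡ (*-cong π-top (sym ‖h‖≈))))))) small

      module _ {K η : |ℝ|} (0<K : 0# < K) (0<η : 0# < η) (κ≈Kη : κ ≈ K * η) (loss : totalLoss (C * (1# + B + B)) * K ≤ ½) where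

        cocycle-rigidity :
          (𝓘 : AbstractIntersectionProfile k) → IsIntersectionProfileFor 𝓘 X → LinkSkeletons 𝓘 → GlobalSkeletons 𝓘 →
          (∀ u → 0ℤ ℤ.≤ dim u → dim u ℤ.≤ + k → Eᵤ._≤cbe_ u η (+ k ℤ.- dim u ℤ.- 1ℤ)) →
          (∀ f → Cₓ.B (+ k) f → f Cₓ.≈ᶜ Cₓ.0ᶜ) →
          ∀ φ → Cₓ.d φ Cₓ.≈ᶜ Cₓ.0ᶜ → B′ * (Γ * (κ * Eₓ.‖ φ ‖)) ≤ κ ^ (2 ℕ.^ (k ℕ.+ 1)) → φ Cₓ.≈ᶜ Cₓ.0ᶜ
        cocycle-rigidity 𝓘 isProfile links global cbe B≡0 φ dφ≈0 small =
          vanishing ℕ.≤-refl (ℕ.m≤m+n k 1) 𝓘 isProfile links global φ (proj₁ 0<K) 0<η κ≈Kη loss (≤-refl {0#})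
            (≤-respˡ (sym (zeroˡ κ)) (*-nonNeg (proj₁ 0<K) (proj₁ (^-pos (2 ℕ.^ k) 0<κ)))) minimal dφ≈0 cbe small
          where
          -- The extension of a link coboundary is up to sign an element of Bᵏ, hence zero, so
          -- subtracting it changes nothing. `ℤ.pred (+ k)` covers k = 0 as well, where the
          -- primitive lives in degree -1.
          minimal : LocallyMinimal k 0# φ
          minimal u _ _ b b∈B =
            let (g , -b≈dg) = -ᶜ-as-d X o ℱ u (≡-sym (ℤ.suc-pred (+ k))) b b∈B
                -b≈0 = B≡0 (λ x → Cₓ.𝓕.-ᴹ_ (value x) (extendByZero X o ℱ u (+ k) b x)) (extendByZero X o ℱ u (ℤ.pred (+ k)) g , -b≈dg)
            in ≤-trans (≤-reflexive (norm-cong λ x → Cₓ.𝓕.≈ᴹ-sym (value x)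
                 (Cₓ.𝓕.≈ᴹ-trans (value x) (Cₓ.𝓕.+ᴹ-congˡ (value x) (-b≈0 x)) (Cₓ.𝓕.+ᴹ-identityʳ (value x) _))))
                 (x≤x+y (≤-reflexive (sym (zeroˡ (w u)))))

        normalForm⇒cocycle : IsOrientation R X o →
          (𝓘 : AbstractIntersectionProfile (k ℕ.+ 1)) → IsIntersectionProfileFor 𝓘 X → LinkSkeletons 𝓘 → GlobalSkeletons 𝓘 →
          (∀ u → 0ℤ ℤ.≤ dim u → dim u ℤ.≤ + k ℤ.+ 1ℤ → Eᵤ._≤cbe_ u η (+ k ℤ.- dim u)) →
          ∀ h → IsNormalForm (Eₓ.CorrectionStep k (K * κ ^ (2 ℕ.^ (k ℕ.+ 1) ℕ.∸ 1))) h →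
          B′ * (Γ * (κ * Eₓ.‖ Cₓ.d h ‖)) ≤ κ ^ (2 ℕ.^ (k ℕ.+ 1)) * κ ^ (2 ℕ.^ (k ℕ.+ 1)) → Cₓ.d h Cₓ.≈ᶜ Cₓ.0ᶜ
        normalForm⇒cocycle orientation 𝓘 isProfile links global cbe h nf small =
          let (𝓙 , isProfileᴶ , 𝓙⇒𝓘) = castProfile X k+1≡sk 𝓘 isProfile
          in vanishing (ℕ.n≤1+n k) (ℕ.≤-reflexive (≡-sym k+1≡sk)) 𝓙 isProfileᴶ
            (λ t ℓ r b p → links t ℓ r b (𝓙⇒𝓘 p)) (λ t ℓ r b p → global t ℓ r b (𝓙⇒𝓘 p)) (Cₓ.d h)
            (proj₁ 0<K) 0<η κ≈Kη loss (proj₁ 0<q)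
            -- q κ = K κ^(2^(k+1)), which is K π 0 for n = k+1: the choice of q makes the
            -- requirement an equality.
            (≤-reflexive (trans (*-assoc K _ κ) (*-congˡ (trans (*-comm _ κ) (trans (^-pred κ (k ℕ.+ 1))
              (reflexive (cong (λ n → κ ^ (2 ℕ.^ n)) k+1≡sk)))))))
            (normalForm⇒LocallyMinimal 0<q nf)
            (CoboundarySquared.d∘d lem X o orientation ℱ h)
            (λ u 0≤du du≤sk → subst (Eᵤ._≤cbe_ u η) (unsuc (+ k) (dim u))
              (cbe u 0≤du (subst (λ n → dim u ℤ.≤ + n) (≡-sym k+1≡sk) du≤sk)))
            (≤-respʳ (trans (sym (^-double κ k)) (reflexive (cong (λ n → κ ^ (2 ℕ.^ n)) (ℕ.+-suc k 1)))) small)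
          where
          k+1≡sk : k ℕ.+ 1 ≡ suc k
          k+1≡sk = ℕ.+-comm k 1
          0<q : 0# < K * κ ^ (2 ℕ.^ (k ℕ.+ 1) ℕ.∸ 1)
          0<q = *-pos 0<K (^-pos (2 ℕ.^ (k ℕ.+ 1) ℕ.∸ 1) 0<κ)
          unsuc : ∀ k a → k ℤ.- a ≡ (1ℤ ℤ.+ k) ℤ.- a ℤ.- 1ℤ
          unsuc = ℤ.solve-∀

    -- Cocycle codes

    module Codes (Σᴹ : Module R m ℓm)
      (𝓕≡Σ : ∀ (x : Face (+ k)) → Sheaf.𝓕 ℱ (value x) ≡ Σᴹ)
      (M M′ : |ℝ|) (0<M : 0# < M) (0<M′ : 0# < M′)
      (w≤M*w : ∀ (x y : Face (+ k)) → w (value x) ≤ M * w (value y))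
      (w≤M′*w : ∀ (x y : Face (+ suc k)) → w (value x) ≤ M′ * w (value y))
      where
      open CocycleCode X w o ℱ k Σᴹ 𝓕≡Σ
      open Module Σᴹ using () renaming (_≈ᴹ_ to _≈Σ_; Carrierᴹ to |Σ|)

      module Posₖ = Counting (+ k) ℤ.-≤+ (ℤ.≤-trans k≤sk sk≤K+2) M 0<M w≤M*w
      module Posₖ₊₁ = Counting (+ suc k) ℤ.-≤+ sk≤K+2 M′ 0<M′ w≤M′*w

      private
        -- Stated for an arbitrary module 𝓜 equal to Σᴹ, so that the equality can be matched with
        -- `≡-refl`.
        subst-≈ : ∀ {𝓜 : Module R m ℓm} (e : 𝓜 ≡ Σᴹ) {a b : |Σ|} → a ≈Σ b →
                  Module._≈ᴹ_ 𝓜 (subst Module.Carrierᴹ (≡-sym e) a) (subst Module.Carrierᴹ (≡-sym e) b)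
        subst-≈ ≡-refl p = p

        ≈-subst : ∀ {𝓜 : Module R m ℓm} (e : 𝓜 ≡ Σᴹ) {a b : |Σ|} →
                  Module._≈ᴹ_ 𝓜 (subst Module.Carrierᴹ (≡-sym e) a) (subst Module.Carrierᴹ (≡-sym e) b) → a ≈Σ b
        ≈-subst ≡-refl p = p

        subst-inverse : ∀ {𝓜 : Module R m ℓm} (e : 𝓜 ≡ Σᴹ) (a : Module.Carrierᴹ 𝓜) →
                        Module._≈ᴹ_ 𝓜 (subst Module.Carrierᴹ (≡-sym e) (subst Module.Carrierᴹ e a)) a
        subst-inverse {𝓜} ≡-refl a = Module.≈ᴹ-refl 𝓜

      toCochain-≐ : ∀ {f g} → toCochain f ≈ᶜ toCochain g → f ≐ʷ g
      toCochain-≐ e x = ≈-subst (𝓕≡Σ x) (e x)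

      toCochain∘fromCochain : ∀ h → toCochain (fromCochain h) ≈ᶜ h
      toCochain∘fromCochain h x = subst-inverse (𝓕≡Σ x) (h x)

      private
        diff≈0⇒≈ : ∀ {φ ψ : Cochain (+ k)} x → Cₓ.𝓕._≈ᴹ_ (value x) ((φ -ᶜ ψ) x) (Cₓ.𝓕.0ᴹ (value x)) → Cₓ.𝓕._≈ᴹ_ (value x) (φ x) (ψ x)
        diff≈0⇒≈ {φ} {ψ} x e = Cₓ.𝓕.≈ᴹ-trans (value x) (Cₓ.𝓕.≈ᴹ-sym (value x) (Cₓ.-ᶜ-+ᶜ φ ψ x))
          (Cₓ.𝓕.≈ᴹ-trans (value x) (Cₓ.𝓕.+ᴹ-congʳ (value x) e) (Cₓ.𝓕.+ᴹ-identityˡ (value x) _))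

      hamming≤norm : ∀ f g → hamming f g ≤ M * ‖ toCochain f -ᶜ toCochain g ‖
      hamming≤norm f g = ≤-trans (Posₖ.proportion≤weight (subset (faces (+ k)) (λ x → ¬ f x ≈Σ g x)))
        (*-monoʳ-≤ (proj₁ 0<M) (≤-respˡ (sym (∑-subset _ (faces (+ k)))) (≤-respʳ (sym (∑-subset _ (faces (+ k))))
          (∑-mono (faces (+ k)) λ x → mask-mono (λ f≉g e → f≉g (≈-subst (𝓕≡Σ x) (diff≈0⇒≈ {toCochain f} {toCochain g} x e)))
            (λ _ → 0≤w (value x)) (λ _ → ≤-refl)))))

      norm≤hamming : ∀ f g → ‖ toCochain f -ᶜ toCochain g ‖ ≤ M * hamming f g
      norm≤hamming f g = ≤-trans (≤-respˡ (sym (∑-subset _ (faces (+ k)))) (≤-respʳ (sym (∑-subset _ (faces (+ k))))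
          (∑-mono (faces (+ k)) λ x → mask-mono (λ s f≈g → s (Cₓ.𝓕.≈ᴹ-trans (value x) (Cₓ.𝓕.+ᴹ-congʳ (value x) (subst-≈ (𝓕≡Σ x) f≈g)) (Cₓ.𝓕.-ᴹ‿inverseʳ (value x) _)))
            (λ _ → 0≤w (value x)) (λ _ → ≤-refl))))
        (Posₖ.weight≤proportion (subset (faces (+ k)) (λ x → ¬ f x ≈Σ g x)))

      norm≤rejection : ∀ f → ‖ δ (toCochain f) ‖ ≤ M′ * rejectionProbability f
      norm≤rejection f = Posₖ₊₁.weight≤proportion (subset (faces (+ suc k)) (Supp (δ (toCochain f))))

      0≤hamming : ∀ f g → 0# ≤ hamming f g
      0≤hamming f g = Posₖ.proportion-nonNeg (subset (faces (+ k)) (λ x → ¬ f x ≈Σ g x))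

      hamming-mono : ∀ {f g f′ g′} → (∀ x → ¬ f x ≈Σ g x → ¬ f′ x ≈Σ g′ x) → hamming f g ≤ hamming f′ g′
      hamming-mono {f} {g} {f′} {g′} ne = *-monoˡ-≤ (proj₁ (⁻¹-pos Posₖ.0<N)) (fromℕ-mono
        (length-filter-mono (λ x → lem {P = ¬ f x ≈Σ g x}) (λ x → lem {P = ¬ f′ x ≈Σ g′ x}) (λ {x} → ne x) (faces (+ k))))

      Codeword : Pred Word ℓm
      Codeword f = δ (toCochain f) ≈ᶜ 0ᶜ

      fromCochain-Codeword : ∀ h → δ h ≈ᶜ 0ᶜ → Codeword (fromCochain h)
      fromCochain-Codeword h = Cₓ.≈ᶜ-trans (Cₓ.d-cong (toCochain∘fromCochain h))

      zeroWord : Word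
      zeroWord = fromCochain 0ᶜ

      zeroWord-Codeword : Codeword zeroWord
      zeroWord-Codeword = fromCochain-Codeword 0ᶜ (Cₓ.d-0 (Cₓ.≈ᶜ-refl {f = 0ᶜ}))

      distToCode≤ : ∀ f g → Codeword g → distToCode f ≤ hamming f g
      distToCode≤ f g cg = inf≤ (λ { (g , _ , e) → ≤-respʳ (sym e) (0≤hamming f g) }) (g , cg , refl)

      distToCode-attained : ∀ f {c} → distToCode f < c → ∃[ g ] Codeword g × hamming f g < c
      distToCode-attained f d<c = let (s , (g , cg , s≈) , s<c) = inf<⇒∃< (_ , zeroWord , zeroWord-Codeword , refl) d<c
        in g , cg , ≤-<-trans (≤-reflexive (sym s≈)) s<c

      d-Codeword : ∀ {f g} → Codeword f → Codeword g → δ (toCochain f -ᶜ toCochain g) ≈ᶜ 0ᶜ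
      d-Codeword {f} {g} cf cg = Cₓ.≈ᶜ-trans (Cₓ.d-sub (toCochain f) (toCochain g)) (Cₓ.≈ᶜ-trans (Cₓ.-ᶜ-zeroʳ cg) cf)

      -- Below κ = Kε, a = κ^(2^(k+1)), e = a/κ, and e₂ = a²/κ.
      module _ {K K′ κ a e e₂ B′ : |ℝ|} (0<K : 0# < K) (K≤1 : K ≤ 1#) (0<K′ : 0# < K′) (K′≤1 : K′ ≤ 1#)
               (K′CCΓ≈½K : K′ * (C * C * Γ) ≈ ½ * K) (0<κ : 0# < κ) (κ≤1 : κ ≤ 1#) (0<e : 0# < e) (0<a : 0# < a) (a≤1 : a ≤ 1#)
               (κe≈a : κ * e ≈ a) (e₂≈ae : e₂ ≈ a * e) (1≤B′ : 1# ≤ B′)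
               (rigid : ∀ (φ : Cochain (+ k)) → δ φ ≈ᶜ 0ᶜ → B′ * (Γ * (κ * ‖ φ ‖)) ≤ a → φ ≈ᶜ 0ᶜ)
               (kill : ∀ (h : Cochain (+ k)) → IsNormalForm (CorrectionStep k (K * e)) h →
                       B′ * (Γ * (κ * ‖ δ h ‖)) ≤ a * a → δ h ≈ᶜ 0ᶜ) where
        private
          q : |ℝ|
          q = K * e

          0<q : 0# < q
          0<q = *-pos 0<K 0<e

          0<B′ : 0# < B′
          0<B′ = <-≤-trans 0<1 1≤B′

          β : |ℝ|
          β = B′ ⁻¹

          0<β : 0# < β
          0<β = ⁻¹-pos 0<B′

          0≤K′ : 0# ≤ K′
          0≤K′ = proj₁ 0<K′

          0≤Γ : 0# ≤ Γ
          0≤Γ = ≤-trans 0≤1 1≤Γ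

          0≤a : 0# ≤ a
          0≤a = proj₁ 0<a

          K′CCΓ≤½ : K′ * (C * C * Γ) ≤ ½
          K′CCΓ≤½ = ≤-respˡ (sym K′CCΓ≈½K) (x*y≤x (proj₁ ½-pos) K≤1)

          K′Γ≤½ : K′ * Γ ≤ ½
          K′Γ≤½ = ≤-trans (*-monoʳ-≤ 0≤K′ (x≤y*x 0≤Γ (1≤x*y 1≤C 1≤C))) K′CCΓ≤½

          K′CΓ≤½ : K′ * (C * Γ) ≤ ½
          K′CΓ≤½ = ≤-trans (*-monoʳ-≤ 0≤K′ (*-monoˡ-≤ 0≤Γ (x≤y*x 0≤C 1≤C))) K′CCΓ≤½

          K′C≤K : K′ * C ≤ K
          K′C≤K = begin
            K′ * C  ≤⟨ *-monoʳ-≤ 0≤K′ (≤-trans (x≤y*x 0≤C 1≤C) (x≤x*y (*-nonNeg 0≤C 0≤C) 1≤Γ)) ⟩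
            K′ * (C * C * Γ)  ≈⟨ K′CCΓ≈½K ⟩
            ½ * K  ≤⟨ ½*x≤x (proj₁ 0<K) ⟩
            K  ∎

          cancel-B′ : ∀ {x y} → x ≤ β * y → B′ * (Γ * (κ * x)) ≤ Γ * (κ * y)
          cancel-B′ {x} {y} x≤ = begin
            B′ * (Γ * (κ * x))  ≤⟨ *-monoʳ-≤ (proj₁ 0<B′) (*-monoʳ-≤ 0≤Γ (*-monoʳ-≤ (proj₁ 0<κ) x≤)) ⟩
            B′ * (Γ * (κ * (β * y)))  ≈⟨ solve 5 (λ b g k c y → b :* (g :* (k :* (c :* y))) := b :* c :* (g :* (k :* y))) refl B′ Γ κ β y ⟩
            B′ * β * (Γ * (κ * y))  ≈⟨ trans (*-congʳ (*-inverseʳ (pos⇒≉0 0<B′))) (*-identityˡ _) ⟩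
            Γ * (κ * y)  ∎

          correct : ∀ {f h} → Star (CorrectionStep k q) f h → q * ‖ h -ᶜ f ‖ ≤ C * ‖ δ f ‖ × ‖ δ h ‖ ≤ ‖ δ f ‖
          correct {f} {h} s = ≤-trans (x≤x+y (*-nonNeg 0≤C (norm-nonNeg (δ h)))) (steps-bound 0<q s) ,
            *-cancelˡ-≤ (<-≤-trans 0<1 1≤C) (≤-trans (x≤y+x (*-nonNeg (proj₁ 0<q) (norm-nonNeg (h -ᶜ f)))) (steps-bound 0<q s))

          correct-kill : ∀ {f h} → Star (CorrectionStep k q) f h → IsNormalForm (CorrectionStep k q) h →
                         B′ * (Γ * (κ * ‖ δ f ‖)) ≤ a * a → δ h ≈ᶜ 0ᶜ
          correct-kill {f} {h} s nf small = kill h nf (≤-trans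
            (*-monoʳ-≤ (proj₁ 0<B′) (*-monoʳ-≤ 0≤Γ (*-monoʳ-≤ (proj₁ 0<κ) (proj₂ (correct s))))) small)

        -- The difference of two codewords is a cocycle. If they were closer, B′ Γ κ times its norm
        -- would be at most K′ Γ a ≤ a, and `rigid` would make it zero. The factor 1 / M converts
        -- Hamming distance into weight.
        relativeDistance : ((1# / M) * B′ ⁻¹ * K′ * e) ≤relativeDistance
        relativeDistance (f , g , cf , cg , f≭g , s≈) = ≤-respʳ (sym s≈) (≮⇒≥ λ close → f≭g (toCochain-≐
          (Cₓ.-‿≈0⇒≈ (rigid (toCochain f -ᶜ toCochain g) (d-Codeword {f} {g} cf cg) (≤-trans (cancel-B′ (near close)) (begin
            Γ * (κ * (K′ * e))  ≈⟨ solve 4 (λ g k k′ e → g :* (k :* (k′ :* e)) := k′ :* g :* (k :* e)) refl Γ κ K′ e ⟩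
            K′ * Γ * (κ * e)  ≤⟨ *-mono-≤ 0≤1 (≤-respʳ (sym κe≈a) 0≤a) (≤-trans K′Γ≤½ ½≤1) (≤-reflexive κe≈a) ⟩
            1# * a  ≈⟨ *-identityˡ a ⟩
            a  ∎))))))
          where
          near : hamming f g < (1# / M) * β * K′ * e → ‖ toCochain f -ᶜ toCochain g ‖ ≤ β * (K′ * e)
          near close = begin
            ‖ toCochain f -ᶜ toCochain g ‖  ≤⟨ norm≤hamming f g ⟩
            M * hamming f g  ≤⟨ *-monoʳ-≤ (proj₁ 0<M) (proj₁ close) ⟩
            M * ((1# / M) * β * K′ * e)  ≈⟨ solve 5 (λ m i b k e → m :* (i :* b :* k :* e) := i :* m :* (b :* (k :* e))) refl M (1# / M) β K′ e ⟩
            1# / M * M * (β * (K′ * e))  ≈⟨ trans (*-congʳ (x/y*y≈x 0<M)) (*-identityˡ _) ⟩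
            β * (K′ * e)  ∎

        private
          0≤e₂ : 0# ≤ e₂
          0≤e₂ = ≤-respʳ (sym e₂≈ae) (*-nonNeg 0≤a (proj₁ 0<e))

          -- If ‖δ φ‖ is below the threshold of `kill`, the algorithm ends at a codeword at weighted
          -- distance at most C ‖δ φ‖ / q. Otherwise ‖δ φ‖ is at least e₂ / (B′ Γ), and the trivial
          -- bound 1 on the distance suffices; this case accounts for B′ and for the exponent of e₂.
          rejection-bound : ∀ f → β * (K′ * e₂) * distToCode f ≤ rejectionProbability f * (M * M′)
          rejection-bound f = by-cases lem
            where
            φ : Cochain (+ k)
            φ = toCochain f
            scale : ‖ δ φ ‖ * M ≤ rejectionProbability f * (M * M′)
            scale = ≤-respʳ (solve 3 (λ m r n → n :* r :* m := r :* (m :* n)) refl M (rejectionProbability f) M′)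
              (*-monoˡ-≤ (proj₁ 0<M) (norm≤rejection f))
            by-cases : Dec (B′ * (Γ * (κ * ‖ δ φ ‖)) ≤ a * a) → β * (K′ * e₂) * distToCode f ≤ rejectionProbability f * (M * M′)
            by-cases (yes small) =
              let (h , s , nf) = normalForm-exists 0<q φ
                  dh≈0 = correct-kill s nf small
                  x = ‖ h -ᶜ φ ‖
                  f′ = fromCochain h
                  hamming≤ : hamming f′ f ≤ M * x
                  hamming≤ = ≤-trans (hamming≤norm f′ f) (≤-reflexive (*-congˡ (norm-cong λ y → Cₓ.𝓕.+ᴹ-congʳ (value y) (toCochain∘fromCochain h y))))
                  K′e₂x≤ : K′ * e₂ * x ≤ ‖ δ φ ‖
                  K′e₂x≤ = *-cancelˡ-≤ (<-≤-trans 0<1 1≤C) (begin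
                    C * (K′ * e₂ * x)  ≈⟨ *-congˡ (*-congʳ (*-congˡ e₂≈ae)) ⟩
                    C * (K′ * (a * e) * x)  ≈⟨ solve 5 (λ c k a e x → c :* (k :* (a :* e) :* x) := (k :* c) :* (e :* x) :* a) refl C K′ a e x ⟩
                    K′ * C * (e * x) * a  ≤⟨ x*y≤x (*-nonNeg (*-nonNeg 0≤K′ 0≤C) (*-nonNeg (proj₁ 0<e) (norm-nonNeg _))) a≤1 ⟩
                    K′ * C * (e * x)  ≤⟨ *-monoˡ-≤ (*-nonNeg (proj₁ 0<e) (norm-nonNeg _)) K′C≤K ⟩
                    K * (e * x)  ≈⟨ *-assoc K e x ⟨
                    q * x  ≤⟨ proj₁ (correct s) ⟩
                    C * ‖ δ φ ‖  ∎)
              in begin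
                β * (K′ * e₂) * distToCode f  ≤⟨ *-monoʳ-≤ 0≤βK′e₂ (≤-trans (distToCode≤ f f′ (fromCochain-Codeword h dh≈0)) (≤-trans (hamming-mono {f} {f′} {f′} {f} λ x ne p → ne (Module.≈ᴹ-sym Σᴹ p)) hamming≤)) ⟩
                β * (K′ * e₂) * (M * x)  ≈⟨ solve 4 (λ b k m x → b :* k :* (m :* x) := b :* (k :* x :* m)) refl β (K′ * e₂) M x ⟩
                β * (K′ * e₂ * x * M)  ≤⟨ y*x≤x (*-nonNeg (*-nonNeg (*-nonNeg 0≤K′ 0≤e₂) (norm-nonNeg _)) (proj₁ 0<M)) (⁻¹-≤1 1≤B′) ⟩
                K′ * e₂ * x * M  ≤⟨ *-monoˡ-≤ (proj₁ 0<M) K′e₂x≤ ⟩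
                ‖ δ φ ‖ * M  ≤⟨ scale ⟩
                rejectionProbability f * (M * M′) ∎
              where
              0≤βK′e₂ : 0# ≤ β * (K′ * e₂)
              0≤βK′e₂ = *-nonNeg (proj₁ 0<β) (*-nonNeg 0≤K′ 0≤e₂)
            by-cases (no ¬small) = begin
              β * (K′ * e₂) * distToCode f  ≤⟨ x*y≤x (*-nonNeg (proj₁ 0<β) (*-nonNeg 0≤K′ 0≤e₂))
                        (≤-trans (distToCode≤ f zeroWord zeroWord-Codeword) (Posₖ.proportion≤1 _)) ⟩
              β * (K′ * e₂)  ≤⟨ *-monoʳ-≤ (proj₁ 0<β) (*-monoʳ-≤ 0≤K′ e₂≤) ⟩
              β * (K′ * (B′ * (Γ * y)))  ≈⟨ solve 5 (λ b k c g y → b :* (k :* (c :* (g :* y))) := c :* b :* (k :* g :* y)) refl β K′ B′ Γ y ⟩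
              B′ * β * (K′ * Γ * y)  ≈⟨ trans (*-congʳ (*-inverseʳ (pos⇒≉0 0<B′))) (*-identityˡ _) ⟩
              K′ * Γ * y  ≤⟨ y*x≤x (norm-nonNeg _) (≤-trans K′Γ≤½ ½≤1) ⟩
              y  ≤⟨ x≤x*y (norm-nonNeg _) Posₖ.1≤M ⟩
              y * M  ≤⟨ scale ⟩
              rejectionProbability f * (M * M′) ∎
              where
              y : |ℝ|
              y = ‖ δ φ ‖
              e₂≤ : e₂ ≤ B′ * (Γ * y)
              e₂≤ = *-cancelʳ-≤ 0<κ (begin
                e₂ * κ  ≈⟨ trans (*-congʳ e₂≈ae) (trans (*-assoc a e κ) (*-congˡ (trans (*-comm e κ) κe≈a))) ⟩
                a * a  ≤⟨ proj₁ (≰⇒> ¬small) ⟩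
                B′ * (Γ * (κ * y))  ≈⟨ solve 4 (λ b g k y → b :* (g :* (k :* y)) := b :* (g :* y) :* k) refl B′ Γ κ y ⟩
                B′ * (Γ * y) * κ  ∎)

        soundness : HasSoundness rejectionProbability ((1# / (M * M′)) * B′ ⁻¹ * K′ * e₂)
        soundness f = *-cancelʳ-≤ (*-pos 0<M 0<M′) (≤-respˡ (sym (begin-equality
          (1# / (M * M′)) * β * K′ * e₂ * distToCode f * (M * M′)
            ≈⟨ solve 6 (λ i b k e t m → i :* b :* k :* e :* t :* m := i :* m :* (b :* (k :* e) :* t)) refl (1# / (M * M′)) β K′ e₂ (distToCode f) (M * M′) ⟩
          1# / (M * M′) * (M * M′) * (β * (K′ * e₂) * distToCode f)
            ≈⟨ trans (*-congʳ (x/y*y≈x (*-pos 0<M 0<M′))) (*-identityˡ _) ⟩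
          β * (K′ * e₂) * distToCode f ∎)) (rejection-bound f))

        private
          radius : |ℝ|
          radius = (B′ ⁻¹ * K′ ^ 2 * e₂) / (M * (1# + K′ * a))

          M*radius≤ : M * radius ≤ β * (K′ * K′ * (a * e))
          M*radius≤ = begin
            M * radius  ≤⟨ *-monoˡ-≤ 0≤radius (x≤x*y (proj₁ 0<M) (x≤x+y (*-nonNeg 0≤K′ 0≤a))) ⟩
            M * (1# + K′ * a) * radius  ≈⟨ trans (*-comm _ _) (x/y*y≈x 0<denominator) ⟩
            β * K′ ^ 2 * e₂  ≈⟨ *-cong (*-congˡ (*-congˡ (*-identityʳ K′))) e₂≈ae ⟩
            β * (K′ * K′) * (a * e)  ≈⟨ *-assoc _ _ _ ⟩
            β * (K′ * K′ * (a * e))  ∎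
            where
            0<denominator : 0# < M * (1# + K′ * a)
            0<denominator = *-pos 0<M (<-≤-trans 0<1 (x≤x+y (*-nonNeg 0≤K′ 0≤a)))
            0≤radius : 0# ≤ radius
            0≤radius = *-nonNeg (*-nonNeg (*-nonNeg (proj₁ 0<β) (proj₁ (^-pos 2 0<K′))) 0≤e₂) (proj₁ (⁻¹-pos 0<denominator))

          -- The distance from h to g is split at the received word φ. Correction moves φ by at most
          -- (C / q) ‖δ φ‖ ≤ (C² / q) ‖φ - g‖, which explains C C Γ and K in `K′`; each of the two
          -- parts uses up at most ½ a of the bound a in `rigid`.
          decodes-to : ∀ {f g h} → Codeword g → hamming f g < radius →
                       Star (CorrectionStep k q) (toCochain f) h → IsNormalForm (CorrectionStep k q) h →
                       δ h ≈ᶜ 0ᶜ × h ≈ᶜ toCochain g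
          decodes-to {f} {g} {h} cg close s nf = dh≈0 , Cₓ.-‿≈0⇒≈ (rigid (h -ᶜ γ₀)
              (Cₓ.≈ᶜ-trans (Cₓ.d-sub h γ₀) (Cₓ.≈ᶜ-trans (Cₓ.-ᶜ-zeroʳ cg) dh≈0)) (begin
            B′ * (Γ * (κ * ‖ h -ᶜ γ₀ ‖))  ≤⟨ *-monoʳ-≤ (proj₁ 0<B′) (*-monoʳ-≤ 0≤Γ (*-monoʳ-≤ (proj₁ 0<κ) (norm-triangle h φ γ₀))) ⟩
            B′ * (Γ * (κ * (x + y)))  ≈⟨ solve 5 (λ b g k x y → b :* (g :* (k :* (x :+ y))) := b :* (g :* (k :* x)) :+ b :* (g :* (k :* y))) refl B′ Γ κ x y ⟩
            B′ * (Γ * (κ * x)) + B′ * (Γ * (κ * y))  ≤⟨ +-mono-≤ x-small y-small ⟩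
            ½ * a + ½ * a  ≈⟨ ½+½ a ⟩
            a  ∎))
            where
            φ γ₀ : Cochain (+ k)
            φ = toCochain f
            γ₀ = toCochain g
            x y : |ℝ|
            x = ‖ h -ᶜ φ ‖
            y = ‖ φ -ᶜ γ₀ ‖
            y≤ : y ≤ β * (K′ * K′ * (a * e))
            y≤ = ≤-trans (norm≤hamming f g) (≤-trans (*-monoʳ-≤ (proj₁ 0<M) (proj₁ close)) M*radius≤)
            dφ≤ : ‖ δ φ ‖ ≤ β * (C * (K′ * K′ * (a * e)))
            dφ≤ = begin
              ‖ δ φ ‖  ≈⟨ norm-cong (Cₓ.≈ᶜ-sym (Cₓ.≈ᶜ-trans (Cₓ.d-sub φ γ₀) (Cₓ.-ᶜ-zeroʳ cg))) ⟩
              ‖ δ (φ -ᶜ γ₀) ‖  ≤⟨ d-bounded (φ -ᶜ γ₀) ⟩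
              C * y  ≤⟨ *-monoʳ-≤ 0≤C y≤ ⟩
              C * (β * (K′ * K′ * (a * e)))  ≈⟨ solve 3 (λ c b t → c :* (b :* t) := b :* (c :* t)) refl C β _ ⟩
              β * (C * (K′ * K′ * (a * e)))  ∎
            dh≈0 : δ h ≈ᶜ 0ᶜ
            dh≈0 = correct-kill s nf (≤-trans (cancel-B′ dφ≤) (begin
              Γ * (κ * (C * (K′ * K′ * (a * e))))  ≈⟨ solve 6 (λ g k c k′ a e → g :* (k :* (c :* (k′ :* k′ :* (a :* e)))) := k′ :* (c :* g) :* k′ :* (a :* (k :* e)))
                        refl Γ κ C K′ a e ⟩
              K′ * (C * Γ) * K′ * (a * (κ * e))  ≈⟨ *-congˡ (*-congˡ κe≈a) ⟩
              K′ * (C * Γ) * K′ * (a * a)  ≤⟨ y*x≤x (*-nonNeg 0≤a 0≤a) (≤-trans (x*y≤x (*-nonNeg 0≤K′ (*-nonNeg 0≤C 0≤Γ)) K′≤1) (≤-trans K′CΓ≤½ ½≤1)) ⟩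
              a * a  ∎))
            Γx≤ : Γ * x ≤ β * (½ * (K′ * a))
            Γx≤ = *-cancelˡ-≤ 0<q (begin
              q * (Γ * x)  ≈⟨ solve 3 (λ q g x → q :* (g :* x) := g :* (q :* x)) refl q Γ x ⟩
              Γ * (q * x)  ≤⟨ *-monoʳ-≤ 0≤Γ (≤-trans (proj₁ (correct s)) (*-monoʳ-≤ 0≤C dφ≤)) ⟩
              Γ * (C * (β * (C * (K′ * K′ * (a * e)))))  ≈⟨ solve 6 (λ g c b k a e → g :* (c :* (b :* (c :* (k :* k :* (a :* e))))) := k :* (c :* c :* g) :* (b :* (k :* a) :* e))
                        refl Γ C β K′ a e ⟩
              K′ * (C * C * Γ) * (β * (K′ * a) * e)  ≈⟨ *-congʳ K′CCΓ≈½K ⟩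
              ½ * K * (β * (K′ * a) * e)  ≈⟨ solve 6 (λ h k b k′ a e → h :* k :* (b :* (k′ :* a) :* e) := k :* e :* (b :* (h :* (k′ :* a)))) refl ½ K β K′ a e ⟩
              q * (β * (½ * (K′ * a)))  ∎)
            x-small : B′ * (Γ * (κ * x)) ≤ ½ * a
            x-small = begin
              B′ * (Γ * (κ * x))  ≈⟨ solve 4 (λ b g k x → b :* (g :* (k :* x)) := b :* (k :* (g :* x))) refl B′ Γ κ x ⟩
              B′ * (κ * (Γ * x))  ≤⟨ *-monoʳ-≤ (proj₁ 0<B′) (*-monoʳ-≤ (proj₁ 0<κ) Γx≤) ⟩
              B′ * (κ * (β * (½ * (K′ * a))))  ≈⟨ solve 6 (λ b k c h k′ a → b :* (k :* (c :* (h :* (k′ :* a)))) := b :* c :* (k :* (k′ :* (h :* a)))) refl B′ κ β ½ K′ a ⟩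
              B′ * β * (κ * (K′ * (½ * a)))  ≈⟨ trans (*-congʳ (*-inverseʳ (pos⇒≉0 0<B′))) (*-identityˡ _) ⟩
              κ * (K′ * (½ * a))  ≤⟨ y*x≤x (*-nonNeg 0≤K′ 0≤½a) κ≤1 ⟩
              K′ * (½ * a)  ≤⟨ y*x≤x 0≤½a K′≤1 ⟩
              ½ * a  ∎
              where
              0≤½a : 0# ≤ ½ * a
              0≤½a = *-nonNeg (proj₁ ½-pos) 0≤a
            y-small : B′ * (Γ * (κ * y)) ≤ ½ * a
            y-small = ≤-trans (cancel-B′ y≤) (begin
              Γ * (κ * (K′ * K′ * (a * e)))  ≈⟨ solve 5 (λ g k k′ a e → g :* (k :* (k′ :* k′ :* (a :* e))) := k′ :* g :* (k′ :* (a :* (k :* e)))) refl Γ κ K′ a e ⟩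
              K′ * Γ * (K′ * (a * (κ * e)))  ≈⟨ *-congˡ (*-congˡ (*-congˡ κe≈a)) ⟩
              K′ * Γ * (K′ * (a * a))  ≤⟨ *-mono-≤ (proj₁ ½-pos) (*-nonNeg 0≤K′ (*-nonNeg 0≤a 0≤a)) K′Γ≤½
                        (≤-trans (y*x≤x (*-nonNeg 0≤a 0≤a) K′≤1) (x*y≤x 0≤a a≤1)) ⟩
              ½ * a  ∎)

        -- Any codeword within the radius may play the part of g for the same run, so all of them
        -- equal the output; this gives uniqueness. The one supplied by `distToCode-attained` shows
        -- that the output is close to f.
        decoding : IsDecodingAlgorithm (Halts q) (Outputs q) ((B′ ⁻¹ * K′ ^ 2 * e₂) / (M * (1# + K′ * a)))
        decoding f close = terminates 0<q (toCochain f) , λ { f′ (h , s , nf , ≡-refl) →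
          let (g , cg , f-g) = distToCode-attained f close
              (dh≈0 , h≈g) = decodes-to {f} {g} cg f-g s nf
              f′≈h = toCochain∘fromCochain h
              hamming≤ : hamming f (fromCochain h) ≤ hamming f g
              hamming≤ = hamming-mono {f} {fromCochain h} {f} {g} λ x f≉h f≈g → f≉h (Module.≈ᴹ-trans Σᴹ f≈g
                (≈-subst (𝓕≡Σ x) (Cₓ.𝓕.≈ᴹ-sym (value x) (Cₓ.𝓕.≈ᴹ-trans (value x) (f′≈h x) (h≈g x)))))
          in fromCochain-Codeword h dh≈0 , ≤-<-trans hamming≤ f-g , λ f″ cf″ close″ →
            toCochain-≐ (Cₓ.≈ᶜ-trans (Cₓ.≈ᶜ-sym (proj₂ (decodes-to {f} {f″} cf″ close″ s nf))) (Cₓ.≈ᶜ-sym f′≈h)) }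

        codeParameters :
          ((1# / M) * B′ ⁻¹ * K′ * e) ≤relativeDistance ×
          HasSoundness rejectionProbability ((1# / (M * M′)) * B′ ⁻¹ * K′ * e₂) ×
          IsDecodingAlgorithm (Halts q) (Outputs q) ((B′ ⁻¹ * K′ ^ 2 * e₂) / (M * (1# + K′ * a)))
        codeParameters = relativeDistance , soundness , decoding

corollary8p5 :
  ∀ {r ℓr m ℓm} (lem : ∀ {ℓ} → ExcludedMiddle ℓ) (ℝ : CompleteOrderedField) →
  let open CompleteOrderedField ℝ hiding (_-_)
      open Classical lem ℝ
  in
  ∀ (B : Carrier) (F : ℕ) (L : Carrier) (k : ℕ) →
  0# < B → 1 ℕ.≤ F → 1# ≤ L →
  ∃₂ λ (K K′ : Carrier) →
    (0# < K × K ≤ 1#) × (0# < K′ × K′ ≤ 1#) ×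
    (∀ (R : CommutativeRing r ℓr) (d : ℕ) → k ℕ.+ 2 ℕ.≤ d →
     (X : GradedPoset) → GradedPoset.IsDPoset X d →
     let module X = GradedPoset X in
     (w : X.Carrier → Carrier) → IsProperWeight d X w →
     (o : X.Carrier → X.Carrier → CommutativeRing.Carrier R) → IsOrientation R X o →
     irregularity d X ≤ L →
     (∀ i j → -1ℤ ℤ.≤ i → i ℤ.≤ j → j ℤ.≤ + k ℤ.+ + 2 → X.Fᵐᵃˣ -1ℤ i j ℕ.≤ F) →
     (𝓘 : AbstractIntersectionProfile k) → IsIntersectionProfileFor 𝓘 X →
     (𝓘′ : AbstractIntersectionProfile (k ℕ.+ 1)) → IsIntersectionProfileFor 𝓘′ X →
     (ℱ : Sheaf R X m ℓm) (ε B′ : Carrier) →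
     0# < ε → ε ≤ 1# → 1# ≤ B′ →
     let Kε = K * ε
         module H = Cohomology X o ℱ
         open AbstractIntersectionProfile using (𝒫)
         _≤cbe[_]_ = λ (c : Carrier) (u : X.Carrier) (i : ℤ) →
           Expansion._≤cbe_ (link X u) (linkWeight d X u w)
             (linkOrientation {R = R} X u o) (linkSheaf X u ℱ) c i
     in
     (∀ u → 0ℤ ℤ.≤ X.dim u → X.dim u ℤ.≤ + k → ε ≤cbe[ u ] (+ k ℤ.- X.dim u ℤ.- 1ℤ)) →
     (∀ u → 0ℤ ℤ.≤ X.dim u → X.dim u ℤ.≤ + k ℤ.+ 1ℤ → ε ≤cbe[ u ] (+ k ℤ.- X.dim u)) →
     (∀ t ℓ r b → (𝒫 𝓘 ∪ 𝒫 𝓘′) (t , ℓ , r , b) → -1ℤ ℤ.< b → (u : X.Face b) →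
       IsSkeletonExpander (linkNIH d X w (value u) ℓ r t)
         (Kε ^ (2^ (+ k ℤ.+ 1ℤ ℤ.- r)))
         (B / Kε ^ ((2^ (+ k ℤ.+ 1ℤ ℤ.- r)) ℕ.* ((2^ (r ℤ.- 1ℤ ℤ.- b)) ℕ.∸ 1)))) →
     (∀ t ℓ r b → (𝒫 𝓘 ∪ 𝒫 𝓘′) (t , ℓ , r , b) → b ≡ -1ℤ →
       IsSkeletonExpander (NIH X w ℓ r t)
         (Kε ^ (2^ (+ k ℤ.+ 1ℤ ℤ.- r)))
         ((B′ * B) / Kε ^ ((2^ (+ k ℤ.+ 1ℤ ℤ.- r)) ℕ.* ((2^ r) ℕ.∸ 1)))) →
     (∀ f → H.B (+ k) f → f H.≈ᶜ H.0ᶜ) →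
     (S : Module R m ℓm) → IsFiniteModule S →
     (𝓕≡S : ∀ (x : X.Face (+ k)) → Sheaf.𝓕 ℱ (value x) ≡ S) →
     (M M′ : Carrier) → 0# < M → 0# < M′ →
     (∀ (x y : X.Face (+ k)) → w (value x) ≤ M * w (value y)) →
     (∀ (x y : X.Face (+ k ℤ.+ 1ℤ)) → w (value x) ≤ M′ * w (value y)) →
     let open CocycleCode X w o ℱ k S 𝓕≡S
         q = K * Kε ^ (2 ℕ.^ (k ℕ.+ 1) ℕ.∸ 1)
     in
     ((1# / M) * B′ ⁻¹ * K′ * Kε ^ (2 ℕ.^ (k ℕ.+ 1) ℕ.∸ 1)) ≤relativeDistance
     × HasSoundness rejectionProbability
         ((1# / (M * M′)) * B′ ⁻¹ * K′ * Kε ^ (2 ℕ.^ (k ℕ.+ 2) ℕ.∸ 1))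
     × IsDecodingAlgorithm (Halts q) (Outputs q)
         ((B′ ⁻¹ * K′ ^ 2 * Kε ^ (2 ℕ.^ (k ℕ.+ 2) ℕ.∸ 1))
          / (M * (1# + K′ * Kε ^ (2 ℕ.^ (k ℕ.+ 1))))))
corollary8p5 lem ℝ B F L k 0<B 1≤F 1≤L =
  K , K′ , (0<K , K≤1) , (0<K′ , K′≤1) ,
  λ R d k+2≤d X isDPoset w proper o orientation irregularity≤L Fᵐᵃˣ≤F 𝓘 isProfile 𝓘′ isProfile′ ℱ η B′ 0<η η≤1 1≤B′
    cbe cbe′ links globals B≡0 Σᴹ _ 𝓕≡Σ M M′ 0<M 0<M′ w≤M*w w≤M′*w →
  let
    S : WeightedPoset lem ℝ
    S = record
      { X = X ; d = d ; isDPoset = isDPoset ; w = w ; proper = proper ; L = L ; 1≤L = 1≤L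
      ; ratio≤L = λ p q r → ≤-trans (ratio≤irregularity lem ℝ d X p q r) irregularity≤L
      ; k = k ; k+2≤d = k+2≤d ; F = F ; 1≤F = 1≤F ; Fᵐᵃˣ≤F = Fᵐᵃˣ≤F }
    κ = K * η
    0<κ = *-pos 0<K 0<η
    κ≤1 = ≤-trans (x*y≤x (proj₁ 0<K) η≤1) K≤1
    -- Identifies dimension `+ suc k`, used in the proof, with `+ k ℤ.+ 1ℤ` in the hypothesis on M′.
    toFace′ = GradedPoset.cast X (cong +_ (ℕ.+-comm 1 k))
  in
    Weighted.Cocycles.Codes.codeParameters lem ℝ S o ℱ Σᴹ 𝓕≡Σ M M′ 0<M 0<M′ w≤M*w
      (λ x y → w≤M′*w (toFace′ x) (toFace′ y))
      0<K K≤1 0<K′ K′≤1 K′CCΓ≈½K 0<κ κ≤1 (^-pos (2 ℕ.^ (k ℕ.+ 1) ℕ.∸ 1) 0<κ)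
      (^-pos (2 ℕ.^ (k ℕ.+ 1)) 0<κ) (^-≤1 (2 ℕ.^ (k ℕ.+ 1)) 0<κ κ≤1) (^-pred κ (k ℕ.+ 1)) (^-double-pred κ k) 1≤B′
      (Weighted.Cocycles.Vanishing.cocycle-rigidity lem ℝ S o ℱ κ 0<κ κ≤1 B B′ (proj₁ 0<B) 1≤B′ 0<K 0<η refl loss*K≤½
        𝓘 isProfile (λ t ℓ r b p → links t ℓ r b (inj₁ p)) (λ t ℓ r b p → globals t ℓ r b (inj₁ p)) cbe B≡0)
      (Weighted.Cocycles.Vanishing.normalForm⇒cocycle lem ℝ S o ℱ κ 0<κ κ≤1 B B′ (proj₁ 0<B) 1≤B′ 0<K 0<η refl loss*K≤½ orientation
        𝓘′ isProfile′ (λ t ℓ r b p → links t ℓ r b (inj₂ p)) (λ t ℓ r b p → globals t ℓ r b (inj₂ p)) cbe′)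
  where
  open Reals lem ℝ
  open Parameters lem ℝ B 0<B F 1≤F L 1≤L k
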